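{- Let $d\ge 0$ be an integer and let $G$ be a $d$-regular graph that contains no $4$-cycle. If $G$ is not super-edge-connected, then $\varphi(G)=d+1$.
   Context: All graphs are finite, simple (undirected, loopless, without multiple edges) and have at least one vertex; they are not assumed connected. "Contains no $4$-cycle" means that $G$ has no subgraph (induced or not) isomorphic to the cycle $C_4$. A (proper vertex) coloring of $G$ is a function $f:V(G)\to C$ into a set $C$ of colors such that $f(u)\ne f(v)$ for every edge $\{u,v\}$. A b-coloring is a coloring $f:V(G)\to C$ such that for each $c\in C$ there is a vertex $v$ with $f(v)=c$ and $f(N_G(v))=C\setminus\{c\}$, where $N_G(v)$ is the set of neighbors of $v$. The b-chromatic number $\varphi(G)$ is the maximum cardinality of a set $C$ for which a b-coloring $f:V(G)\to C$ exists. The edge connectivity $\lambda(G)$ is the minimum cardinality of a subset $U$ of $E(G)$ such that $G\setminus U$ (the graph obtained by deleting the edges in $U$) is either disconnected or a graph with only one vertex. An edge-cut of $G$ is a subset of $E(G)$ whose deletion from $G$ yields a disconnected graph (so $\varnothing$ is an edge-cut if $G$ is disconnected). A minimum edge-cut is an edge-cut of cardinality $\lambda(G)$. A $d$-regular graph $G$ is called super-edge-connected if $\lambda(G)=d$ and every minimum edge-cut of $G$ is the set of all edges incident with some vertex of $G$. -}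

module Defs where

open import Data.Fin using (Fin; toℕ)
open import Data.Fin.Properties using (_≟_; _<?_; all?)
open import Data.List using (length; filter; allFin; cartesianProduct)
open import Data.Nat as ℕ using (ℕ; _≤_; _%_)
open import Data.Product using (∃; _×_; _,_; proj₁; proj₂)
open import Data.Sum as Sum using (_⊎_)
open import Function.Definitions using (Injective)
open import Level using (Level; 0ℓ)
open import Relation.Binary.Core using (Rel; _⇒_; _⇔_; _=[_]⇒_)
open import Relation.Binary.Construct.Closure.ReflexiveTransitive using (Star)
open import Relation.Binary.Definitions using (Decidable; Irreflexive; Symmetric)
open import Relation.Binary.PropositionalEquality using (_≡_; _≢_; refl)
open import Relation.Nullary using (¬_; ¬?)
open import Relation.Nullary.Decidable using (_×-dec_; _⊎-dec_; from-yes)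
open import Relation.Unary using (Pred; _≐_; ∁; ｛_｝)

private
  variable
    ℓ : Level
    m n : ℕ

IsMinimum : Pred ℕ ℓ → Pred ℕ ℓ
IsMinimum P k = P k × (∀ {j} → P j → k ≤ j)

IsMaximum : Pred ℕ ℓ → Pred ℕ ℓ
IsMaximum P k = P k × (∀ {j} → P j → j ≤ k)

-- Finite simple graphs on the vertex set Fin n.  Adjacency is decidable, as
-- befits a finite graph; n = 0 is not excluded here.
record Graph (n : ℕ) : Set₁ where
  infix 4 _~_ _~?_
  field
    _~_    : Rel (Fin n) 0ℓ
    _~?_   : Decidable _~_
    sym    : Symmetric _~_
    irrefl : Irreflexive _≡_ _~_

degree : Graph n → Fin n → ℕ
degree {n} G v = length (filter (v ~?_) (allFin n))
  where open Graph G

Regular : ℕ → Graph n → Set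
Regular d G = ∀ v → degree G v ≡ d

-- H is isomorphic to a (not necessarily induced) subgraph of G.
Contains : Graph n → Graph m → Set
Contains G H = ∃ λ f → Injective _≡_ _≡_ f × Graph._~_ H =[ f ]⇒ Graph._~_ G

C₄ : Graph 4
C₄ = record
  { _~_    = _~_
  ; _~?_   = _~?_
  ; sym    = Sum.swap
  ; irrefl = λ { {i} refl → from-yes (all? λ i → ¬? (i ~? i)) i }
  }
  where
  Next : Rel (Fin 4) 0ℓ
  Next i j = toℕ j ≡ ℕ.suc (toℕ i) % 4

  next? : Decidable Next
  next? i j = toℕ j ℕ.≟ ℕ.suc (toℕ i) % 4

  _~_ : Rel (Fin 4) 0ℓ
  i ~ j = Next i j ⊎ Next j i

  _~?_ : Decidable _~_
  i ~? j = next? i j ⊎-dec next? j i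

IsColoring : {C : Set} → Graph n → (Fin n → C) → Set
IsColoring G f = ∀ {u v} → u ~ v → f u ≢ f v
  where open Graph G

image : {A B : Set} → (A → B) → Pred A 0ℓ → Pred B 0ℓ
image f P y = ∃ λ x → P x × f x ≡ y

IsBColoring : {C : Set} → Graph n → (Fin n → C) → Set
IsBColoring G f =
  IsColoring G f ×
  (∀ c → ∃ λ v → f v ≡ c × image f (v ~_) ≐ ∁ ｛ c ｝)
  where open Graph G

IsBChromaticNumber : Graph n → ℕ → Set
IsBChromaticNumber {n} G =
  IsMaximum λ k → ∃ λ (f : Fin n → Fin k) → IsBColoring G f

-- Subsets of E(G), as symmetric relations: the edge {u , v} belongs to the
-- subset when both (u , v) and (v , u) are related.
record EdgeSet (G : Graph n) : Set₁ where
  open Graph G using (_~_)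
  field
    Has  : Rel (Fin n) 0ℓ
    has? : Decidable Has
    sym  : Symmetric Has
    ⊆E   : Has ⇒ _~_

-- Each edge is counted once, with its smaller endpoint first.
size : {G : Graph n} → EdgeSet G → ℕ
size {n} U =
  length (filter (λ (u , v) → (u <? v) ×-dec has? u v)
                 (cartesianProduct (allFin n) (allFin n)))
  where open EdgeSet U

infixl 6 _∖_

_∖_ : (G : Graph n) → EdgeSet G → Graph n
G ∖ U = record
  { _~_    = λ u v → u ~ v × ¬ Has u v
  ; _~?_   = λ u v → (u ~? v) ×-dec ¬? (has? u v)
  ; sym    = λ (u~v , u∉v) → G.sym u~v , λ v∈u → u∉v (U.sym v∈u)
  ; irrefl = λ u≡v (u~v , _) → irrefl u≡v u~v
  }
  where
  module G = Graph G
  module U = EdgeSet U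
  open G using (_~_; _~?_; irrefl)
  open U using (Has; has?)

incidentEdges : (G : Graph n) → Fin n → EdgeSet G
incidentEdges G w = record
  { Has  = λ u v → u ~ v × (u ≡ w ⊎ v ≡ w)
  ; has? = λ u v → (u ~? v) ×-dec ((u ≟ w) ⊎-dec (v ≟ w))
  ; sym  = λ (u~v , w∈uv) → sym u~v , Sum.swap w∈uv
  ; ⊆E   = proj₁
  }
  where open Graph G

Connected : Graph n → Set
Connected G = ∀ u v → Star _~_ u v
  where open Graph G

Disconnected : Graph n → Set
Disconnected G = ¬ Connected G

IsEdgeCut : (G : Graph n) → EdgeSet G → Set
IsEdgeCut G U = Disconnected (G ∖ U)

IsEdgeConnectivity : Graph n → ℕ → Set₁
IsEdgeConnectivity {n} G =
  IsMinimum λ k → ∃ λ (U : EdgeSet G) →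
    size U ≡ k × (Disconnected (G ∖ U) ⊎ n ≡ 1)

IsMinimumEdgeCut : (G : Graph n) → EdgeSet G → Set₁
IsMinimumEdgeCut G U = IsEdgeCut G U × IsEdgeConnectivity G (size U)

-- Meant for d-regular G.
SuperEdgeConnected : ℕ → Graph n → Set₁
SuperEdgeConnected d G =
  IsEdgeConnectivity G d ×
  (∀ U → IsMinimumEdgeCut G U →
     ∃ λ w → EdgeSet.Has U ⇔ EdgeSet.Has (incidentEdges G w))

{-# OPTIONS --safe #-}

-- Color a vertex x and its neighbors with all d + 1 colors, then complete the
-- neighborhoods of some neighbors of x, one at a time, so that they too see all
-- colors.  In the absence of 4-cycles the leaves already colored around one
-- neighbor forbid each color at most once around another, so this succeeds for
-- about d/2 neighbors.  A graph that is not super-edge-connected has a cut of at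
-- most d edges with at least two vertices on either side.  Counting yields on
-- each side a vertex all of whose neighbors are on that side and which has at
-- most one cut edge at its neighbors.  The stars at these two vertices jointly
-- dominate all d + 1 colors.  Permuting the colors separately in the block
-- dominated by the first star and in the block dominated by the second avoids all
-- conflicts along the cut, because each block has more colors than conflicts.
-- The remaining vertices are colored greedily.  For d ≤ 2, and for cubic graphs
-- with a triangle, a single star suffices.
module Submission where

open import Defs
open import Data.Bool using (true; false)
open import Data.Empty using (⊥)
open import Data.Fin using (Fin; zero; suc; toℕ; fromℕ<; splitAt; join; _↑ˡ_; _↑ʳ_; opposite)
import Data.Fin.Permutation as Perm
open import Data.Fin.Permutation using (Permutation′; _⟨$⟩ʳ_; _⟨$⟩ˡ_; _∘ₚ_; transpose; inverseˡ; inverseʳ)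
import Data.Fin.Permutation.Components as PC
import Data.Fin.Properties as Fin
open import Data.Fin.Properties using (_≟_; any?; all?; toℕ<n)
open import Data.Fin.Subset using (Subset; _∈_)
open import Data.Fin.Subset.Properties using (_∈?_; anySubset?)
open import Data.List as List using (length; filter; cartesianProduct)
import Data.List.Properties as List
open import Data.Maybe as Maybe using (Maybe; just; nothing; _<∣>_)
import Data.Maybe.Properties as Maybe
open import Data.Nat using (ℕ; zero; suc; _+_; _*_; _∸_; _≤_; _<_; z≤n; s≤s; s≤s⁻¹; z<s; _≤?_; _<?_; NonZero; >-nonZero)
open import Data.Nat.Properties hiding (_≟_; _≤?_; _<?_)
open import Data.Nat.Tactic.RingSolver using (solve-∀)
open import Data.Product using (∃; ∃₂; _×_; _,_; proj₁; proj₂)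
open import Data.Sum as Sum using (_⊎_; inj₁; inj₂; [_,_]′)
open import Data.Sum.Function.Propositional using (_⊎-↔_)
open import Data.Unit using (⊤; tt)
open import Data.Vec using (tabulate)
import Data.Vec.Properties as Vec
open import Function using (_∘_; id; case_of_)
open import Function.Construct.Composition using (_↔-∘_)
open import Function.Construct.Symmetry using (↔-sym)
open import Level using (0ℓ)
open import Relation.Binary.Construct.Closure.ReflexiveTransitive as Path using (Star; _◅_; _◅◅_) renaming (ε to here)
open import Relation.Binary.Definitions using (tri<; tri≈; tri>)
open import Relation.Binary.PropositionalEquality using (_≡_; _≢_; refl; sym; trans; cong; cong₂; subst; subst₂; module ≡-Reasoning)
open import Relation.Nullary using (¬_; Dec; yes; no; does; _because_; ¬?; contradiction)
open import Relation.Nullary.Decidable using (_×-dec_; _⊎-dec_; _→-dec_; decidable-stable; dec-true)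
open import Relation.Unary using (Pred; Decidable)
open import Algebra.Properties.CommutativeMonoid.Sum +-0-commutativeMonoid using (sum; sum-syntax; sum-cong-≗; ∑-distrib-+; ∑-comm; sum-permute)
open import Algebra.Properties.Semiring.Sum +-*-semiring using (*-distribˡ-sum; *-distribʳ-sum)

-- With `i` neighbors of the center completed, each blank vertex around the next one has up to `i`
-- forbidden colors, each missing color up to `i` forbidden vertices, and only `d ∸ 2` blank
-- vertices are guaranteed; hence the condition `i + i ≤ d ∸ 2`. For `d = m + suc m′` with nearly
-- equal `m` and `m′`, stars completed at `m` and `m′` neighbors dominate `suc m` and `suc m′`
-- colors, exactly `suc d` together. A cut of `d` edges may still cause more conflicts than a block
-- of about half the colors tolerates. Since only `m` of the interior neighbors of a center are
-- completed, those whose leaves meet many cut edges can be passed over. Cut edges at the neighbors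
-- of the centers are there whatever is chosen, which is why the centers must have at most one of
-- them. The search for a center breaks down if a side is a clique on `d` vertices with one cut edge
-- at each: no vertex is then interior. For `d ≥ 3` the absence of 4-cycles permits this only when
-- `d = 3` and the side is a triangle, and that is why cubic graphs with a triangle are set apart.

private
  variable
    k l m n : ℕ
    P Q R : Set
    A B : Pred (Fin n) 0ℓ


-- Sums of indicators over Fin n

⟦_⟧ : Dec P → ℕ
⟦ true  because _ ⟧ = 1
⟦ false because _ ⟧ = 0

⟦⟧-yes : (p? : Dec P) → P → ⟦ p? ⟧ ≡ 1
⟦⟧-yes (yes _) _ = refl
⟦⟧-yes (no ¬p) p = contradiction p ¬p

⟦⟧-no : (p? : Dec P) → ¬ P → ⟦ p? ⟧ ≡ 0
⟦⟧-no (yes p) ¬p = contradiction p ¬p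
⟦⟧-no (no _) _ = refl

⟦⟧≤1 : (p? : Dec P) → ⟦ p? ⟧ ≤ 1
⟦⟧≤1 (yes _) = ≤-refl
⟦⟧≤1 (no _) = z≤n

⟦⟧-true : (p? : Dec P) → 0 < ⟦ p? ⟧ → P
⟦⟧-true (yes p) _ = p

⟦⟧-bound : (p? : Dec P) → (P → 1 ≤ k) → ⟦ p? ⟧ ≤ k
⟦⟧-bound (yes p) 1≤k = 1≤k p
⟦⟧-bound (no _) _ = z≤n

⟦⟧-mono : (p? : Dec P) (q? : Dec Q) → (P → Q) → ⟦ p? ⟧ ≤ ⟦ q? ⟧
⟦⟧-mono p? q? f = ⟦⟧-bound p? λ p → ≤-reflexive (sym (⟦⟧-yes q? (f p)))

⟦⟧-cong : (p? : Dec P) (q? : Dec Q) → (P → Q) → (Q → P) → ⟦ p? ⟧ ≡ ⟦ q? ⟧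
⟦⟧-cong p? q? f g = ≤-antisym (⟦⟧-mono p? q? f) (⟦⟧-mono q? p? g)

⟦⟧-cover : (p? : Dec P) (q? : Dec Q) (r? : Dec R) → (P → Q ⊎ R) →
           ⟦ p? ⟧ ≤ ⟦ q? ⟧ + ⟦ r? ⟧
⟦⟧-cover p? (yes _) r? f = ≤-trans (⟦⟧≤1 p?) (m≤m+n 1 _)
⟦⟧-cover p? (no ¬q) r? f =
  ⟦⟧-mono p? r? ([ (λ q → contradiction q ¬q) , id ]′ ∘ f)

⟦⟧-disjoint : (p? : Dec P) (q? : Dec Q) (r? : Dec R) →
              (Q → P) → (R → P) → (Q → ¬ R) → ⟦ q? ⟧ + ⟦ r? ⟧ ≤ ⟦ p? ⟧
⟦⟧-disjoint p? (yes q) r? f g h =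
  ≤-reflexive (trans (cong suc (⟦⟧-no r? (h q))) (sym (⟦⟧-yes p? (f q))))
⟦⟧-disjoint p? (no _) r? f g h = ⟦⟧-mono r? p? g

sum-mono : {f g : Fin n → ℕ} → (∀ i → f i ≤ g i) → sum f ≤ sum g
sum-mono {zero} f≤g = z≤n
sum-mono {suc n} f≤g = +-mono-≤ (f≤g zero) (sum-mono (f≤g ∘ suc))

sum-const : ∀ n k → ∑[ i < n ] k ≡ n * k
sum-const zero k = refl
sum-const (suc n) k = cong (k +_) (sum-const n k)

sum-zero : {f : Fin n → ℕ} → (∀ i → f i ≡ 0) → sum f ≡ 0
sum-zero {n} f≡0 = trans (sum-cong-≗ f≡0) (trans (sum-const n 0) (*-zeroʳ n))

term≤sum : (f : Fin n → ℕ) (i : Fin n) → f i ≤ sum f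
term≤sum f zero = m≤m+n _ _
term≤sum f (suc i) = ≤-trans (term≤sum (f ∘ suc) i) (m≤n+m _ _)

sum-<⇒∃< : (f g : Fin n → ℕ) → sum f < sum g → ∃ λ i → f i < g i
sum-<⇒∃< f g f<g with any? (λ i → f i <? g i)
... | yes p = p
... | no ¬p = contradiction (sum-mono λ i → ≮⇒≥ λ fi<gi → ¬p (i , fi<gi)) (<⇒≱ f<g)

sum-pos : (f : Fin n → ℕ) → 0 < sum f → ∃ λ i → 0 < f i
sum-pos {n} f 0<f = sum-<⇒∃< (λ _ → 0) f (subst (_< sum f) (sym (sum-zero {n} λ _ → refl)) 0<f)

sum-strict : (f g : Fin n → ℕ) → (∀ i → f i ≤ g i) → ∀ i → f i < g i → sum f < sum g
sum-strict f g f≤g zero lt = +-mono-<-≤ lt (sum-mono (f≤g ∘ suc))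
sum-strict f g f≤g (suc i) lt =
  +-mono-≤-< (f≤g zero) (sum-strict (f ∘ suc) (g ∘ suc) (f≤g ∘ suc) i lt)

count : Decidable A → ℕ
count A? = sum λ i → ⟦ A? i ⟧

count-mono : (A? : Decidable A) (B? : Decidable B) → (∀ {i} → A i → B i) →
             count A? ≤ count B?
count-mono A? B? f = sum-mono λ i → ⟦⟧-mono (A? i) (B? i) f

count-cong : (A? : Decidable A) (B? : Decidable B) →
             (∀ {i} → A i → B i) → (∀ {i} → B i → A i) → count A? ≡ count B?
count-cong A? B? f g = sum-cong-≗ λ i → ⟦⟧-cong (A? i) (B? i) f g

count-none : (A? : Decidable A) → (∀ i → ¬ A i) → count A? ≡ 0
count-none A? ¬A = sum-zero λ i → ⟦⟧-no (A? i) (¬A i)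

count-pos : (A? : Decidable A) → 0 < count A? → ∃ A
count-pos A? 0<c with sum-pos (λ i → ⟦ A? i ⟧) 0<c
... | i , p = i , ⟦⟧-true (A? i) p

count-∃ : (A? : Decidable A) → ∃ A → 0 < count A?
count-∃ A? (i , a) =
  ≤-trans (≤-reflexive (sym (⟦⟧-yes (A? i) a))) (term≤sum (λ i → ⟦ A? i ⟧) i)

count-≤1 : (A? : Decidable A) → (∀ {i j} → A i → A j → i ≡ j) → count A? ≤ 1
count-≤1 {zero} A? uniq = z≤n
count-≤1 {suc n} A? uniq with A? zero
... | yes a = ≤-reflexive (cong suc (count-none (A? ∘ suc) λ i a′ → Fin.0≢1+n (uniq a a′)))
... | no _ = count-≤1 (A? ∘ suc) λ a a′ → Fin.suc-injective (uniq a a′)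

count-≟ : (a : Fin n) → count (_≟ a) ≡ 1
count-≟ a = ≤-antisym (count-≤1 (_≟ a) λ p q → trans p (sym q)) (count-∃ (_≟ a) (a , refl))

count-split : (A? : Decidable A) (B? : Decidable B) →
              count (λ i → A? i ×-dec B? i) + count (λ i → A? i ×-dec ¬? (B? i)) ≡ count A?
count-split A? B? = trans (sym (∑-distrib-+ (λ i → ⟦ A? i ×-dec B? i ⟧) (λ i → ⟦ A? i ×-dec ¬? (B? i) ⟧))) (sum-cong-≗ split)
  where
  split : ∀ i → ⟦ A? i ×-dec B? i ⟧ + ⟦ A? i ×-dec ¬? (B? i) ⟧ ≡ ⟦ A? i ⟧
  split i with A? i | B? i
  ... | yes _ | yes _ = refl
  ... | yes _ | no _ = refl
  ... | no _ | _ = refl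

-- Double counting of the related pairs: each `i` in `A` lies in at least one and each `j` in at
-- most one. `S` is a relation rather than a function because in the applications the partner of `i`
-- is only known to exist.
count-transfer : {S : Fin n → Fin k → Set} (A? : Decidable A) (B? : Decidable B)
                 (S? : ∀ i j → Dec (S i j)) →
                 (∀ {i} → A i → ∃ λ j → B j × S i j) →
                 (∀ {i i′ j} → S i j → S i′ j → i ≡ i′) → count A? ≤ count B?
count-transfer {n} {k} A? B? S? f inj = begin
  count A?                                        ≤⟨ sum-mono (λ i → ⟦⟧-bound (A? i) (λ a → count-∃ (λ j → B? j ×-dec S? i j) (f a))) ⟩
  ∑[ i < n ] ∑[ j < k ] ⟦ B? j ×-dec S? i j ⟧  ≡⟨ ∑-comm (λ i j → ⟦ B? j ×-dec S? i j ⟧) ⟩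
  ∑[ j < k ] ∑[ i < n ] ⟦ B? j ×-dec S? i j ⟧  ≤⟨ sum-mono below ⟩
  count B?                                        ∎
  where
  open ≤-Reasoning
  below : ∀ j → ∑[ i < n ] ⟦ B? j ×-dec S? i j ⟧ ≤ ⟦ B? j ⟧
  below j with B? j
  ... | yes b = ≤-trans (count-mono (λ i → yes b ×-dec S? i j) (λ i → S? i j) proj₂)
                        (count-≤1 (λ i → S? i j) inj)
  ... | no ¬b = ≤-reflexive (count-none (λ i → no ¬b ×-dec S? i j) λ _ → ¬b ∘ proj₁)

count-all : ∀ n → count {n} (λ _ → yes tt) ≡ n
count-all n = trans (sum-const n 1) (*-identityʳ n)

count-inj : {S : Fin n → Fin k → Set} (A? : Decidable A) (S? : ∀ i j → Dec (S i j)) →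
            (∀ {i} → A i → ∃ (S i)) → (∀ {i i′ j} → S i j → S i′ j → i ≡ i′) →
            count A? ≤ k
count-inj {k = k} A? S? f inj = ≤-trans
  (count-transfer A? (λ _ → yes tt) S? (λ a → let j , s = f a in j , tt , s) inj)
  (≤-reflexive (count-all k))

length-filter-tabulate : {X : Set} {T : Pred X 0ℓ} (T? : Decidable T) (f : Fin n → X) →
                         length (filter T? (List.tabulate f)) ≡ sum λ i → ⟦ T? (f i) ⟧
length-filter-tabulate {zero} T? f = refl
length-filter-tabulate {suc n} T? f with T? (f zero)
... | yes p = cong suc (length-filter-tabulate T? (f ∘ suc))
... | no p = length-filter-tabulate T? (f ∘ suc)

length-filter-product : {X Y : Set} {T : Pred (X × Y) 0ℓ} (T? : Decidable T)
                        (f : Fin m → X) (g : Fin n → Y) →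
                        length (filter T? (cartesianProduct (List.tabulate f) (List.tabulate g)))
                        ≡ ∑[ i < m ] ∑[ j < n ] ⟦ T? (f i , g j) ⟧
length-filter-product {zero} T? f g = refl
length-filter-product {suc m} {n} T? f g = begin
  length (filter T? (List.map (f zero ,_) gs List.++ rest))           ≡⟨ cong length (List.filter-++ T? (List.map (f zero ,_) gs) rest) ⟩
  length (filter T? (List.map (f zero ,_) gs) List.++ filter T? rest) ≡⟨ List.length-++ (filter T? (List.map (f zero ,_) gs)) ⟩
  length (filter T? (List.map (f zero ,_) gs)) + length (filter T? rest)
    ≡⟨ cong₂ _+_ (trans (cong (length ∘ filter T?) (List.map-tabulate g (f zero ,_))) (length-filter-tabulate T? (λ j → f zero , g j)))
                 (length-filter-product T? (f ∘ suc) g) ⟩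
  _ ∎
  where
  open ≡-Reasoning
  gs = List.tabulate g
  rest = cartesianProduct (List.tabulate (f ∘ suc)) gs

-- Enumerations of finite predicates

record Enumeration (A : Pred (Fin n) 0ℓ) (k : ℕ) : Set where
  field
    at        : Fin k → Fin n
    sound     : ∀ i → A (at i)
    injective : ∀ {i j} → at i ≡ at j → i ≡ j
    index     : ∀ {v} → A v → ∃ λ i → at i ≡ v

enumerate : (A? : Decidable A) → count A? ≡ k → Enumeration A k
enumerate {zero} A? refl = record
  { at = λ () ; sound = λ () ; injective = λ { {()} } ; index = λ { {()} } }
enumerate {suc n} A? refl with A? zero
... | yes a = record { at = at ; sound = sound ; injective = injective ; index = index }
  where
  module E = Enumeration (enumerate (A? ∘ suc) refl)
  at : Fin (suc (count (A? ∘ suc))) → Fin (suc n)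
  at zero = zero
  at (suc i) = suc (E.at i)
  sound : ∀ i → _
  sound zero = a
  sound (suc i) = E.sound i
  injective : ∀ {i j} → at i ≡ at j → i ≡ j
  injective {zero} {zero} _ = refl
  injective {suc i} {suc j} eq = cong suc (E.injective (Fin.suc-injective eq))
  index : ∀ {v} → _ → ∃ λ i → at i ≡ v
  index {zero} _ = zero , refl
  index {suc v} p with E.index p
  ... | i , eq = suc i , cong suc eq
... | no ¬a = record
  { at = suc ∘ E.at
  ; sound = E.sound
  ; injective = E.injective ∘ Fin.suc-injective
  ; index = λ { {zero} a → contradiction a ¬a
              ; {suc v} p → let i , eq = E.index p in i , cong suc eq } }
  where module E = Enumeration (enumerate (A? ∘ suc) refl)

enumeration-count : (A? : Decidable A) → Enumeration A k → count A? ≡ k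
enumeration-count {k = k} A? E = ≤-antisym
  (count-inj A? (λ v i → E.at i ≟ v) E.index λ p q → trans (sym p) q)
  (subst (_≤ count A?) (count-all k)
    (count-transfer (λ _ → yes tt) A? (λ i v → E.at i ≟ v) (λ {i} _ → E.at i , E.sound i , refl)
      λ p q → E.injective (trans p (sym q))))
  where module E = Enumeration E

module _ (A? : Decidable A) (B? : Decidable B) (A⊆B : ∀ {i} → A i → B i)
         (E : Enumeration A m) (size : count B? ≡ m + k) where

  private
    module E = Enumeration E

    rest? : Decidable (λ i → B i × ¬ A i)
    rest? i = B? i ×-dec ¬? (A? i)

    rest-size : count rest? ≡ k
    rest-size = +-cancelˡ-≡ m _ _ (begin
      m + count rest?                               ≡⟨ cong (_+ count rest?) (enumeration-count A? E) ⟨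
      count A? + count rest?                        ≡⟨ cong (_+ count rest?) (count-cong A? (λ i → B? i ×-dec A? i) (λ a → A⊆B a , a) proj₂) ⟩
      count (λ i → B? i ×-dec A? i) + count rest?   ≡⟨ count-split B? A? ⟩
      count B?                                      ≡⟨ size ⟩
      m + k                                         ∎)
      where open ≡-Reasoning

    module F = Enumeration (enumerate rest? rest-size)

    at : Fin (m + k) → Fin _
    at i = [ E.at , F.at ]′ (splitAt m i)

    at-injective : ∀ s t → [ E.at , F.at ]′ s ≡ [ E.at , F.at ]′ t → s ≡ t
    at-injective (inj₁ i) (inj₁ j) eq = cong inj₁ (E.injective eq)
    at-injective (inj₂ i) (inj₂ j) eq = cong inj₂ (F.injective eq)
    at-injective (inj₁ i) (inj₂ j) eq = contradiction (subst A eq (E.sound i)) (proj₂ (F.sound j))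
    at-injective (inj₂ i) (inj₁ j) eq = contradiction (subst A (sym eq) (E.sound j)) (proj₂ (F.sound i))

  -- The members of `A` receive the smallest indices. For a star this decides which neighbors are
  -- completed first and bear the smallest nonzero colors.
  extend-enumeration : Enumeration B (m + k)
  extend-enumeration = record
    { at = at
    ; sound = λ i → sound (splitAt m i)
    ; injective = λ {i} {j} eq → trans (sym (Fin.join-splitAt m k i))
        (trans (cong (join m k) (at-injective (splitAt m i) (splitAt m j) eq)) (Fin.join-splitAt m k j))
    ; index = index }
    where
    sound : ∀ s → B ([ E.at , F.at ]′ s)
    sound (inj₁ i) = A⊆B (E.sound i)
    sound (inj₂ i) = proj₁ (F.sound i)
    index : ∀ {v} → B v → ∃ λ i → at i ≡ v
    index {v} b with A? v
    ... | yes a = let i , eq = E.index a in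
                  i ↑ˡ k , trans (cong [ E.at , F.at ]′ (Fin.splitAt-↑ˡ m i k)) eq
    ... | no ¬a = let i , eq = F.index (b , ¬a) in
                  m ↑ʳ i , trans (cong [ E.at , F.at ]′ (Fin.splitAt-↑ʳ m k i)) eq

  extend-first : ∀ i → toℕ i < m → A (Enumeration.at extend-enumeration i)
  extend-first i i<m with splitAt m i | Fin.splitAt-< m {k} i i<m
  ... | _ | refl = E.sound _

arrange : (A? : Decidable A) (B? : Decidable B) → (∀ {i} → A i → B i) → ∀ {l} → l ≡ m + k →
          count A? ≡ m → count B? ≡ l →
          ∃ λ (E : Enumeration B l) → ∀ i → toℕ i < m → A (Enumeration.at E i)
arrange A? B? A⊆B refl size-A size-B =
  extend-enumeration A? B? A⊆B (enumerate A? size-A) size-B ,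
  extend-first A? B? A⊆B (enumerate A? size-A) size-B

-- Permutations avoiding forbidden positions

transpose-left : (i j : Fin k) → PC.transpose i j i ≡ j
transpose-left i j with i ≟ i
... | yes _ = refl
... | no i≢i = contradiction refl i≢i

transpose-right : (i j : Fin k) → PC.transpose i j j ≡ i
transpose-right i j with j ≟ i
... | yes j≡i = j≡i
... | no _ with j ≟ j
...   | yes _ = refl
...   | no j≢j = contradiction refl j≢j

transpose-other : {i j l : Fin k} → l ≢ i → l ≢ j → PC.transpose i j l ≡ l
transpose-other {i = i} {j} {l} l≢i l≢j with l ≟ i
... | yes l≡i = contradiction l≡i l≢i
... | no _ with l ≟ j
...   | yes l≡j = contradiction l≡j l≢j
...   | no _ = refl

injectiveʳ : (σ : Permutation′ k) {i j : Fin k} → σ ⟨$⟩ʳ i ≡ σ ⟨$⟩ʳ j → i ≡ j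
injectiveʳ σ eq = trans (sym (inverseˡ σ)) (trans (cong (σ ⟨$⟩ˡ_) eq) (inverseˡ σ))

module _ {OK : Fin k → Fin k → Set} (OK? : ∀ p q → Dec (OK p q)) where

  private
    violations : Permutation′ k → ℕ
    violations σ = count λ p → ¬? (OK? p (σ ⟨$⟩ʳ p))

  -- Describes an exchange of the values of `p` and `q` that lowers the number of violations: `p` is
  -- repaired, and `q` cannot add a violation if it ends up right or was wrong already.
  Improvable : Permutation′ k → Set
  Improvable σ = ∃₂ λ p q → ¬ OK p (σ ⟨$⟩ʳ p) × OK p (σ ⟨$⟩ʳ q) ×
                            (OK q (σ ⟨$⟩ʳ p) ⊎ ¬ OK q (σ ⟨$⟩ʳ q))

  private
    improve : (σ : Permutation′ k) → Improvable σ →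
              ∃ λ σ′ → violations σ′ < violations σ
    improve σ (p , q , ¬pp , pq , qp) =
      σ′ , sum-strict _ _ le p (≤-reflexive (trans (cong suc now) (sym before)))
      where
      σ′ = transpose p q ∘ₚ σ
      at-p : σ′ ⟨$⟩ʳ p ≡ σ ⟨$⟩ʳ q
      at-p = cong (σ ⟨$⟩ʳ_) (transpose-left p q)
      at-q : σ′ ⟨$⟩ʳ q ≡ σ ⟨$⟩ʳ p
      at-q = cong (σ ⟨$⟩ʳ_) (transpose-right p q)
      now : ⟦ ¬? (OK? p (σ′ ⟨$⟩ʳ p)) ⟧ ≡ 0
      now = ⟦⟧-no (¬? (OK? p (σ′ ⟨$⟩ʳ p))) λ ¬ok → ¬ok (subst (OK p) (sym at-p) pq)
      before : ⟦ ¬? (OK? p (σ ⟨$⟩ʳ p)) ⟧ ≡ 1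
      before = ⟦⟧-yes (¬? (OK? p (σ ⟨$⟩ʳ p))) ¬pp
      le : ∀ i → ⟦ ¬? (OK? i (σ′ ⟨$⟩ʳ i)) ⟧ ≤ ⟦ ¬? (OK? i (σ ⟨$⟩ʳ i)) ⟧
      le i = ⟦⟧-mono (¬? (OK? i (σ′ ⟨$⟩ʳ i))) (¬? (OK? i (σ ⟨$⟩ʳ i))) imp
        where
        imp : ¬ OK i (σ′ ⟨$⟩ʳ i) → ¬ OK i (σ ⟨$⟩ʳ i)
        imp ¬ok = cases (i ≟ p) (i ≟ q)
          where
          cases : Dec (i ≡ p) → Dec (i ≡ q) → ¬ OK i (σ ⟨$⟩ʳ i)
          cases (yes refl) _ = ¬pp
          cases (no i≢p) (no i≢q) = subst (λ j → ¬ OK i (σ ⟨$⟩ʳ j)) (transpose-other i≢p i≢q) ¬ok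
          cases (no _) (yes refl) =
            [ (λ ok → contradiction (subst (OK q) (sym at-q) ok) ¬ok) , id ]′ qp

    repair : ∀ fuel σ → violations σ ≤ fuel →
             (∀ σ → (∃ λ p → ¬ OK p (σ ⟨$⟩ʳ p)) → Improvable σ) →
             ∃ λ σ → ∀ p → OK p (σ ⟨$⟩ʳ p)
    repair fuel σ le step with all? (λ p → OK? p (σ ⟨$⟩ʳ p))
    ... | yes ok = σ , ok
    ... | no ¬ok with Fin.¬∀⟶∃¬ k _ (λ p → OK? p (σ ⟨$⟩ʳ p)) ¬ok
    ...   | viol with improve σ (step σ viol)
    repair zero σ le step | no _ | _ | σ′ , lt = contradiction (<-≤-trans lt le) λ ()
    repair (suc fuel) σ le step | no _ | _ | σ′ , lt =
      repair fuel σ′ (s≤s⁻¹ (<-≤-trans lt le)) step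

  swapping : (∀ σ → (∃ λ p → ¬ OK p (σ ⟨$⟩ʳ p)) → Improvable σ) →
             ∃ λ σ → ∀ p → OK p (σ ⟨$⟩ʳ p)
  swapping = repair (violations Perm.id) Perm.id ≤-refl

module _ (pre : Fin k → Maybe (Fin k)) where

  Unset : Fin k → Set
  Unset p = pre p ≡ nothing

  Unused : Fin k → Set
  Unused q = ∀ p → pre p ≢ just q

  unset? : Decidable Unset
  unset? p = Maybe.≡-dec _≟_ (pre p) nothing

  unused? : Decidable Unused
  unused? q = all? λ p → ¬? (Maybe.≡-dec _≟_ (pre p) (just q))

  -- While some prescribed value is violated, a transposition repairs it.
  -- Afterwards the counting hypothesis provides, for each bad position, another
  -- position such that exchanging their values leaves neither of them bad.
  complete : {Bad : Fin k → Fin k → Set} (bad? : ∀ p q → Dec (Bad p q)) →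
             (∀ {p p′ q} → pre p ≡ just q → pre p′ ≡ just q → p ≡ p′) →
             (∀ {p q} → Unset p → Unused q → Bad p q →
                count (λ q′ → unused? q′ ×-dec bad? p q′) +
                count (λ p′ → unset? p′ ×-dec bad? p′ q) ≤ count unset?) →
             ∃ λ (σ : Permutation′ k) →
               (∀ {p q} → pre p ≡ just q → σ ⟨$⟩ʳ p ≡ q) ×
               (∀ {p} → Unset p → ¬ Bad p (σ ⟨$⟩ʳ p))
  complete {Bad} bad? pre-inj few with swapping OK? step
    where
    OK : Fin k → Fin k → Set
    OK p q = (∀ q′ → pre p ≡ just q′ → q ≡ q′) × (Unset p → Unused q × ¬ Bad p q)

    OK? : ∀ p q → Dec (OK p q)
    OK? p q = all? (λ q′ → Maybe.≡-dec _≟_ (pre p) (just q′) →-dec (q ≟ q′))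
              ×-dec (unset? p →-dec (unused? q ×-dec ¬? (bad? p q)))

    set-OK : ∀ {p q} → pre p ≡ just q → OK p q
    set-OK eq = (λ q′ eq′ → Maybe.just-injective (trans (sym eq) eq′)) ,
                λ un → case trans (sym eq) un of λ ()

    unset-OK : ∀ {p q} → Unset p → Unused q → ¬ Bad p q → OK p q
    unset-OK un unused ¬bad = (λ q′ eq → case trans (sym eq) un of λ ()) , λ _ → unused , ¬bad

    module _ (σ : Permutation′ k) where

      Misplaced : Fin k → Set
      Misplaced p = ∃ λ q → pre p ≡ just q × σ ⟨$⟩ʳ p ≢ q

      misplaced? : Decidable Misplaced
      misplaced? p = any? λ q → Maybe.≡-dec _≟_ (pre p) (just q) ×-dec ¬? (σ ⟨$⟩ʳ p ≟ q)

      place : ∃ Misplaced → Improvable OK? σ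
      place (p , q , eq , σp≢q) =
        p , p′ , (λ ok → σp≢q (proj₁ ok q eq)) ,
        subst (OK p) (sym (inverseʳ σ)) (set-OK eq) , inj₂ ¬ok
        where
        p′ = σ ⟨$⟩ˡ q
        σp′≡q : σ ⟨$⟩ʳ p′ ≡ q
        σp′≡q = inverseʳ σ
        -- `p′` holds the value prescribed for `p` and is therefore wrong itself: if unset, it must
        -- not hold a used value; if prescribed, it would have to be `p` by injectivity of `pre`.
        ¬ok : ¬ OK p′ (σ ⟨$⟩ʳ p′)
        ¬ok ok with pre p′ in eq′
        ... | nothing = proj₁ (proj₂ ok refl) p (trans eq (cong just (sym σp′≡q)))
        ... | just q′ = σp≢q (trans (cong (σ ⟨$⟩ʳ_) p≡p′) σp′≡q)
          where
          p≡p′ : p ≡ p′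
          p≡p′ = pre-inj eq (trans eq′ (cong just (trans (sym (proj₁ ok q′ refl)) σp′≡q)))

      module _ (placed : ∀ p {q} → pre p ≡ just q → σ ⟨$⟩ʳ p ≡ q) where

        image-unused : ∀ {p} → Unset p → Unused (σ ⟨$⟩ʳ p)
        image-unused un p′ eq =
          case trans (sym (subst Unset (injectiveʳ σ (sym (placed p′ eq))) un)) eq of λ ()

        avoid : ∀ {p} → Unset p → Bad p (σ ⟨$⟩ʳ p) → Improvable OK? σ
        avoid {p} un bad with any? (λ p′ → unset? p′ ×-dec (¬? (bad? p (σ ⟨$⟩ʳ p′)) ×-dec ¬? (bad? p′ (σ ⟨$⟩ʳ p))))
        ... | yes (p′ , un′ , ¬bad , ¬bad′) =
              p , p′ , (λ ok → proj₂ (proj₂ ok un) bad) ,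
              unset-OK un (image-unused un′) ¬bad ,
              inj₁ (unset-OK un′ (image-unused un) ¬bad′)
        -- Every unset `p′` is spoiled by the row of `p` or by the column of its value, and `p`
        -- itself by both. Counting `p` twice exceeds the hypothesis by one, so a weak inequality in
        -- `few` is enough.
        ... | no none = contradiction (few un (image-unused un) bad) (<⇒≱ (begin-strict
              count unset?                                         <⟨ ≤-refl ⟩
              1 + count unset?                                     ≡⟨ cong (_+ count unset?) (count-≟ p) ⟨
              count (_≟ p) + count unset?                          ≡⟨ ∑-distrib-+ _ (λ p′ → ⟦ unset? p′ ⟧) ⟨
              ∑[ p′ < k ] (⟦ p′ ≟ p ⟧ + ⟦ unset? p′ ⟧)            ≤⟨ sum-mono cover ⟩
              ∑[ p′ < k ] (⟦ row? (σ ⟨$⟩ʳ p′) ⟧ + ⟦ col? p′ ⟧)    ≡⟨ ∑-distrib-+ (λ p′ → ⟦ row? (σ ⟨$⟩ʳ p′) ⟧) (λ p′ → ⟦ col? p′ ⟧) ⟩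
              (∑[ p′ < k ] ⟦ row? (σ ⟨$⟩ʳ p′) ⟧) + count col?      ≡⟨ cong (_+ count col?) (sum-permute (λ q → ⟦ row? q ⟧) σ) ⟨
              count row? + count col?                              ∎))
          where
          open ≤-Reasoning
          row? = λ q′ → unused? q′ ×-dec bad? p q′
          col? = λ p′ → unset? p′ ×-dec bad? p′ (σ ⟨$⟩ʳ p)
          cover : ∀ p′ → ⟦ p′ ≟ p ⟧ + ⟦ unset? p′ ⟧ ≤ ⟦ row? (σ ⟨$⟩ʳ p′) ⟧ + ⟦ col? p′ ⟧
          cover p′ with p′ ≟ p
          ... | yes refl = +-mono-≤
                (≤-reflexive (sym (⟦⟧-yes (row? (σ ⟨$⟩ʳ p)) (image-unused un , bad))))
                (⟦⟧-mono (unset? p) (col? p) λ un → un , bad)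
          ... | no _ = ⟦⟧-cover (unset? p′) (row? (σ ⟨$⟩ʳ p′)) (col? p′) either
            where
            either : Unset p′ → _
            either un′ with bad? p (σ ⟨$⟩ʳ p′) | bad? p′ (σ ⟨$⟩ʳ p)
            ... | yes b | _ = inj₁ (image-unused un′ , b)
            ... | no _ | yes b = inj₂ (un′ , b)
            ... | no ¬b | no ¬b′ = contradiction (p′ , un′ , ¬b , ¬b′) none

        resolve : (∃ λ p → ¬ OK p (σ ⟨$⟩ʳ p)) → Improvable OK? σ
        resolve (p , ¬ok) with pre p in eq
        ... | just q = contradiction (subst (λ m → (∀ q′ → m ≡ just q′ → σ ⟨$⟩ʳ p ≡ q′) ×
                         (m ≡ nothing → Unused (σ ⟨$⟩ʳ p) × ¬ Bad p (σ ⟨$⟩ʳ p))) eq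
                         (subst (OK p) (sym (placed p eq)) (set-OK eq))) ¬ok
        ... | nothing = avoid eq (decidable-stable (bad? p (σ ⟨$⟩ʳ p)) λ ¬bad →
                          ¬ok ((λ _ ()) , λ _ → image-unused eq , ¬bad))

      step : (∃ λ p → ¬ OK p (σ ⟨$⟩ʳ p)) → Improvable OK? σ
      step with any? misplaced?
      ... | yes p = λ _ → place p
      ... | no ¬p = resolve λ p {q} eq →
              decidable-stable (σ ⟨$⟩ʳ p ≟ q) λ ne → ¬p (p , q , eq , ne)
  ... | σ , ok = σ , (λ {p} eq → proj₁ (ok p) _ eq) , (λ {p} un → proj₂ (proj₂ (ok p) un))

-- A pair of positions counted both in the row and in the column is counted
-- only once in the matrix, which leaves room for all k positions.
avoid-matrix : (w : Fin (suc k) → Fin (suc k) → ℕ) →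
               ∑[ i < suc k ] ∑[ j < suc k ] w i j ≤ k →
               ∃ λ (σ : Permutation′ (suc k)) → ∀ i → w i (σ ⟨$⟩ʳ i) ≡ 0
avoid-matrix {k} w few with complete (λ _ → nothing) bad? (λ ()) small
  where
  bad? : ∀ i j → Dec (0 < w i j)
  bad? i j = 0 <? w i j
  small : ∀ {p q} → _ → _ → 0 < w p q → _
  small {p} {q} _ _ _ = begin
    count row? + count col?                                         ≤⟨ +-mono-≤ (count-mono row? (bad? p) proj₂) (count-mono col? (λ i → bad? i q) proj₂) ⟩
    count (bad? p) + count (λ i → bad? i q)                          ≡⟨ cong (_+ count (λ i → bad? i q)) pick ⟨
    ∑[ i < suc k ] (⟦ i ≟ p ⟧ * count (bad? p)) + count (λ i → bad? i q) ≡⟨ ∑-distrib-+ (λ i → ⟦ i ≟ p ⟧ * count (bad? p)) (λ i → ⟦ bad? i q ⟧) ⟨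
    ∑[ i < suc k ] (⟦ i ≟ p ⟧ * count (bad? p) + ⟦ bad? i q ⟧)    ≤⟨ sum-mono row ⟩
    ∑[ i < suc k ] (∑[ j < suc k ] w i j + ⟦ i ≟ p ⟧)              ≡⟨ ∑-distrib-+ (λ i → ∑[ j < suc k ] w i j) (λ i → ⟦ i ≟ p ⟧) ⟩
    (∑[ i < suc k ] ∑[ j < suc k ] w i j) + count (_≟ p)             ≤⟨ +-mono-≤ few (≤-reflexive (count-≟ p)) ⟩
    k + 1                                                            ≡⟨ +-comm k 1 ⟩
    suc k                                                            ≡⟨ trans (sum-const (suc k) 1) (*-identityʳ (suc k)) ⟨
    ∑[ i < suc k ] 1                                                 ∎
    where
    open ≤-Reasoning
    row? = λ q′ → unused? (λ _ → nothing) q′ ×-dec bad? p q′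
    col? = λ p′ → unset? (λ _ → nothing) p′ ×-dec bad? p′ q
    pick : ∑[ i < suc k ] (⟦ i ≟ p ⟧ * count (bad? p)) ≡ count (bad? p)
    pick = trans (sym (*-distribʳ-sum (count (bad? p)) (λ i → ⟦ i ≟ p ⟧)))
                 (trans (cong (_* count (bad? p)) (count-≟ p)) (*-identityˡ _))
    row : ∀ i → ⟦ i ≟ p ⟧ * count (bad? p) + ⟦ bad? i q ⟧ ≤ ∑[ j < suc k ] w i j + ⟦ i ≟ p ⟧
    row i with i ≟ p
    ... | yes refl = +-mono-≤ (≤-trans (≤-reflexive (+-identityʳ _))
                       (sum-mono λ j → ⟦⟧-bound (bad? i j) id)) (⟦⟧≤1 (bad? i q))
    ... | no _ = ≤-trans (⟦⟧-bound (bad? i q) λ pos → ≤-trans pos (term≤sum (w i) q)) (m≤m+n _ 0)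
... | σ , _ , ok = σ , λ i → n≤0⇒n≡0 (≮⇒≥ (ok refl))

-- Partial colorings

module PartialColorings (G : Graph n) (d : ℕ) (regular : Regular d G) where

  open Graph G renaming (sym to ~-sym)

  PartialColoring : Set
  PartialColoring = Fin n → Maybe (Fin (suc d))

  private
    variable
      g g′ : PartialColoring
      u v w z : Fin n
      c c′ : Fin (suc d)

  ~⇒≢ : u ~ v → u ≢ v
  ~⇒≢ u~v u≡v = irrefl u≡v u~v

  degree-count : ∀ v → count (v ~?_) ≡ d
  degree-count v = trans (sym (length-filter-tabulate (v ~?_) id)) (regular v)

  Near : Fin n → Fin n → Set
  Near z v = v ≡ z ⊎ z ~ v

  near? : ∀ z v → Dec (Near z v)
  near? z v = (v ≟ z) ⊎-dec (z ~? v)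

  count-near : ∀ z → count (near? z) ≡ suc d
  count-near z = begin
    count (near? z)                                         ≡⟨ count-split (near? z) (_≟ z) ⟨
    count (λ v → near? z v ×-dec (v ≟ z)) + count (λ v → near? z v ×-dec ¬? (v ≟ z))
      ≡⟨ cong₂ _+_ (count-cong (λ v → near? z v ×-dec (v ≟ z)) (_≟ z) proj₂ λ eq → inj₁ eq , eq)
                   (count-cong (λ v → near? z v ×-dec ¬? (v ≟ z)) (z ~?_)
                     (λ { (inj₁ eq , ne) → contradiction eq ne ; (inj₂ adj , _) → adj })
                     λ adj → inj₂ adj , λ eq → ~⇒≢ adj (sym eq)) ⟩
    count (_≟ z) + count (z ~?_)                            ≡⟨ cong₂ _+_ (count-≟ z) (degree-count z) ⟩
    suc d                                                   ∎
    where open ≡-Reasoning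

  Interior : Pred (Fin n) 0ℓ → Pred (Fin n) 0ℓ
  Interior A v = ∀ u → Near v u → A u

  interior? : {A : Pred (Fin n) 0ℓ} → Decidable A → Decidable (Interior A)
  interior? A? v = all? λ u → near? v u →-dec A? u

  Proper : PartialColoring → Set
  Proper g = ∀ {u v c} → u ~ v → g u ≡ just c → g v ≢ just c

  Extends : PartialColoring → PartialColoring → Set
  Extends g h = ∀ {v c} → g v ≡ just c → h v ≡ just c

  record Rainbow (g : PartialColoring) (z : Fin n) : Set where
    field
      total     : Near z v → ∃ λ c → g v ≡ just c
      injective : Near z u → Near z v → g u ≡ just c → g v ≡ just c → u ≡ v
      onto      : ∀ c → ∃ λ v → Near z v × g v ≡ just c

  -- A rainbow neighborhood has no blank vertex, so no extension can alter it. Domination once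
  -- achieved survives all later steps, including the greedy completion.
  rainbow-extends : Extends g g′ → Rainbow g z → Rainbow g′ z
  rainbow-extends {g} {h} g⊆h r = record
    { total = λ near → let c , eq = R.total near in c , g⊆h eq
    ; injective = λ near near′ eq eq′ →
        R.injective near near′ (restrict near eq) (restrict near′ eq′)
    ; onto = λ c → let v , near , eq = R.onto c in v , near , g⊆h eq }
    where
    module R = Rainbow r
    restrict : Near _ v → h v ≡ just c → g v ≡ just c
    restrict near eq with R.total near
    ... | c′ , eq′ = trans eq′ (trans (sym (g⊆h eq′)) eq)

  colored? : ∀ (g : PartialColoring) v c → Dec (g v ≡ just c)
  colored? g v c = Maybe.≡-dec _≟_ (g v) (just c)

  available : (g : PartialColoring) (v : Fin n) → ∃ λ c → ∀ {u} → v ~ u → g u ≢ just c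
  available g v with any? (λ c → all? λ u → v ~? u →-dec ¬? (colored? g u c))
  ... | yes (c , free) = c , λ {u} → free u
  ... | no none = contradiction
        (subst₂ _≤_ (count-all (suc d)) (degree-count v)
          (count-transfer (λ _ → yes tt) (v ~?_) (λ c u → colored? g u c) taken
            λ eq eq′ → Maybe.just-injective (trans (sym eq) eq′)))
        1+n≰n
    where
    taken : ∀ {c} → ⊤ → ∃ λ u → v ~ u × g u ≡ just c
    taken {c} _ = decidable-stable (any? λ u → (v ~? u) ×-dec colored? g u c) λ ¬taken →
      none (c , λ u adj eq → ¬taken (u , adj , eq))

  color-one : Proper g → ∀ v → ∃ λ h → Proper h × Extends g h × ∃ λ c → h v ≡ just c
  color-one {g} proper v with g v in eq
  ... | just c = g , proper , id , c , eq
  ... | nothing with available g v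
  ...   | c , free = h , proper-h , g⊆h , c , h-at
    where
    h : PartialColoring
    h u with u ≟ v
    ... | yes _ = just c
    ... | no _ = g u
    h-at : h v ≡ just c
    h-at with v ≟ v
    ... | yes _ = refl
    ... | no v≢v = contradiction refl v≢v
    g⊆h : Extends g h
    g⊆h {u} eq′ with u ≟ v
    ... | yes refl = case trans (sym eq) eq′ of λ ()
    ... | no _ = eq′
    proper-h : Proper h
    proper-h {u} {w} adj eq₁ eq₂ with u ≟ v | w ≟ v
    ... | yes refl | yes refl = irrefl refl adj
    ... | yes refl | no _ = free adj (trans eq₂ (sym eq₁))
    ... | no _ | yes refl = free (~-sym adj) (trans eq₁ (sym eq₂))
    ... | no _ | no _ = proper adj eq₁ eq₂

  color-all : Proper g → ∀ k → k ≤ n →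
              ∃ λ h → Proper h × Extends g h × (∀ v → toℕ v < k → ∃ λ c → h v ≡ just c)
  color-all {g} proper zero _ = g , proper , id , λ _ ()
  color-all proper (suc k) k<n with color-all proper k (<⇒≤ k<n)
  ... | h , proper-h , g⊆h , done with color-one proper-h (fromℕ< k<n)
  ...   | h′ , proper-h′ , h⊆h′ , c , at-k = h′ , proper-h′ , h⊆h′ ∘ g⊆h , done′
    where
    done′ : ∀ v → toℕ v < suc k → ∃ λ c → h′ v ≡ just c
    done′ v v<1+k with m<1+n⇒m<n∨m≡n v<1+k
    ... | inj₁ v<k = let c , eq = done v v<k in c , h⊆h′ eq
    ... | inj₂ v≡k = c , trans (cong h′ (Fin.toℕ-injective (trans v≡k (sym (Fin.toℕ-fromℕ< k<n))))) at-k

  b-coloring : Proper g → (∀ c → ∃ λ z → g z ≡ just c × Rainbow g z) →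
               ∃ λ (f : Fin n → Fin (suc d)) → IsBColoring G f
  b-coloring {g} proper dominated with color-all proper n ≤-refl
  ... | h , proper-h , g⊆h , done = f , coloring , b-vertex
    where
    f : Fin n → Fin (suc d)
    f v = proj₁ (done v (toℕ<n v))
    h≡f : ∀ v → h v ≡ just (f v)
    h≡f v = proj₂ (done v (toℕ<n v))
    g≡f : g v ≡ just c → f v ≡ c
    g≡f {v} eq = Maybe.just-injective (trans (sym (h≡f v)) (g⊆h eq))
    coloring : IsColoring G f
    coloring {u} {v} adj eq = proper-h adj (h≡f u) (trans (h≡f v) (cong just (sym eq)))
    b-vertex : ∀ c → _
    b-vertex c with dominated c
    ... | z , z-c , r = z , g≡f z-c ,
          (λ { (u , adj , eq) c≡ → coloring adj (trans (g≡f z-c) (trans c≡ (sym eq))) }) ,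
          λ {c′} c≢c′ → case Rainbow.onto r c′ of λ
            { (u , inj₁ refl , eq) → contradiction (trans (sym (g≡f z-c)) (g≡f eq)) c≢c′
            ; (u , inj₂ adj , eq) → u , adj , g≡f eq }

  Free : PartialColoring → Fin n → Fin (suc d) → Set
  Free g z c = ∀ v → Near z v → g v ≢ just c

  Blocked : PartialColoring → Fin n → Fin (suc d) → Set
  Blocked g v c = ∃ λ u → v ~ u × g u ≡ just c

  NearBlank : PartialColoring → Fin n → Fin n → Set
  NearBlank g z v = Near z v × g v ≡ nothing

  free? : ∀ g z c → Dec (Free g z c)
  free? g z c = all? λ v → near? z v →-dec ¬? (colored? g v c)

  blocked? : ∀ g v c → Dec (Blocked g v c)
  blocked? g v c = any? λ u → (v ~? u) ×-dec colored? g u c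

  nearBlank? : ∀ g z v → Dec (NearBlank g z v)
  nearBlank? g z v = near? z v ×-dec Maybe.≡-dec _≟_ (g v) nothing

  module _ {g : PartialColoring} (proper : Proper g) (z : Fin n) (E : Enumeration (Near z) (suc d)) where

    private
      module E = Enumeration E

      pre : Fin (suc d) → Maybe (Fin (suc d))
      pre p = g (E.at p)

      bad? : ∀ p c → Dec (Blocked g (E.at p) c)
      bad? p c = blocked? g (E.at p) c

    -- An instance of `complete`: the positions are the closed neighborhood of `z`, the prescribed
    -- values are the colors already there, and a color is bad for a vertex if a colored neighbor
    -- bears it. Conflicts among the blank vertices cannot arise, since a permutation gives them
    -- distinct colors.
    rainbow-assignment : ∀ t →
      (∀ {u v c} → Near z u → Near z v → g u ≡ just c → g v ≡ just c → u ≡ v) →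
      (∀ {v} → NearBlank g z v → count (λ c → free? g z c ×-dec blocked? g v c) ≤ t) →
      (∀ {c} → Free g z c → count (λ v → nearBlank? g z v ×-dec blocked? g v c) ≤ t) →
      t + t ≤ count (nearBlank? g z) →
      ∃ λ (σ : Permutation′ (suc d)) →
        (∀ {p q} → g (E.at p) ≡ just q → σ ⟨$⟩ʳ p ≡ q) ×
        (∀ {p} → g (E.at p) ≡ nothing → ¬ Blocked g (E.at p) (σ ⟨$⟩ʳ p))
    rainbow-assignment t inj rows cols room =
      complete pre bad? (λ eq eq′ → E.injective (inj (E.sound _) (E.sound _) eq eq′)) few
      where
      unused-free : Unused pre c → Free g z c
      unused-free unused v near eq =
        let p , at-p = E.index near in unused p (trans (cong g at-p) eq)
      few : ∀ {p q} → Unset pre p → Unused pre q → Blocked g (E.at p) q →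
            count (λ q′ → unused? pre q′ ×-dec bad? p q′) +
            count (λ p′ → unset? pre p′ ×-dec bad? p′ q) ≤ count (unset? pre)
      few {p} {q} un unused _ = begin
        count (λ q′ → unused? pre q′ ×-dec bad? p q′) + count (λ p′ → unset? pre p′ ×-dec bad? p′ q)
          ≤⟨ +-mono-≤
               (≤-trans (count-mono (λ q′ → unused? pre q′ ×-dec bad? p q′)
                                    (λ c → free? g z c ×-dec blocked? g (E.at p) c)
                          λ (unused , bad) → unused-free unused , bad)
                        (rows (E.sound p , un)))
               (≤-trans (count-transfer (λ p′ → unset? pre p′ ×-dec bad? p′ q)
                                        (λ v → nearBlank? g z v ×-dec blocked? g v q)
                                        (λ p v → E.at p ≟ v)
                          (λ {p′} (un , bad) → E.at p′ , ((E.sound p′ , un) , bad) , refl)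
                          λ eq eq′ → E.injective (trans eq (sym eq′)))
                        (cols (unused-free unused))) ⟩
        t + t ≤⟨ room ⟩
        count (nearBlank? g z)
          ≤⟨ count-transfer (nearBlank? g z) (unset? pre) (λ v p → E.at p ≟ v)
               (λ (near , blank) → let p , at-p = E.index near in p , trans (cong g at-p) blank , at-p)
               (λ eq eq′ → trans (sym eq) eq′) ⟩
        count (unset? pre) ∎
        where open ≤-Reasoning

    module _ (σ : Permutation′ (suc d))
             (placed : ∀ {p q} → g (E.at p) ≡ just q → σ ⟨$⟩ʳ p ≡ q)
             (fresh : ∀ {p} → g (E.at p) ≡ nothing → ¬ Blocked g (E.at p) (σ ⟨$⟩ʳ p)) where

      -- The last component records the color at each position of `E`. The first neighborhood of a
      -- star relies on it for its fixed coloring; later neighborhoods only have to be rainbow.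
      assign-rainbow : ∃ λ h → Proper h × Extends g h × Rainbow h z ×
                               (∀ {v c} → h v ≡ just c → g v ≡ just c ⊎ Near z v) ×
                               (∀ p → h (E.at p) ≡ just (σ ⟨$⟩ʳ p))
      assign-rainbow = h , proper-h , (λ {v} {c} → g⊆h {v} {c}) , rainbow , origin , h-at
        where
        new : ∀ {v} → Dec (Near z v) → Maybe (Fin (suc d))
        new (yes near) = just (σ ⟨$⟩ʳ proj₁ (E.index near))
        new (no _) = nothing
        h : PartialColoring
        h v = g v <∣> new (near? z v)
        g⊆h : Extends g h
        g⊆h eq rewrite eq = refl
        h-at : ∀ p → h (E.at p) ≡ just (σ ⟨$⟩ʳ p)
        h-at p with g (E.at p) in eq
        ... | just q = cong just (sym (placed eq))
        ... | nothing with near? z (E.at p)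
        ...   | yes near = cong (just ∘ (σ ⟨$⟩ʳ_)) (E.injective (proj₂ (E.index near)))
        ...   | no far = contradiction (E.sound p) far
        source : ∀ {v c} → h v ≡ just c →
                 g v ≡ just c ⊎ (∃ λ p → E.at p ≡ v × g (E.at p) ≡ nothing × σ ⟨$⟩ʳ p ≡ c)
        source {v} eq with g v in eq-v
        ... | just _ = inj₁ eq
        ... | nothing with near? z v
        ...   | yes near = let p , at-p = E.index near in
                           inj₂ (p , at-p , trans (cong g at-p) eq-v , Maybe.just-injective eq)
        origin : ∀ {v c} → h v ≡ just c → g v ≡ just c ⊎ Near z v
        origin eq = Sum.map₂ (λ { (p , refl , _) → E.sound p }) (source eq)
        clash : ∀ {u c p} → g (E.at p) ≡ nothing → σ ⟨$⟩ʳ p ≡ c → g u ≡ just c → ¬ (E.at p ~ u)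
        clash blank refl eq adj = fresh blank (_ , adj , eq)
        proper-h : Proper h
        proper-h adj eq eq′ with source eq | source eq′
        ... | inj₁ old | inj₁ old′ = proper adj old old′
        ... | inj₂ (p , refl , blank , σp) | inj₁ old = clash blank σp old adj
        ... | inj₁ old | inj₂ (p , refl , blank , σp) = clash blank σp old (~-sym adj)
        ... | inj₂ (p , refl , _ , σp) | inj₂ (p′ , refl , _ , σp′) =
              irrefl (cong E.at (injectiveʳ σ (trans σp (sym σp′)))) adj
        rainbow : Rainbow h z
        rainbow = record
          { total = λ near → let p , at-p = E.index near in
              σ ⟨$⟩ʳ p , trans (cong h (sym at-p)) (h-at p)
          ; injective = λ near near′ eq eq′ →
              let p , at-p = E.index near ; p′ , at-p′ = E.index near′ in
              trans (sym at-p) (trans (cong E.at (injectiveʳ σ (Maybe.just-injective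
                (trans (sym (trans (cong h (sym at-p)) (h-at p)))
                  (trans eq (trans (sym eq′) (trans (cong h (sym at-p′)) (h-at p′)))))))) at-p′)
          ; onto = λ c → E.at (σ ⟨$⟩ˡ c) , E.sound _ , trans (h-at _) (cong just (inverseʳ σ)) }

  make-rainbow : ∀ {g} → Proper g → ∀ z t →
    (∀ {u v c} → Near z u → Near z v → g u ≡ just c → g v ≡ just c → u ≡ v) →
    (∀ {v} → NearBlank g z v → count (λ c → free? g z c ×-dec blocked? g v c) ≤ t) →
    (∀ {c} → Free g z c → count (λ v → nearBlank? g z v ×-dec blocked? g v c) ≤ t) →
    t + t ≤ count (nearBlank? g z) →
    ∃ λ h → Proper h × Extends g h × Rainbow h z ×
            (∀ {v c} → h v ≡ just c → g v ≡ just c ⊎ Near z v)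
  make-rainbow proper z t inj rows cols room =
    let E = enumerate (near? z) (count-near z)
        σ , placed , fresh = rainbow-assignment proper z E t inj rows cols room
        h , proper-h , g⊆h , rainbow , origin , _ = assign-rainbow proper z E σ placed fresh
    in h , proper-h , (λ {v} {c} → g⊆h {v} {c}) , rainbow , origin

-- Stars

count-below : ∀ n i → count (λ (j : Fin n) → toℕ j <? i) ≤ i
count-below n i = count-inj {n} {k = i} {S = λ j j′ → toℕ j ≡ toℕ j′} (λ j → toℕ j <? i) (λ j j′ → toℕ j Data.Nat.≟ toℕ j′)
  (λ j<i → fromℕ< j<i , sym (Fin.toℕ-fromℕ< j<i))
  (λ eq eq′ → Fin.toℕ-injective (trans eq (sym eq′)))

module Stars (G : Graph n) (d : ℕ) (regular : Regular d G) (no-C₄ : ¬ Contains G C₄) where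

  open Graph G renaming (sym to ~-sym)
  open PartialColorings G d regular

  private
    variable
      g : PartialColoring
      u v w z a b : Fin n
      c : Fin (suc d)

  -- Otherwise `u`, `a`, `v`, `b` form a 4-cycle. The hypothesis on 4-cycles enters only through
  -- this lemma.
  common-neighbor : u ≢ v → u ~ a → u ~ b → v ~ a → v ~ b → a ≡ b
  common-neighbor {u} {v} {a} {b} u≢v ua ub va vb with a ≟ b
  ... | yes a≡b = a≡b
  ... | no a≢b = contradiction (f , (λ {i} {j} → f-injective {i} {j}) , λ {i} {j} → f-hom i j) no-C₄
    where
    pattern 0F = zero
    pattern 1F = suc zero
    pattern 2F = suc (suc zero)
    pattern 3F = suc (suc (suc zero))
    f : Fin 4 → Fin n
    f 0F = u
    f 1F = a
    f 2F = v
    f 3F = b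
    f-injective : ∀ {i j} → f i ≡ f j → i ≡ j
    f-injective {0F} {0F} _ = refl
    f-injective {0F} {1F} eq = contradiction eq (~⇒≢ ua)
    f-injective {0F} {2F} eq = contradiction eq u≢v
    f-injective {0F} {3F} eq = contradiction eq (~⇒≢ ub)
    f-injective {1F} {0F} eq = contradiction (sym eq) (~⇒≢ ua)
    f-injective {1F} {1F} _ = refl
    f-injective {1F} {2F} eq = contradiction (sym eq) (~⇒≢ va)
    f-injective {1F} {3F} eq = contradiction eq a≢b
    f-injective {2F} {0F} eq = contradiction (sym eq) u≢v
    f-injective {2F} {1F} eq = contradiction eq (~⇒≢ va)
    f-injective {2F} {2F} _ = refl
    f-injective {2F} {3F} eq = contradiction eq (~⇒≢ vb)
    f-injective {3F} {0F} eq = contradiction (sym eq) (~⇒≢ ub)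
    f-injective {3F} {1F} eq = contradiction (sym eq) a≢b
    f-injective {3F} {2F} eq = contradiction (sym eq) (~⇒≢ vb)
    f-injective {3F} {3F} _ = refl
    f-hom : ∀ i j → Graph._~_ C₄ i j → f i ~ f j
    f-hom 0F 1F _ = ua
    f-hom 0F 3F _ = ub
    f-hom 1F 0F _ = ~-sym ua
    f-hom 1F 2F _ = ~-sym va
    f-hom 2F 1F _ = va
    f-hom 2F 3F _ = vb
    f-hom 3F 0F _ = ~-sym ub
    f-hom 3F 2F _ = ~-sym vb
    f-hom 0F 0F = λ { (inj₁ ()) ; (inj₂ ()) }
    f-hom 0F 2F = λ { (inj₁ ()) ; (inj₂ ()) }
    f-hom 1F 1F = λ { (inj₁ ()) ; (inj₂ ()) }
    f-hom 1F 3F = λ { (inj₁ ()) ; (inj₂ ()) }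
    f-hom 2F 0F = λ { (inj₁ ()) ; (inj₂ ()) }
    f-hom 2F 2F = λ { (inj₁ ()) ; (inj₂ ()) }
    f-hom 3F 1F = λ { (inj₁ ()) ; (inj₂ ()) }
    f-hom 3F 3F = λ { (inj₁ ()) ; (inj₂ ()) }

  module StarAt (x : Fin n) (E : Enumeration (x ~_) d) where

    open Enumeration E public renaming
      (at to e; sound to x~e; injective to e-injective; index to e-index)

    -- `domain` is what keeps the induction going: with all colored vertices confined to the closed
    -- neighborhood of `x` and to the leaves of the first `i` neighbors, few vertices can obstruct
    -- the next step.
    record StarColoring (i : ℕ) (g : PartialColoring) : Set where
      field
        proper    : Proper g
        center    : g x ≡ just zero
        neighbor  : ∀ j → g (e j) ≡ just (suc j)
        rainbow-x : Rainbow g x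
        rainbow-e : ∀ j → toℕ j < i → Rainbow g (e j)
        domain    : g v ≡ just c → Near x v ⊎ (∃ λ j → toℕ j < i × e j ~ v)

    initial : ∃ (StarColoring 0)
    initial =
      let h , proper-h , _ , rainbow , origin , at-p =
            assign-rainbow {g = λ _ → nothing} (λ _ ()) x near-E Perm.id (λ ()) (λ _ ())
      in h , record
        { proper = proper-h ; center = at-p zero ; neighbor = at-p ∘ suc
        ; rainbow-x = rainbow ; rainbow-e = λ _ ()
        ; domain = λ eq → case origin eq of λ { (inj₂ near) → inj₁ near } }
      where
      at : Fin (suc d) → Fin n
      at zero = x
      at (suc j) = e j
      near-E : Enumeration (Near x) (suc d)
      near-E = record
        { at = at
        ; sound = λ { zero → inj₁ refl ; (suc j) → inj₂ (x~e j) }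
        ; injective = at-injective
        ; index = λ { (inj₁ refl) → zero , refl ; (inj₂ adj) → let j , eq = e-index adj in suc j , eq } }
        where
        at-injective : ∀ {i j} → at i ≡ at j → i ≡ j
        at-injective {zero} {zero} _ = refl
        at-injective {zero} {suc j} eq = contradiction eq (~⇒≢ (x~e j))
        at-injective {suc i} {zero} eq = contradiction (sym eq) (~⇒≢ (x~e i))
        at-injective {suc i} {suc j} eq = cong suc (e-injective eq)

    module Step {i} (S : StarColoring i g) (i<d : i < d) where
      open StarColoring S

      j₀ : Fin d
      j₀ = fromℕ< i<d

      z₀ : Fin n
      z₀ = e j₀

      earlier : ∀ {j} → toℕ j < i → e j ≢ z₀
      earlier {j} j<i eq = <⇒≢ j<i (trans (cong toℕ (e-injective eq)) (Fin.toℕ-fromℕ< i<d))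

      -- A leaf of an earlier `e j` that is adjacent to `z₀` is a common neighbor of `e j` and `z₀`,
      -- and `x` is the only one.
      colored-near : Near z₀ u → g u ≡ just c → Near x u
      colored-near (inj₁ refl) _ = inj₂ (x~e j₀)
      colored-near (inj₂ adj) eq with domain eq
      ... | inj₁ near = near
      ... | inj₂ (j , j<i , adj′) = inj₁ (sym
              (common-neighbor (earlier j<i) (~-sym (x~e j)) adj′ (~-sym (x~e j₀)) adj))

      near-not-blank : Near x v → g v ≢ nothing
      near-not-blank near blank = case trans (sym blank) (proj₂ (Rainbow.total rainbow-x near)) of λ ()

      blank-adj : NearBlank g z₀ v → z₀ ~ v
      blank-adj (inj₂ adj , _) = adj
      blank-adj (inj₁ refl , blank) = contradiction blank (near-not-blank (inj₂ (x~e j₀)))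

      free≢z₀ : Free g z₀ c → g u ≡ just c → z₀ ≢ u
      free≢z₀ free eq refl = free z₀ (inj₁ refl) eq

      -- If `u` were adjacent to `x`, then `x` and `v` would be two common neighbors of `u` and
      -- `z₀`, which differ because `c` is free around `z₀`. So only leaves of earlier neighbors can
      -- block.
      blocker : NearBlank g z₀ v → Free g z₀ c → v ~ u → g u ≡ just c →
                ¬ Near x u × (∃ λ j → toℕ j < i × e j ~ u)
      blocker {v} {c} {u} nb@(_ , blank) free adj eq = not-near , later (domain eq)
        where
        not-near : ¬ Near x u
        not-near (inj₁ refl) = near-not-blank (inj₂ (~-sym adj)) blank
        not-near (inj₂ x~u) = near-not-blank (inj₁ (sym
          (common-neighbor (free≢z₀ free eq) (~-sym (x~e j₀)) (blank-adj nb) (~-sym x~u) (~-sym adj)))) blank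
        later : Near x u ⊎ (∃ λ j → toℕ j < i × e j ~ u) → ∃ λ j → toℕ j < i × e j ~ u
        later (inj₁ near) = contradiction near not-near
        later (inj₂ p) = p

      -- Serves the small degrees: the excluded values are so many that for `d ≤ 2`, and around a
      -- triangle for `d = 3`, no color is blocked at all.
      blocked-color : NearBlank g z₀ v → Free g z₀ c → Blocked g v c →
                      c ≢ zero × c ≢ suc j₀ × (∃ λ j → toℕ j < i × ¬ (e j ~ z₀) ×
                        (∀ j′ → Near (e j) (e j′) → c ≢ suc j′))
      blocked-color {v} {c} nb@(_ , blank) free (u , adj , eq) =
        let ¬near , j , j<i , adj′ = blocker nb free adj eq in
        (λ { refl → free x (inj₂ (~-sym (x~e j₀))) center }) ,
        (λ { refl → free z₀ (inj₁ refl) (neighbor j₀) }) ,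
        j , j<i ,
        (λ adj″ → near-not-blank (inj₂ (subst (x ~_)
          (common-neighbor (free≢z₀ free eq) (~-sym adj″) (blank-adj nb) (~-sym adj′) (~-sym adj)) (x~e j))) blank) ,
        λ { j′ near refl → ¬near (inj₂ (subst (x ~_)
          (Rainbow.injective (rainbow-e j j<i) near (inj₂ adj′) (neighbor j′) eq) (x~e j′))) }

      -- A blocked color sits on a common neighbor of `v` and some earlier `e j`, and each `j`
      -- admits only one such vertex.
      rows : NearBlank g z₀ v → count (λ c → free? g z₀ c ×-dec blocked? g v c) ≤ i
      rows {v} nb@(_ , blank) = ≤-trans
        (count-transfer (λ c → free? g z₀ c ×-dec blocked? g v c) (λ j → toℕ j <? i)
          (λ c j → any? λ u → (e j ~? u) ×-dec ((v ~? u) ×-dec colored? g u c))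
          (λ (free , u , adj , eq) → let _ , j , j<i , adj′ = blocker nb free adj eq in
             j , j<i , u , adj′ , adj , eq)
          λ { {c} {c′} {j} (u , adj₁ , adj₂ , eq) (u′ , adj₁′ , adj₂′ , eq′) →
              let e≢v = λ e≡v → near-not-blank (inj₂ (subst (x ~_) e≡v (x~e j))) blank in
              Maybe.just-injective (trans (sym eq)
                (trans (cong g (common-neighbor e≢v adj₁ adj₁′ adj₂ adj₂′)) eq′)) })
        (count-below d i)

      -- For each earlier `j` only one vertex around `e j` bears `c`, as that neighborhood is
      -- rainbow, and this vertex has at most one common neighbor with `z₀`.
      cols : Free g z₀ c → count (λ v → nearBlank? g z₀ v ×-dec blocked? g v c) ≤ i
      cols {c} free = ≤-trans
        (count-transfer (λ v → nearBlank? g z₀ v ×-dec blocked? g v c) (λ j → toℕ j <? i)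
          (λ v j → nearBlank? g z₀ v ×-dec ((toℕ j <? i) ×-dec
             any? λ u → (e j ~? u) ×-dec ((v ~? u) ×-dec colored? g u c)))
          (λ (nb , u , adj , eq) → let _ , j , j<i , adj′ = blocker nb free adj eq in
             j , j<i , nb , j<i , u , adj′ , adj , eq)
          λ { {v} {v′} {j} (nb , j<i , u , adj₁ , adj₂ , eq) (nb′ , _ , u′ , adj₁′ , adj₂′ , eq′) →
              let u≡u′ = Rainbow.injective (rainbow-e j j<i) (inj₂ adj₁) (inj₂ adj₁′) eq eq′ in
              common-neighbor (free≢z₀ free eq) (blank-adj nb) (blank-adj nb′) (~-sym adj₂)
                (~-sym (subst (v′ ~_) (sym u≡u′) adj₂′)) })
        (count-below d i)

      -- Of the `suc d` vertices in the closed neighborhood, at most three are colored: `z₀`, `x`,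
      -- and one common neighbor of the two.
      room : d ∸ 2 ≤ count (nearBlank? g z₀)
      room = m≤n+o⇒m∸n≤o d 2 (s≤s⁻¹ (begin
        suc d                                             ≡⟨ count-near z₀ ⟨
        count (near? z₀)                                  ≡⟨ count-split (near? z₀) blank? ⟨
        count (nearBlank? g z₀) + count (λ v → near? z₀ v ×-dec ¬? (blank? v))
          ≤⟨ +-monoʳ-≤ (count (nearBlank? g z₀)) (≤-trans (sum-mono three)
               (≤-reflexive (trans (∑-distrib-+ (λ v → ⟦ v ≟ z₀ ⟧) (λ v → ⟦ v ≟ x ⟧ + ⟦ both? v ⟧))
                 (cong (count (_≟ z₀) +_) (∑-distrib-+ (λ v → ⟦ v ≟ x ⟧) (λ v → ⟦ both? v ⟧)))))) ⟩
        count (nearBlank? g z₀) + (count (_≟ z₀) + (count (_≟ x) + count both?))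
          ≤⟨ +-monoʳ-≤ (count (nearBlank? g z₀)) (+-mono-≤ (≤-reflexive (count-≟ z₀))
               (+-mono-≤ (≤-reflexive (count-≟ x)) (count-≤1 both?
                  λ (p , q) (p′ , q′) → common-neighbor (~⇒≢ (x~e j₀)) p p′ q q′))) ⟩
        count (nearBlank? g z₀) + 3                       ≡⟨ +-comm _ 3 ⟩
        3 + count (nearBlank? g z₀)                       ∎))
        where
        open ≤-Reasoning
        blank? = λ v → Maybe.≡-dec _≟_ (g v) nothing
        both? = λ v → (x ~? v) ×-dec (z₀ ~? v)
        three : ∀ v → ⟦ near? z₀ v ×-dec ¬? (blank? v) ⟧ ≤ ⟦ v ≟ z₀ ⟧ + (⟦ v ≟ x ⟧ + ⟦ both? v ⟧)
        three v = ≤-trans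
          (⟦⟧-cover (near? z₀ v ×-dec ¬? (blank? v)) (v ≟ z₀) ((v ≟ x) ⊎-dec both? v) split)
          (+-monoʳ-≤ ⟦ v ≟ z₀ ⟧ (⟦⟧-cover ((v ≟ x) ⊎-dec both? v) (v ≟ x) (both? v) id))
          where
          split : Near z₀ v × g v ≢ nothing → v ≡ z₀ ⊎ (v ≡ x ⊎ (x ~ v × z₀ ~ v))
          split (inj₁ eq , _) = inj₁ eq
          split (inj₂ adj , ¬blank) with g v in eq
          ... | nothing = contradiction refl ¬blank
          ... | just c with colored-near (inj₂ adj) eq
          ...   | inj₁ v≡x = inj₂ (inj₁ v≡x)
          ...   | inj₂ x~v = inj₂ (inj₂ (x~v , adj))

      Unblocked : Set
      Unblocked = ∀ {v c} → NearBlank g z₀ v → Free g z₀ c → ¬ Blocked g v c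

      advance : i + i ≤ d ∸ 2 ⊎ Unblocked → ∃ (StarColoring (suc i))
      advance possible =
        let h , proper-h , g⊆h , rainbow , origin = colour possible in h , record
        { proper = proper-h
        ; center = g⊆h center
        ; neighbor = g⊆h ∘ neighbor
        ; rainbow-x = rainbow-extends g⊆h rainbow-x
        ; rainbow-e = λ j j<1+i → case m<1+n⇒m<n∨m≡n j<1+i of λ
            { (inj₁ j<i) → rainbow-extends g⊆h (rainbow-e j j<i)
            ; (inj₂ j≡i) → subst (λ j → Rainbow h (e j))
                (Fin.toℕ-injective (trans (Fin.toℕ-fromℕ< i<d) (sym j≡i))) rainbow }
        ; domain = λ eq → case origin eq of λ
            { (inj₁ old) → Sum.map₂ (λ (j , j<i , adj) → j , m<n⇒m<1+n j<i , adj) (domain old)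
            ; (inj₂ (inj₁ refl)) → inj₁ (inj₂ (x~e j₀))
            ; (inj₂ (inj₂ adj)) → inj₂ (j₀ , ≤-reflexive (cong suc (Fin.toℕ-fromℕ< i<d)) , adj) } }
        where
        near-injective : ∀ {u v c} → Near z₀ u → Near z₀ v → g u ≡ just c → g v ≡ just c → u ≡ v
        near-injective near near′ eq eq′ =
          Rainbow.injective rainbow-x (colored-near near eq) (colored-near near′ eq′) eq eq′
        colour : i + i ≤ d ∸ 2 ⊎ Unblocked → _
        colour (inj₁ 2i≤) = make-rainbow proper z₀ i near-injective rows cols (≤-trans 2i≤ room)
        -- With nothing blocked the bounds hold for `t = 0`, and no blank vertices are required.
        colour (inj₂ unblocked) = make-rainbow proper z₀ 0 near-injective
          (λ {v} nb → ≤-reflexive (count-none (λ c → free? g z₀ c ×-dec blocked? g v c)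
             λ c (free , blocked) → unblocked nb free blocked))
          (λ {c} free → ≤-reflexive (count-none (λ v → nearBlank? g z₀ v ×-dec blocked? g v c)
             λ v (nb , blocked) → unblocked nb free blocked))
          z≤n

    star : ∀ m → m ≤ d →
           (∀ {i g} (S : StarColoring i g) (i<d : i < d) → i < m →
              i + i ≤ d ∸ 2 ⊎ Step.Unblocked S i<d) →
           ∃ (StarColoring m)
    star zero _ _ = initial
    star (suc m) m<d possible with star m (<⇒≤ m<d) (λ S i<d i<m → possible S i<d (m<n⇒m<1+n i<m))
    ... | g , S = Step.advance S m<d (possible S m<d ≤-refl)

    star-b-coloring : ∃ (StarColoring d) → ∃ λ (f : Fin n → Fin (suc d)) → IsBColoring G f
    star-b-coloring (g , S) = b-coloring proper λ
      { zero → x , center , rainbow-x ; (suc j) → e j , neighbor j , rainbow-e j (toℕ<n j) }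
      where open StarColoring S

-- Degrees at most three

no-three : ∀ {d} → d ≤ 2 → (a b c : Fin d) → a ≢ b → a ≢ c → b ≢ c → ⊥
no-three _ zero zero _ a≢b _ _ = a≢b refl
no-three _ zero (suc _) zero _ a≢c _ = a≢c refl
no-three _ (suc _) zero zero _ _ b≢c = b≢c refl
no-three (s≤s (s≤s z≤n)) zero (suc zero) (suc zero) _ _ b≢c = b≢c refl
no-three (s≤s (s≤s z≤n)) (suc zero) zero (suc zero) _ a≢c _ = a≢c refl
no-three (s≤s (s≤s z≤n)) (suc zero) (suc zero) _ a≢b _ _ = a≢b refl

module SmallDegree (G : Graph n) (d : ℕ) (regular : Regular d G) (no-C₄ : ¬ Contains G C₄) where

  open Graph G renaming (sym to ~-sym)
  open PartialColorings G d regular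
  open Stars G d regular no-C₄

  degree≤2 : d ≤ 2 → Fin n → ∃ λ (f : Fin n → Fin (suc d)) → IsBColoring G f
  degree≤2 d≤2 x = star-b-coloring (star d ≤-refl λ S i<d i<m → inj₂ (unblocked S i<d))
    where
    open StarAt x (enumerate (x ~?_) (degree-count x))
    unblocked : ∀ {i g} (S : StarColoring i g) (i<d : i < d) → Step.Unblocked S i<d
    unblocked S i<d {c = zero} nb free blocked =
      proj₁ (Step.blocked-color S i<d nb free blocked) refl
    unblocked S i<d {c = suc c} nb free blocked =
      let _ , c≢j₀ , j , j<i , _ , c≢near = Step.blocked-color S i<d nb free blocked in
      -- The blocked color, the current index and the blocking index would be three distinct
      -- elements of `Fin d`.
      no-three d≤2 c (Step.j₀ S i<d) j (c≢j₀ ∘ cong suc) (c≢near j (inj₁ refl) ∘ cong suc)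
        λ j₀≡j → Step.earlier S i<d j<i (cong e (sym j₀≡j))

module Triangle (G : Graph n) (regular : Regular 3 G) (no-C₄ : ¬ Contains G C₄) where

  open Graph G renaming (sym to ~-sym)
  open PartialColorings G 3 regular
  open Stars G 3 regular no-C₄

  triangle : ∀ {x a b} → x ~ a → x ~ b → a ~ b → ∃ λ (f : Fin n → Fin 4) → IsBColoring G f
  triangle {x} {a} {b} x~a x~b a~b =
    star-b-coloring (star 3 ≤-refl λ S i<d i<m → inj₂ (unblocked S i<d))
    where
    pair : Enumeration (λ v → v ≡ a ⊎ v ≡ b) 2
    pair = record
      { at = λ { zero → a ; (suc _) → b }
      ; sound = λ { zero → inj₁ refl ; (suc zero) → inj₂ refl }
      ; injective = λ { {zero} {zero} _ → refl
                      ; {zero} {suc zero} eq → contradiction eq (~⇒≢ a~b)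
                      ; {suc zero} {zero} eq → contradiction (sym eq) (~⇒≢ a~b)
                      ; {suc zero} {suc zero} _ → refl }
      ; index = λ { (inj₁ refl) → zero , refl ; (inj₂ refl) → suc zero , refl } }
    -- The adjacent neighbors `a` and `b` come first. The second then has only an adjacent
    -- predecessor, which cannot block. For the third, a blocking leaf hangs on `a` or `b`, both of
    -- whose neighborhoods contain the colors of `x`, `a` and `b`; the one remaining color is that
    -- of the third neighbor itself.
    neighbors : Enumeration (x ~_) 3
    neighbors = extend-enumeration (λ v → (v ≟ a) ⊎-dec (v ≟ b)) (x ~?_)
                  (λ { (inj₁ refl) → x~a ; (inj₂ refl) → x~b }) pair (degree-count x)
    open StarAt x neighbors
    impossible : (j j₀ c : Fin 3) → toℕ j < toℕ j₀ → ¬ (e j ~ e j₀) → c ≢ j₀ →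
                 (∀ j′ → Near (e j) (e j′) → c ≢ j′) → ⊥
    impossible zero (suc zero) _ _ ¬adj _ _ = ¬adj a~b
    impossible zero (suc (suc zero)) zero _ _ _ ≢near = ≢near zero (inj₁ refl) refl
    impossible zero (suc (suc zero)) (suc zero) _ _ _ ≢near = ≢near (suc zero) (inj₂ a~b) refl
    impossible zero (suc (suc zero)) (suc (suc zero)) _ _ c≢j₀ _ = c≢j₀ refl
    impossible (suc zero) (suc (suc zero)) zero _ _ _ ≢near = ≢near zero (inj₂ (~-sym a~b)) refl
    impossible (suc zero) (suc (suc zero)) (suc zero) _ _ _ ≢near = ≢near (suc zero) (inj₁ refl) refl
    impossible (suc zero) (suc (suc zero)) (suc (suc zero)) _ _ c≢j₀ _ = c≢j₀ refl
    impossible (suc zero) (suc zero) _ (s≤s ())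
    impossible (suc (suc zero)) (suc zero) _ (s≤s ())
    impossible (suc (suc zero)) (suc (suc zero)) _ (s≤s (s≤s ()))
    unblocked : ∀ {i g} (S : StarColoring i g) (i<3 : i < 3) → Step.Unblocked S i<3
    unblocked S i<3 {c = zero} nb free blocked =
      proj₁ (Step.blocked-color S i<3 nb free blocked) refl
    unblocked S i<3 {c = suc c} nb free blocked =
      let _ , c≢j₀ , j , j<i , ¬adj , c≢near = Step.blocked-color S i<3 nb free blocked in
      impossible j (Step.j₀ S i<3) c
        (subst (toℕ j <_) (sym (Fin.toℕ-fromℕ< i<3)) j<i) ¬adj (c≢j₀ ∘ cong suc)
        λ j′ near → c≢near j′ near ∘ cong suc

-- Merging two stars across a cut

double-sum-mono : {f g : Fin k → Fin l → ℕ} → (∀ i j → f i j ≤ g i j) →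
                  ∑[ i < k ] ∑[ j < l ] f i j ≤ ∑[ i < k ] ∑[ j < l ] g i j
double-sum-mono f≤g = sum-mono λ i → sum-mono (f≤g i)

double-sum-+ : (f g : Fin k → Fin l → ℕ) →
               ∑[ i < k ] ∑[ j < l ] (f i j + g i j) ≡
               ∑[ i < k ] ∑[ j < l ] f i j + ∑[ i < k ] ∑[ j < l ] g i j
double-sum-+ {l = l} f g = trans (sum-cong-≗ λ i → ∑-distrib-+ (f i) (g i))
                 (∑-distrib-+ (λ i → ∑[ j < l ] f i j) (λ i → ∑[ j < l ] g i j))

double-sum-comm : (f : Fin k → Fin k → Fin n → Fin n → ℕ) →
                  ∑[ i < k ] ∑[ j < k ] ∑[ p < n ] ∑[ q < n ] f i j p q ≡
                  ∑[ p < n ] ∑[ q < n ] ∑[ i < k ] ∑[ j < k ] f i j p q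
double-sum-comm {k} {n} f = begin
  ∑[ i < k ] ∑[ j < k ] ∑[ p < n ] ∑[ q < n ] f i j p q
    ≡⟨ sum-cong-≗ (λ i → ∑-comm λ j p → ∑[ q < n ] f i j p q) ⟩
  ∑[ i < k ] ∑[ p < n ] ∑[ j < k ] ∑[ q < n ] f i j p q
    ≡⟨ ∑-comm (λ i p → ∑[ j < k ] ∑[ q < n ] f i j p q) ⟩
  ∑[ p < n ] ∑[ i < k ] ∑[ j < k ] ∑[ q < n ] f i j p q
    ≡⟨ sum-cong-≗ (λ p → sum-cong-≗ λ i → ∑-comm (λ j q → f i j p q)) ⟩
  ∑[ p < n ] ∑[ i < k ] ∑[ q < n ] ∑[ j < k ] f i j p q
    ≡⟨ sum-cong-≗ (λ p → ∑-comm (λ i q → ∑[ j < k ] f i j p q)) ⟩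
  ∑[ p < n ] ∑[ q < n ] ∑[ i < k ] ∑[ j < k ] f i j p q ∎
  where open ≡-Reasoning

double-count-≤1 : {T : Fin k → Fin k → Set} (T? : ∀ i j → Dec (T i j)) →
                  (∀ {i j i′ j′} → T i j → T i′ j′ → i ≡ i′ × j ≡ j′) →
                  ∑[ i < k ] ∑[ j < k ] ⟦ T? i j ⟧ ≤ 1
double-count-≤1 {k} T? uniq = begin
  ∑[ i < k ] ∑[ j < k ] ⟦ T? i j ⟧           ≤⟨ sum-mono row ⟩
  count (λ i → any? (T? i))                     ≤⟨ count-≤1 (λ i → any? (T? i)) (λ (_ , t) (_ , t′) → proj₁ (uniq t t′)) ⟩
  1                                             ∎
  where
  open ≤-Reasoning
  row : ∀ i → count (T? i) ≤ ⟦ any? (T? i) ⟧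
  row i with any? (T? i)
  ... | yes _ = count-≤1 (T? i) λ t t′ → proj₂ (uniq t t′)
  ... | no none = ≤-reflexive (count-none (T? i) λ j t → none (j , t))

matrix-count : {T : Fin k → Fin k → Fin n → Fin n → Set} {R : Fin n → Fin n → Set}
               (T? : ∀ i j p q → Dec (T i j p q)) (R? : ∀ p q → Dec (R p q)) →
               (∀ {i j p q} → T i j p q → R p q) →
               (∀ {i j i′ j′ p q} → T i j p q → T i′ j′ p q → i ≡ i′ × j ≡ j′) →
               ∑[ i < k ] ∑[ j < k ] ∑[ p < n ] ∑[ q < n ] ⟦ T? i j p q ⟧ ≤
               ∑[ p < n ] ∑[ q < n ] ⟦ R? p q ⟧
matrix-count {k} {n} T? R? T⇒R uniq = ≤-trans
  (≤-reflexive (double-sum-comm (λ i j p q → ⟦ T? i j p q ⟧)))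
  (double-sum-mono bound)
  where
  bound : ∀ p q → ∑[ i < k ] ∑[ j < k ] ⟦ T? i j p q ⟧ ≤ ⟦ R? p q ⟧
  bound p q with R? p q
  ... | yes _ = double-count-≤1 (λ i j → T? i j p q) uniq
  ... | no ¬r = ≤-reflexive (sum-zero λ i → count-none (λ j → T? i j p q) λ j t → ¬r (T⇒R t))

-- Selecting neighbors of small total weight

record Selection (S : Pred (Fin n) 0ℓ) (ω : Fin n → ℕ) (m ε : ℕ) : Set₁ where
  field
    {Chosen} : Pred (Fin n) 0ℓ
    chosen?  : Decidable Chosen
    chosen⊆  : ∀ {i} → Chosen i → S i
    cardinal : count chosen? ≡ m
    light    : sum (λ i → ⟦ chosen? i ⟧ * ω i) + ε ≤ m

without? : {S : Pred (Fin n) 0ℓ} → Decidable S → (a : Fin n) → Decidable (λ i → S i × i ≢ a)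
without? S? a i = S? i ×-dec ¬? (i ≟ a)

count-without : {S : Pred (Fin n) 0ℓ} (S? : Decidable S) {a : Fin n} → S a →
                suc (count (without? S? a)) ≡ count S?
count-without S? {a} a∈S = begin
  1 + count (without? S? a)                                ≡⟨ cong (_+ count (without? S? a)) (count-≟ a) ⟨
  count (_≟ a) + count (without? S? a)
    ≡⟨ cong (_+ count (without? S? a)) (count-cong (_≟ a) (λ i → S? i ×-dec (i ≟ a)) (λ { refl → a∈S , refl }) proj₂) ⟩
  count (λ i → S? i ×-dec (i ≟ a)) + count (without? S? a) ≡⟨ count-split S? (_≟ a) ⟩
  count S?                                                 ∎
  where open ≡-Reasoning

-- Deleting a member of positive weight lowers the left side by at least one, as much as the right
-- side drops. If all weights vanish, `ε ≤ m` suffices. In the application `ε` is the number of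
-- conflicts that remain whatever is chosen.
removable : ∀ r {S : Pred (Fin n) 0ℓ} (S? : Decidable S) (ω : Fin n → ℕ) {m ε} →
            count S? ≡ suc r + m → ε ≤ m → sum (λ i → ⟦ S? i ⟧ * ω i) + ε ≤ suc r + m →
            ∃ λ a → S a × sum (λ i → ⟦ without? S? a i ⟧ * ω i) + ε ≤ r + m
removable r S? ω {m} {ε} card ε≤m light with any? (λ i → S? i ×-dec (0 <? ω i))
... | yes (a , a∈S , 0<ωa) = a , a∈S , s≤s⁻¹ (begin
    suc (sum (λ i → ⟦ S′? i ⟧ * ω i) + ε)
      ≡⟨ cong (_+ ε) (trans (+-comm 1 (sum (λ i → ⟦ S′? i ⟧ * ω i)))
           (trans (cong (sum (λ i → ⟦ S′? i ⟧ * ω i) +_) (sym (count-≟ a)))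
             (sym (∑-distrib-+ (λ i → ⟦ S′? i ⟧ * ω i) (λ i → ⟦ i ≟ a ⟧))))) ⟩
    sum (λ i → ⟦ S′? i ⟧ * ω i + ⟦ i ≟ a ⟧) + ε   ≤⟨ +-monoˡ-≤ ε (sum-mono lighter) ⟩
    sum (λ i → ⟦ S? i ⟧ * ω i) + ε                ≤⟨ light ⟩
    suc r + m                                     ∎)
  where
  open ≤-Reasoning
  S′? = without? S? a
  lighter : ∀ i → ⟦ S′? i ⟧ * ω i + ⟦ i ≟ a ⟧ ≤ ⟦ S? i ⟧ * ω i
  lighter i with S? i | i ≟ a
  ... | yes _ | yes refl = ≤-trans 0<ωa (m≤m+n (ω a) 0)
  ... | yes _ | no _ = ≤-reflexive (+-identityʳ _)
  ... | no ¬s | yes refl = contradiction a∈S ¬s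
  ... | no _ | no _ = z≤n
... | no weightless with count-pos S? (subst (0 <_) (sym card) z<s)
...   | a , a∈S = a , a∈S ,
      ≤-trans (≤-reflexive (cong (_+ ε) (sum-zero weight))) (≤-trans ε≤m (m≤n+m m r))
  where
  weight : ∀ i → ⟦ without? S? a i ⟧ * ω i ≡ 0
  weight i with S? i | i ≟ a
  ... | yes s | no _ = trans (+-identityʳ _) (n≤0⇒n≡0 (≮⇒≥ λ pos → weightless (i , s , pos)))
  ... | yes _ | yes _ = refl
  ... | no _ | _ = refl

select : ∀ r {S : Pred (Fin n) 0ℓ} (S? : Decidable S) (ω : Fin n → ℕ) {m ε} →
         count S? ≡ r + m → ε ≤ m → sum (λ i → ⟦ S? i ⟧ * ω i) + ε ≤ r + m →
         Selection S ω m ε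
select zero S? ω card ε≤m light = record
  { chosen? = S? ; chosen⊆ = id ; cardinal = card ; light = light }
select (suc r) S? ω card ε≤m light =
  let a , a∈S , light′ = removable r S? ω card ε≤m light
      rest = select r (without? S? a) ω (suc-injective (trans (count-without S? a∈S) card)) ε≤m light′
  in record { Selection rest ; chosen⊆ = proj₁ ∘ Selection.chosen⊆ rest }

-- Two blocks of colors

block : ∀ k {l} (i : Fin (k + l)) → (∃ λ j → j ↑ˡ l ≡ i) ⊎ (∃ λ j → k ↑ʳ j ≡ i)
block k i with splitAt k i in eq
... | inj₁ j = inj₁ (j , Fin.splitAt⁻¹-↑ˡ eq)
... | inj₂ j = inj₂ (j , Fin.splitAt⁻¹-↑ʳ {k} eq)

blockwise : (σ : Permutation′ k) (τ : Permutation′ l) → ∃ λ (κ : Permutation′ (k + l)) →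
            (∀ i → κ ⟨$⟩ʳ (i ↑ˡ l) ≡ (σ ⟨$⟩ʳ i) ↑ˡ l) × (∀ j → κ ⟨$⟩ʳ (k ↑ʳ j) ≡ k ↑ʳ (τ ⟨$⟩ʳ j))
blockwise {k} {l} σ τ =
  ↔-sym Fin.+↔⊎ ↔-∘ ((σ ⊎-↔ τ) ↔-∘ Fin.+↔⊎) ,
  (λ i → cong (λ s → join k l (Sum.map (σ ⟨$⟩ʳ_) (τ ⟨$⟩ʳ_) s)) (Fin.splitAt-↑ˡ k i l)) ,
  (λ j → cong (λ s → join k l (Sum.map (σ ⟨$⟩ʳ_) (τ ⟨$⟩ʳ_) s)) (Fin.splitAt-↑ʳ k l j))

-- A star dominates an initial segment of the colors. Reversing the colors of one of two stars
-- therefore makes the dominated blocks complementary.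
opposite-raise : ∀ k l (j : Fin (suc l)) → toℕ (opposite (suc k ↑ʳ j)) ≤ l
opposite-raise k l j = begin
  toℕ (opposite (suc k ↑ʳ j))                 ≡⟨ Fin.opposite-prop (suc k ↑ʳ j) ⟩
  (suc k + suc l) ∸ suc (toℕ (suc k ↑ʳ j))    ≡⟨ cong (λ i → (suc k + suc l) ∸ suc i) (Fin.toℕ-↑ʳ (suc k) j) ⟩
  (suc k + suc l) ∸ suc (suc k + toℕ j)       ≡⟨ cong ((suc k + suc l) ∸_) (+-suc (suc k) (toℕ j)) ⟨
  (suc k + suc l) ∸ (suc k + suc (toℕ j))     ≡⟨ [m+n]∸[m+o]≡n∸o (suc k) (suc l) (suc (toℕ j)) ⟩
  l ∸ toℕ j                                   ≤⟨ m∸n≤m l (toℕ j) ⟩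
  l                                           ∎
  where open ≤-Reasoning

module TwoStars (G : Graph n) (m m′ : ℕ) (regular : Regular (m + suc m′) G)
                (no-C₄ : ¬ Contains G C₄) where

  open Graph G renaming (sym to ~-sym)
  open PartialColorings G (m + suc m′) regular
  open Stars G (m + suc m′) regular no-C₄

  recolored-rainbow : ∀ {g h z} (κ : Permutation′ (suc (m + suc m′))) →
                      (∀ {v} → Near z v → h v ≡ Maybe.map (κ ⟨$⟩ʳ_) (g v)) →
                      Rainbow g z → Rainbow h z
  recolored-rainbow {g} {h} κ h≡κg r = record
    { total = λ near → let c , eq = R.total near in κ ⟨$⟩ʳ c , recolor near eq
    ; injective = λ near near′ eq eq′ →
        let c , old = R.total near ; c′ , old′ = R.total near′ in
        R.injective near near′ old (trans old′ (cong just (sym (injectiveʳ κ (Maybe.just-injective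
          (trans (sym (recolor near old)) (trans eq (trans (sym eq′) (recolor near′ old′)))))))))
    ; onto = λ c → let v , near , eq = R.onto (κ ⟨$⟩ˡ c) in
        v , near , trans (recolor near eq) (cong just (inverseʳ κ)) }
    where
    module R = Rainbow r
    recolor : ∀ {v c} → Near _ v → g v ≡ just c → h v ≡ just (κ ⟨$⟩ʳ c)
    recolor near eq = trans (h≡κg near) (cong (Maybe.map (κ ⟨$⟩ʳ_)) eq)

  -- The closed neighborhoods of the center and of the completed neighbors lie in `A`, so they stay
  -- rainbow when the coloring is used on `A` only. `M` names the completed neighbors independently
  -- of their order, as needed for summing weights.
  record InnerStar (A : Pred (Fin n) 0ℓ) (x : Fin n) (M : Pred (Fin n) 0ℓ) (i : ℕ) : Set where
    field
      E   : Enumeration (x ~_) (m + suc m′)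
      {g} : PartialColoring
    open StarAt x E public
    field
      coloring : StarColoring i g
      x-inner  : Interior A x
      M-inner  : ∀ {u} → M u → Interior A u
      e-chosen : ∀ j → toℕ j < i → M (e j)
    open StarColoring coloring public

    e-inner : ∀ j → toℕ j < i → Interior A (e j)
    e-inner j j<i = M-inner (e-chosen j j<i)

    Leaf : Fin n → Set
    Leaf p = ∃ λ u → M u × u ~ p

    module Boundary {p q} (p~q : p ~ q) (q∉A : ¬ A q) where

      p≢x : p ≢ x
      p≢x refl = q∉A (x-inner q (inj₂ p~q))

      reach : ∀ {c} → g p ≡ just c → x ~ p ⊎ Leaf p
      reach eq with domain eq
      ... | inj₁ (inj₁ p≡x) = contradiction p≡x p≢x
      ... | inj₁ (inj₂ adj) = inj₁ adj
      ... | inj₂ (j , j<i , adj) = inj₂ (e j , e-chosen j j<i , adj)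

      -- A neighbor of `x` with such a color is one of the completed ones, hence interior, whereas
      -- `p` has the neighbor `q` outside `A`.
      low⇒≁x : ∀ {c} → g p ≡ just c → toℕ c ≤ i → ¬ (x ~ p)
      low⇒≁x eq c≤i adj with e-index adj
      ... | j , refl = q∉A (e-inner j
              (subst (λ c → toℕ c ≤ i) (Maybe.just-injective (trans (sym eq) (neighbor j))) c≤i)
              q (inj₂ p~q))

    low-rainbow : ∀ c → toℕ c ≤ i → ∃ λ z → Interior A z × g z ≡ just c × Rainbow g z
    low-rainbow zero _ = x , x-inner , center , rainbow-x
    low-rainbow (suc j) j<i = e j , e-inner j j<i , neighbor j , rainbow-e j j<i

  module Sides {A B : Pred (Fin n) 0ℓ} (A? : Decidable A) (B? : Decidable B)
               (cover : ∀ v → A v ⊎ B v) (disjoint : ∀ {v} → A v → ¬ B v) where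

    Cut : Fin n → Fin n → Set
    Cut p q = A p × B q × p ~ q

    cut? : ∀ p q → Dec (Cut p q)
    cut? p q = A? p ×-dec (B? q ×-dec (p ~? q))

    module Merge {x y M N} (X : InnerStar A x M m) (Y : InnerStar B y N m′) where

      private
        module X = InnerStar X
        module Y = InnerStar Y

      -- A cut edge that becomes monochromatic if `c` is sent to `c′`. Only the colors on the side
      -- `A` are permuted.
      Clash : Fin (suc (m + suc m′)) → Fin (suc (m + suc m′)) → Fin n → Fin n → Set
      Clash c c′ p q = Cut p q × X.g p ≡ just c × Y.g q ≡ just c′

      clash? : ∀ c c′ p q → Dec (Clash c c′ p q)
      clash? c c′ p q = cut? p q ×-dec (colored? X.g p c ×-dec colored? Y.g q c′)

      left : Fin (suc m) → Fin (suc (m + suc m′))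
      left i = i ↑ˡ suc m′

      right : Fin (suc m′) → Fin (suc (m + suc m′))
      right j = suc m ↑ʳ j

      -- `opposite` appears because the permutation of a block is followed by the reversal of all
      -- colors.
      clashes : (Fin k → Fin (suc (m + suc m′))) → Fin k → Fin k → ℕ
      clashes block i j = ∑[ p < n ] ∑[ q < n ] ⟦ clash? (block i) (opposite (block j)) p q ⟧

      module _ (κ : Permutation′ (suc (m + suc m′)))
               (no-clash : ∀ {c p q} → ¬ Clash c (κ ⟨$⟩ʳ c) p q)
               (high : ∀ j → toℕ (κ ⟨$⟩ʳ (right j)) ≤ m′) where

        merged : PartialColoring
        merged v with A? v
        ... | yes _ = Maybe.map (κ ⟨$⟩ʳ_) (X.g v)
        ... | no _ = Y.g v

        merged-A : ∀ {v} → A v → merged v ≡ Maybe.map (κ ⟨$⟩ʳ_) (X.g v)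
        merged-A {v} a with A? v
        ... | yes _ = refl
        ... | no ¬a = contradiction a ¬a

        merged-B : ∀ {v} → B v → merged v ≡ Y.g v
        merged-B {v} b with A? v
        ... | yes a = contradiction b (disjoint a)
        ... | no _ = refl

        from-A : ∀ {v c} → A v → merged v ≡ just c → ∃ λ c′ → X.g v ≡ just c′ × κ ⟨$⟩ʳ c′ ≡ c
        from-A {v} a eq with X.g v | trans (sym (merged-A a)) eq
        ... | just c′ | refl = c′ , refl , refl

        crossing : ∀ {u v c} → A u → B v → u ~ v → merged u ≡ just c → merged v ≢ just c
        crossing a b adj eq eq′ with from-A a eq
        ... | c′ , old , refl = no-clash ((a , b , adj) , old , trans (sym (merged-B b)) eq′)

        proper-merged : Proper merged
        proper-merged {u} {v} adj eq eq′ with cover u | cover v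
        ... | inj₁ a | inj₂ b = crossing a b adj eq eq′
        ... | inj₂ b | inj₁ a = crossing a b (~-sym adj) eq′ eq
        ... | inj₂ b | inj₂ b′ =
              Y.proper adj (trans (sym (merged-B b)) eq) (trans (sym (merged-B b′)) eq′)
        ... | inj₁ a | inj₁ a′ with from-A a eq | from-A a′ eq′
        ...   | c , old , κc | c′ , old′ , κc′ =
                X.proper adj old (trans old′ (cong just (injectiveʳ κ (trans κc′ (sym κc)))))

        -- A color coming from the left block is dominated by the star in `A`. One coming from the
        -- right block is at most `m′` by `high`, and the star in `B` dominates those.
        dominated : ∀ c → ∃ λ z → merged z ≡ just c × Rainbow merged z
        dominated c = cases (block (suc m) (κ ⟨$⟩ˡ c))
          where
          cases : (∃ λ i → left i ≡ κ ⟨$⟩ˡ c) ⊎ (∃ λ j → right j ≡ κ ⟨$⟩ˡ c) → _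
          cases (inj₁ (i , eq)) =
            let z , inner , z-c , r = X.low-rainbow (κ ⟨$⟩ˡ c) (subst (λ c → toℕ c ≤ m) eq
                  (subst (_≤ m) (sym (Fin.toℕ-↑ˡ i (suc m′))) (s≤s⁻¹ (toℕ<n i))))
            in z , trans (merged-A (inner z (inj₁ refl)))
                     (trans (cong (Maybe.map (κ ⟨$⟩ʳ_)) z-c) (cong just (inverseʳ κ))) ,
               recolored-rainbow κ (λ near → merged-A (inner _ near)) r
          cases (inj₂ (j , eq)) =
            let z , inner , z-c , r = Y.low-rainbow c (subst (λ c → toℕ c ≤ m′)
                  (trans (cong (κ ⟨$⟩ʳ_) eq) (inverseʳ κ)) (high j))
            in z , trans (merged-B (inner z (inj₁ refl))) z-c ,
               recolored-rainbow Perm.id (λ near → trans (merged-B (inner _ near)) (sym (Maybe.map-id _))) r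

      avoids : (block : Fin k → Fin (suc (m + suc m′))) → ∀ {i j p q} → clashes block i j ≡ 0 →
               ¬ Clash (block i) (opposite (block j)) p q
      avoids block {i} {j} {p} {q} none clash = contradiction none (>⇒≢ (≤-trans
        (count-∃ (clash? (block i) (opposite (block j)) p) (q , clash))
        (term≤sum (λ p → ∑[ q < n ] ⟦ clash? (block i) (opposite (block j)) p q ⟧) p)))

      -- Each block has one color more than it has clashes, which is just what `avoid-matrix` asks
      -- for.
      merge : ∑[ i < suc m ] ∑[ j < suc m ] clashes left i j ≤ m →
              ∑[ i < suc m′ ] ∑[ j < suc m′ ] clashes right i j ≤ m′ →
              ∃ λ (f : Fin n → Fin (suc (m + suc m′))) → IsBColoring G f
      merge fewˡ fewʳ =
        let σ , σ-avoids = avoid-matrix (clashes left) fewˡ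
            τ , τ-avoids = avoid-matrix (clashes right) fewʳ
            κ , κ-left , κ-right = blockwise σ τ
        in merge-along σ τ κ σ-avoids τ-avoids κ-left κ-right
        where
        merge-along : ∀ σ τ κ → (∀ i → clashes left i (σ ⟨$⟩ʳ i) ≡ 0) → (∀ j → clashes right j (τ ⟨$⟩ʳ j) ≡ 0) →
                      (∀ i → κ ⟨$⟩ʳ (left i) ≡ left (σ ⟨$⟩ʳ i)) → (∀ j → κ ⟨$⟩ʳ (right j) ≡ right (τ ⟨$⟩ʳ j)) →
                      _
        merge-along σ τ κ σ-avoids τ-avoids κ-left κ-right =
          b-coloring (proper-merged ρ no-clash high) (dominated ρ no-clash high)
          where
          ρ = κ ∘ₚ Perm.reverse
          no-clash : ∀ {c p q} → ¬ Clash c (opposite (κ ⟨$⟩ʳ c)) p q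
          no-clash {c} {p} {q} clash = cases (block (suc m) c)
            where
            cases : (∃ λ i → left i ≡ c) ⊎ (∃ λ j → right j ≡ c) → ⊥
            cases (inj₁ (i , refl)) = avoids left {i} {σ ⟨$⟩ʳ i} (σ-avoids i)
              (subst (λ c′ → Clash (left i) (opposite c′) p q) (κ-left i) clash)
            cases (inj₂ (j , refl)) = avoids right {j} {τ ⟨$⟩ʳ j} (τ-avoids j)
              (subst (λ c′ → Clash (right j) (opposite c′) p q) (κ-right j) clash)
          high : ∀ j → toℕ (opposite (κ ⟨$⟩ʳ (right j))) ≤ m′
          high j = subst (λ c → toℕ (opposite c) ≤ m′) (sym (κ-right j)) (opposite-raise m m′ (τ ⟨$⟩ʳ j))

-- Cut edges seen from a vertex

module Exposure (G : Graph n) (d : ℕ) (regular : Regular d G) where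

  open Graph G renaming (sym to ~-sym)
  open PartialColorings G d regular

  Leaving : Pred (Fin n) 0ℓ → Fin n → Fin n → Set
  Leaving A p q = A p × ¬ A q × p ~ q

  InnerNeighbor : Pred (Fin n) 0ℓ → Fin n → Fin n → Set
  InnerNeighbor A x u = x ~ u × Interior A u

  module _ {A : Pred (Fin n) 0ℓ} (A? : Decidable A) where

    leaving? : ∀ p q → Dec (Leaving A p q)
    leaving? p q = A? p ×-dec (¬? (A? q) ×-dec (p ~? q))

    exposure : Fin n → ℕ
    exposure x = ∑[ p < n ] ∑[ q < n ] ⟦ (x ~? p) ×-dec leaving? p q ⟧


    innerNeighbor? : ∀ x u → Dec (InnerNeighbor A x u)
    innerNeighbor? x u = (x ~? u) ×-dec interior? A? u

    -- A neighbor of `x` that is not interior has an edge leaving `A`, and this edge contributes to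
    -- the exposure.
    inner-neighbors : ∀ {x} → Interior A x → d ≤ count (innerNeighbor? x) + exposure x
    inner-neighbors {x} inner = begin
      d                                                          ≡⟨ degree-count x ⟨
      count (x ~?_)                                              ≤⟨ sum-mono either ⟩
      ∑[ u < n ] (⟦ innerNeighbor? x u ⟧ + ∑[ q < n ] ⟦ (x ~? u) ×-dec leaving? u q ⟧)
        ≡⟨ ∑-distrib-+ (λ u → ⟦ innerNeighbor? x u ⟧) (λ u → ∑[ q < n ] ⟦ (x ~? u) ×-dec leaving? u q ⟧) ⟩
      count (innerNeighbor? x) + exposure x                      ∎
      where
      open ≤-Reasoning
      either : ∀ u → ⟦ x ~? u ⟧ ≤ ⟦ innerNeighbor? x u ⟧ + ∑[ q < n ] ⟦ (x ~? u) ×-dec leaving? u q ⟧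
      either u = ≤-trans
        (⟦⟧-cover (x ~? u) (innerNeighbor? x u) (any? λ q → (x ~? u) ×-dec leaving? u q) split)
        (+-monoʳ-≤ ⟦ innerNeighbor? x u ⟧ (⟦⟧-bound (any? λ q → (x ~? u) ×-dec leaving? u q)
          (count-∃ λ q → (x ~? u) ×-dec leaving? u q)))
        where
        split : x ~ u → InnerNeighbor A x u ⊎ (∃ λ q → x ~ u × Leaving A u q)
        split adj with interior? A? u
        ... | yes i = inj₁ (adj , i)
        ... | no ¬i with Fin.¬∀⟶∃¬ n _ (λ q → near? u q →-dec A? q) ¬i
        ...   | q , ¬imp with near? u q
        ...     | no ¬near = contradiction (λ near → contradiction near ¬near) ¬imp
        ...     | yes (inj₁ refl) = contradiction (λ _ → inner u (inj₂ adj)) ¬imp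
        ...     | yes (inj₂ adj′) = inj₂ (q , adj , inner u (inj₂ adj) , (λ a → ¬imp λ _ → a) , adj′)

-- Counting the clashes of two stars

module Balance (G : Graph n) (m m′ : ℕ) (regular : Regular (m + suc m′) G)
               (no-C₄ : ¬ Contains G C₄) where

  open Graph G renaming (sym to ~-sym)
  open PartialColorings G (m + suc m′) regular
  open Stars G (m + suc m′) regular no-C₄
  open TwoStars G m m′ regular no-C₄
  open Exposure G (m + suc m′) regular

  inner-star : ∀ {A M : Pred (Fin n) 0ℓ} {x i i′} (M? : Decidable M) → Interior A x →
               (∀ {u} → M u → InnerNeighbor A x u) → count M? ≡ i →
               m + suc m′ ≡ i + i′ → (∀ {j} → j < i → j + j ≤ (m + suc m′) ∸ 2) →
               InnerStar A x M i
  inner-star {x = x} {i} {i′} M? inner M⊆ card total room =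
    let E , first = arrange M? (x ~?_) (proj₁ ∘ M⊆) total card (degree-count x)
        g , S = StarAt.star x E i (≤-trans (m≤m+n i i′) (≤-reflexive (sym total)))
                  (λ _ _ j<i → inj₁ (room j<i))
    in record { E = E ; g = g ; coloring = S ; x-inner = inner ; M-inner = proj₂ ∘ M⊆ ; e-chosen = first }

  module _ {A B : Pred (Fin n) 0ℓ} (A? : Decidable A) (B? : Decidable B)
           (cover : ∀ v → A v ⊎ B v) (disjoint : ∀ {v} → A v → ¬ B v) where

    open Sides A? B? cover disjoint

    cut⇒leavingA : ∀ {p q} → Cut p q → Leaving A p q
    cut⇒leavingA (a , b , adj) = a , (λ a′ → disjoint a′ b) , adj

    leavingA⇒cut : ∀ {p q} → Leaving A p q → Cut p q
    leavingA⇒cut {q = q} (a , ¬a , adj) = a , [ (λ a′ → contradiction a′ ¬a) , id ]′ (cover q) , adj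

    cut⇒leavingB : ∀ {p q} → Cut p q → Leaving B q p
    cut⇒leavingB (a , b , adj) = b , disjoint a , ~-sym adj

    leavingB⇒cut : ∀ {p q} → Leaving B q p → Cut p q
    leavingB⇒cut {p} (b , ¬b , adj) =
      [ id , (λ b′ → contradiction b′ ¬b) ]′ (cover p) , b , ~-sym adj

    module _ {x y : Fin n} (x-inner : Interior A x) (y-inner : Interior B y) where

      -- These are the cut edges on which the choice of completed neighbors has an influence. All
      -- others touch a neighbor of a center and are accounted for by the exposures.
      Deep : Fin n → Fin n → Set
      Deep p q = Cut p q × ¬ (x ~ p) × ¬ (y ~ q)

      deep? : ∀ p q → Dec (Deep p q)
      deep? p q = cut? p q ×-dec (¬? (x ~? p) ×-dec ¬? (y ~? q))

      at-x? = λ p q → cut? p q ×-dec ((x ~? p) ×-dec ¬? (y ~? q))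
      at-y? = λ p q → cut? p q ×-dec (¬? (x ~? p) ×-dec (y ~? q))
      at-both? = λ p q → cut? p q ×-dec ((x ~? p) ×-dec (y ~? q))

      total deep at-x at-y at-both : ℕ
      total   = ∑[ p < n ] ∑[ q < n ] ⟦ cut? p q ⟧
      deep    = ∑[ p < n ] ∑[ q < n ] ⟦ deep? p q ⟧
      at-x    = ∑[ p < n ] ∑[ q < n ] ⟦ at-x? p q ⟧
      at-y    = ∑[ p < n ] ∑[ q < n ] ⟦ at-y? p q ⟧
      at-both = ∑[ p < n ] ∑[ q < n ] ⟦ at-both? p q ⟧

      weight : Fin n → ℕ
      weight u = ∑[ p < n ] ∑[ q < n ] ⟦ (u ~? p) ×-dec deep? p q ⟧

      exposure-x : exposure A? x ≡ at-x + at-both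
      exposure-x = trans (sum-cong-≗ λ p → sum-cong-≗ (split p))
                         (double-sum-+ (λ p q → ⟦ at-x? p q ⟧) (λ p q → ⟦ at-both? p q ⟧))
        where
        split : ∀ p q → ⟦ (x ~? p) ×-dec leaving? A? p q ⟧ ≡ ⟦ at-x? p q ⟧ + ⟦ at-both? p q ⟧
        split p q = trans
          (⟦⟧-cong ((x ~? p) ×-dec leaving? A? p q) (cut? p q ×-dec (x ~? p))
            (λ (adj , l) → leavingA⇒cut l , adj) (λ (c , adj) → adj , cut⇒leavingA c))
          (by-cases (cut? p q) (x ~? p) (y ~? q))
          where
          by-cases : ∀ {P Q R : Set} (p? : Dec P) (q? : Dec Q) (r? : Dec R) →
                     ⟦ p? ×-dec q? ⟧ ≡ ⟦ p? ×-dec (q? ×-dec ¬? r?) ⟧ + ⟦ p? ×-dec (q? ×-dec r?) ⟧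
          by-cases (no _) _ _ = refl
          by-cases (yes _) (no _) _ = refl
          by-cases (yes _) (yes _) (yes _) = refl
          by-cases (yes _) (yes _) (no _) = refl

      exposure-y : exposure B? y ≡ at-y + at-both
      exposure-y = trans (∑-comm (λ q p → ⟦ (y ~? q) ×-dec leaving? B? q p ⟧))
        (trans (sum-cong-≗ λ p → sum-cong-≗ (split p))
               (double-sum-+ (λ p q → ⟦ at-y? p q ⟧) (λ p q → ⟦ at-both? p q ⟧)))
        where
        split : ∀ p q → ⟦ (y ~? q) ×-dec leaving? B? q p ⟧ ≡ ⟦ at-y? p q ⟧ + ⟦ at-both? p q ⟧
        split p q = trans
          (⟦⟧-cong ((y ~? q) ×-dec leaving? B? q p) (cut? p q ×-dec (y ~? q))
            (λ (adj , l) → leavingB⇒cut l , adj) (λ (c , adj) → adj , cut⇒leavingB c))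
          (by-cases (cut? p q) (x ~? p) (y ~? q))
          where
          by-cases : ∀ {P Q R : Set} (p? : Dec P) (q? : Dec Q) (r? : Dec R) →
                     ⟦ p? ×-dec r? ⟧ ≡ ⟦ p? ×-dec (¬? q? ×-dec r?) ⟧ + ⟦ p? ×-dec (q? ×-dec r?) ⟧
          by-cases (no _) _ _ = refl
          by-cases (yes _) (no _) (yes _) = refl
          by-cases (yes _) (no _) (no _) = refl
          by-cases (yes _) (yes _) (yes _) = refl
          by-cases (yes _) (yes _) (no _) = refl

      total-split : total ≡ deep + at-y + (at-x + at-both)
      total-split = begin
        total ≡⟨ sum-cong-≗ (λ p → sum-cong-≗ λ q → by-cases (cut? p q) (x ~? p) (y ~? q)) ⟩
        ∑[ p < n ] ∑[ q < n ] (⟦ deep? p q ⟧ + ⟦ at-y? p q ⟧ + (⟦ at-x? p q ⟧ + ⟦ at-both? p q ⟧))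
          ≡⟨ double-sum-+ (λ p q → ⟦ deep? p q ⟧ + ⟦ at-y? p q ⟧) (λ p q → ⟦ at-x? p q ⟧ + ⟦ at-both? p q ⟧) ⟩
        _ ≡⟨ cong₂ _+_ (double-sum-+ (λ p q → ⟦ deep? p q ⟧) (λ p q → ⟦ at-y? p q ⟧))
                       (double-sum-+ (λ p q → ⟦ at-x? p q ⟧) (λ p q → ⟦ at-both? p q ⟧)) ⟩
        deep + at-y + (at-x + at-both) ∎
        where
        open ≡-Reasoning
        by-cases : ∀ {P Q R : Set} (p? : Dec P) (q? : Dec Q) (r? : Dec R) →
                   ⟦ p? ⟧ ≡ ⟦ p? ×-dec (¬? q? ×-dec ¬? r?) ⟧ + ⟦ p? ×-dec (¬? q? ×-dec r?) ⟧ +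
                            (⟦ p? ×-dec (q? ×-dec ¬? r?) ⟧ + ⟦ p? ×-dec (q? ×-dec r?) ⟧)
        by-cases (no _) _ _ = refl
        by-cases (yes _) (no _) (yes _) = refl
        by-cases (yes _) (no _) (no _) = refl
        by-cases (yes _) (yes _) (yes _) = refl
        by-cases (yes _) (yes _) (no _) = refl

      module _ {S : Pred (Fin n) 0ℓ} (S? : Decidable S) where

        private
          selected? = λ u p q → S? u ×-dec ((u ~? p) ×-dec deep? p q)

          as-product : ∀ {P Q : Set} (p? : Dec P) (q? : Dec Q) → ⟦ p? ⟧ * ⟦ q? ⟧ ≡ ⟦ p? ×-dec q? ⟧
          as-product (no _) _ = refl
          as-product (yes _) (no _) = refl
          as-product (yes _) (yes _) = refl

        weight-sum : sum (λ u → ⟦ S? u ⟧ * weight u) ≡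
                     ∑[ p < n ] ∑[ q < n ] ∑[ u < n ] ⟦ selected? u p q ⟧
        weight-sum = begin
          sum (λ u → ⟦ S? u ⟧ * weight u)
            ≡⟨ sum-cong-≗ (λ u → trans (*-distribˡ-sum ⟦ S? u ⟧ (λ p → ∑[ q < n ] ⟦ (u ~? p) ×-dec deep? p q ⟧))
                 (sum-cong-≗ λ p → trans (*-distribˡ-sum ⟦ S? u ⟧ (λ q → ⟦ (u ~? p) ×-dec deep? p q ⟧))
                   (sum-cong-≗ λ q → as-product (S? u) ((u ~? p) ×-dec deep? p q)))) ⟩
          ∑[ u < n ] ∑[ p < n ] ∑[ q < n ] ⟦ selected? u p q ⟧
            ≡⟨ ∑-comm (λ u p → ∑[ q < n ] ⟦ selected? u p q ⟧) ⟩
          ∑[ p < n ] ∑[ u < n ] ∑[ q < n ] ⟦ selected? u p q ⟧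
            ≡⟨ sum-cong-≗ (λ p → ∑-comm (λ u q → ⟦ selected? u p q ⟧)) ⟩
          ∑[ p < n ] ∑[ q < n ] ∑[ u < n ] ⟦ selected? u p q ⟧ ∎
          where open ≡-Reasoning

        -- The endpoint `p` of a deep edge has at most one common neighbor with `x`, so no deep edge
        -- is charged to two members of `S`.
        weight-≤-deep : (∀ {u} → S u → x ~ u) → sum (λ u → ⟦ S? u ⟧ * weight u) ≤ deep
        weight-≤-deep S⊆N = ≤-trans (≤-reflexive weight-sum) (double-sum-mono bound)
          where
          bound : ∀ p q → ∑[ u < n ] ⟦ selected? u p q ⟧ ≤ ⟦ deep? p q ⟧
          bound p q with deep? p q
          ... | no ¬deep = ≤-reflexive (count-none (λ u → S? u ×-dec ((u ~? p) ×-dec no ¬deep)) λ u → ¬deep ∘ proj₂ ∘ proj₂)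
          ... | yes deep@((_ , b , adj) , _) = count-≤1 (λ u → S? u ×-dec ((u ~? p) ×-dec yes deep))
                λ (s , up , _) (s′ , up′ , _) →
                  common-neighbor x≢p (S⊆N s) (S⊆N s′) (~-sym up) (~-sym up′)
            where
            x≢p : x ≢ p
            x≢p refl = disjoint (x-inner q (inj₂ adj)) b

        deep-leaves? : ∀ p q → Dec (Deep p q × ∃ λ u → S u × u ~ p)
        deep-leaves? p q = deep? p q ×-dec any? λ u → S? u ×-dec (u ~? p)

        deep-leaves-≤-weight : ∑[ p < n ] ∑[ q < n ] ⟦ deep-leaves? p q ⟧ ≤ sum (λ u → ⟦ S? u ⟧ * weight u)
        deep-leaves-≤-weight = ≤-trans
          (double-sum-mono λ p q → ⟦⟧-bound (deep-leaves? p q)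
            λ (deep , u , s , up) → count-∃ (λ u → selected? u p q) (u , s , up , deep))
          (≤-reflexive (sym weight-sum))

      module _ {M N : Pred (Fin n) 0ℓ} (X : InnerStar A x M m) (Y : InnerStar B y N m′) (M? : Decidable M) where

        private
          module X = InnerStar X
          module Y = InnerStar Y
        open Merge X Y

        -- Centers and chosen neighbors are interior, so a clash in the left block
        -- involves a leaf of X, and a clash in the right block a leaf of Y.
        clashesˡ : ∑[ i < suc m ] ∑[ j < suc m ] clashes left i j ≤
                   sum (λ u → ⟦ M? u ⟧ * weight u) + at-y
        clashesˡ = begin
          ∑[ i < suc m ] ∑[ j < suc m ] clashes left i j
            ≤⟨ matrix-count (λ i j → clash? (left i) (opposite (left j)))
                 (λ p q → deep-leaves? M? p q ⊎-dec at-y? p q) (λ {i} {j} → classify i j)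
                 (λ (_ , gp , gq) (_ , gp′ , gq′) →
                   Fin.↑ˡ-injective (suc m′) _ _ (Maybe.just-injective (trans (sym gp) gp′)) ,
                   Fin.↑ˡ-injective (suc m′) _ _ (injectiveʳ Perm.reverse (Maybe.just-injective (trans (sym gq) gq′)))) ⟩
          ∑[ p < n ] ∑[ q < n ] ⟦ deep-leaves? M? p q ⊎-dec at-y? p q ⟧
            ≤⟨ double-sum-mono (λ p q → ⟦⟧-cover (deep-leaves? M? p q ⊎-dec at-y? p q) (deep-leaves? M? p q) (at-y? p q) id) ⟩
          ∑[ p < n ] ∑[ q < n ] (⟦ deep-leaves? M? p q ⟧ + ⟦ at-y? p q ⟧)
            ≡⟨ double-sum-+ (λ p q → ⟦ deep-leaves? M? p q ⟧) (λ p q → ⟦ at-y? p q ⟧) ⟩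
          (∑[ p < n ] ∑[ q < n ] ⟦ deep-leaves? M? p q ⟧) + at-y
            ≤⟨ +-monoˡ-≤ at-y (deep-leaves-≤-weight M?) ⟩
          sum (λ u → ⟦ M? u ⟧ * weight u) + at-y ∎
          where
          open ≤-Reasoning
          classify : ∀ i j {p q} → Clash (left i) (opposite (left j)) p q →
                     (Deep p q × ∃ λ u → M u × u ~ p) ⊎ (Cut p q × ¬ (x ~ p) × y ~ q)
          classify i j {p} {q} (cut@(a , b , adj) , gp , gq)
            with y ~? q | X.Boundary.low⇒≁x adj (λ a′ → disjoint a′ b) gp i≤m
            where
            i≤m : toℕ (left i) ≤ m
            i≤m = subst (_≤ m) (sym (Fin.toℕ-↑ˡ i (suc m′))) (s≤s⁻¹ (toℕ<n i))
          ... | yes yq | x≁p = inj₂ (cut , x≁p , yq)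
          ... | no y≁q | x≁p = inj₁ ((cut , x≁p , y≁q) ,
                [ (λ xp → contradiction xp x≁p) , id ]′ (X.Boundary.reach adj (λ a′ → disjoint a′ b) gp))

        -- Charged to the star at `x` once more: a colored `p` on the cut is a neighbor of `x` or a
        -- leaf of that star. Thus a single choice of `M` controls both blocks.
        clashesʳ : ∑[ i < suc m′ ] ∑[ j < suc m′ ] clashes right i j ≤
                   sum (λ u → ⟦ M? u ⟧ * weight u) + at-x
        clashesʳ = begin
          ∑[ i < suc m′ ] ∑[ j < suc m′ ] clashes right i j
            ≤⟨ matrix-count (λ i j → clash? (right i) (opposite (right j)))
                 (λ p q → deep-leaves? M? p q ⊎-dec at-x? p q) (λ {i} {j} → classify i j)
                 (λ (_ , gp , gq) (_ , gp′ , gq′) →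
                   Fin.↑ʳ-injective (suc m) _ _ (Maybe.just-injective (trans (sym gp) gp′)) ,
                   Fin.↑ʳ-injective (suc m) _ _ (injectiveʳ Perm.reverse (Maybe.just-injective (trans (sym gq) gq′)))) ⟩
          ∑[ p < n ] ∑[ q < n ] ⟦ deep-leaves? M? p q ⊎-dec at-x? p q ⟧
            ≤⟨ double-sum-mono (λ p q → ⟦⟧-cover (deep-leaves? M? p q ⊎-dec at-x? p q) (deep-leaves? M? p q) (at-x? p q) id) ⟩
          ∑[ p < n ] ∑[ q < n ] (⟦ deep-leaves? M? p q ⟧ + ⟦ at-x? p q ⟧)
            ≡⟨ double-sum-+ (λ p q → ⟦ deep-leaves? M? p q ⟧) (λ p q → ⟦ at-x? p q ⟧) ⟩
          (∑[ p < n ] ∑[ q < n ] ⟦ deep-leaves? M? p q ⟧) + at-x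
            ≤⟨ +-monoˡ-≤ at-x (deep-leaves-≤-weight M?) ⟩
          sum (λ u → ⟦ M? u ⟧ * weight u) + at-x ∎
          where
          open ≤-Reasoning
          classify : ∀ i j {p q} → Clash (right i) (opposite (right j)) p q →
                     (Deep p q × ∃ λ u → M u × u ~ p) ⊎ (Cut p q × x ~ p × ¬ (y ~ q))
          classify i j {p} {q} (cut@(a , b , adj) , gp , gq)
            with x ~? p | Y.Boundary.low⇒≁x (~-sym adj) (disjoint a) gq (opposite-raise m m′ j)
          ... | yes xp | y≁q = inj₂ (cut , xp , y≁q)
          ... | no x≁p | y≁q = inj₁ ((cut , x≁p , y≁q) ,
                [ (λ xp → contradiction xp x≁p) , id ]′ (X.Boundary.reach adj (λ a′ → disjoint a′ b) gp))

      -- The center of smaller exposure is taken as `x`. Then `at-x ≤ at-y`, and reserving `at-y` in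
      -- the selection covers both blocks, the left one being the tighter because `m ≤ m′`.
      two-stars : total ≤ m + suc m′ → exposure A? x ≤ exposure B? y → exposure B? y ≤ 1 →
                  1 ≤ m → m ≤ m′ → m′ ≤ suc m →
                  ∃ λ (f : Fin n → Fin (suc (m + suc m′))) → IsBColoring G f
      two-stars total≤d x≤y y≤1 1≤m m≤m′ m′≤1+m =
        Merge.merge X Y (≤-trans (clashesˡ X Y C.chosen?) C.light)
          (≤-trans (clashesʳ X Y C.chosen?) (≤-trans (+-monoʳ-≤ _ at-x≤at-y) (≤-trans C.light m≤m′)))
        where
        S? = innerNeighbor? A? x
        T? = innerNeighbor? B? y
        at-x≤at-y : at-x ≤ at-y
        at-x≤at-y = +-cancelʳ-≤ at-both at-x at-y (subst₂ _≤_ exposure-x exposure-y x≤y)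
        at-y≤m : at-y ≤ m
        at-y≤m = ≤-trans (m≤m+n at-y at-both) (≤-trans (≤-reflexive (sym exposure-y)) (≤-trans y≤1 1≤m))
        many : ∀ {c e} → m + suc m′ ≤ c + e → e ≤ 1 → m + m′ ≤ c
        many {c} {e} le e≤1 = s≤s⁻¹ (begin
          suc (m + m′)  ≡⟨ +-suc m m′ ⟨
          m + suc m′    ≤⟨ le ⟩
          c + e         ≤⟨ +-monoʳ-≤ c e≤1 ⟩
          c + 1         ≡⟨ +-comm c 1 ⟩
          suc c         ∎)
          where open ≤-Reasoning
        S-many : m + m′ ≤ count S?
        S-many = many (inner-neighbors A? x-inner) (≤-trans x≤y y≤1)
        T-many : m + m′ ≤ count T?
        T-many = many (inner-neighbors B? y-inner) y≤1
        -- The `at-x + at-both` cut edges at neighbors of `x` are missing from the left side and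
        -- bound the number of neighbors missing from `S`, so they cancel.
        S-light : sum (λ u → ⟦ S? u ⟧ * weight u) + at-y ≤ count S?
        S-light = +-cancelʳ-≤ (at-x + at-both) _ _ (begin
          sum (λ u → ⟦ S? u ⟧ * weight u) + at-y + (at-x + at-both)
            ≤⟨ +-monoˡ-≤ (at-x + at-both) (+-monoˡ-≤ at-y (weight-≤-deep S? proj₁)) ⟩
          deep + at-y + (at-x + at-both)    ≡⟨ total-split ⟨
          total                             ≤⟨ total≤d ⟩
          m + suc m′                        ≤⟨ inner-neighbors A? x-inner ⟩
          count S? + exposure A? x          ≡⟨ cong (count S? +_) exposure-x ⟩
          count S? + (at-x + at-both)       ∎)
          where open ≤-Reasoning
        excess : ∀ {c k} → k ≤ c → c ≡ (c ∸ k) + k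
        excess k≤c = sym (m∸n+n≡m k≤c)
        S-excess = excess (≤-trans (m≤m+n m m′) S-many)
        T-excess = excess (≤-trans (m≤n+m m′ m) T-many)
        chosen = select (count S? ∸ m) S? weight S-excess at-y≤m
                   (≤-trans S-light (≤-reflexive S-excess))
        -- The clash bounds involve only the neighbors completed at `x`, so any `m′` interior
        -- neighbors of `y` will do and all weights are zero.
        chosen′ = select (count T? ∸ m′) T? (λ _ → 0) {ε = 0} T-excess z≤n
                    (≤-trans (≤-reflexive (trans (+-identityʳ _) (sum-zero λ u → *-zeroʳ ⟦ T? u ⟧))) z≤n)
        module C = Selection chosen
        module C′ = Selection chosen′
        d-2 : (m + suc m′) ∸ 2 ≡ (m + m′) ∸ 1
        d-2 = cong (_∸ 2) (+-suc m m′)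
        room : ∀ {j} → j < m → j + j ≤ (m + suc m′) ∸ 2
        room {j} j<m = subst (j + j ≤_) (sym d-2)
          (∸-monoˡ-≤ 1 (+-mono-≤ j<m (≤-trans (<⇒≤ j<m) m≤m′)))
        -- The last index `j = m′ ∸ 1` needs `2 (m′ - 1) ≤ m + m′ - 1`, so `m′` may exceed `m` by
        -- one but not by more.
        room′ : ∀ {j} → j < m′ → j + j ≤ (m + suc m′) ∸ 2
        room′ {j} j<m′ = subst (j + j ≤_) (sym (trans d-2 (cong (_∸ 1) (+-comm m m′))))
          (∸-monoˡ-≤ 1 (+-mono-≤ j<m′ (s≤s⁻¹ (≤-trans j<m′ m′≤1+m))))
        X : InnerStar A x C.Chosen m
        X = inner-star C.chosen? x-inner C.chosen⊆ C.cardinal refl room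
        Y : InnerStar B y C′.Chosen m′
        Y = inner-star C′.chosen? y-inner C′.chosen⊆ C′.cardinal
              (trans (+-suc m m′) (trans (cong suc (+-comm m m′)) (sym (+-suc m′ m)))) room′

-- A vertex with little exposure

argmin : {P : Pred (Fin n) 0ℓ} (P? : Decidable P) (f : Fin n → ℕ) → ∃ P →
         ∃ λ x → P x × (∀ {y} → P y → f x ≤ f y)
argmin {n} {P} P? f (x , Px) = descend (f x) x Px ≤-refl
  where
  descend : ∀ bound x → P x → f x ≤ bound → ∃ λ x → P x × (∀ {y} → P y → f x ≤ f y)
  descend bound x Px fx≤ with any? (λ y → P? y ×-dec (f y <? f x))
  ... | no none = x , Px , λ {y} Py → ≮⇒≥ λ lt → none (y , Py , lt)
  descend zero x Px fx≤ | yes (y , Py , lt) = contradiction (<-≤-trans lt fx≤) λ ()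
  descend (suc bound) x Px fx≤ | yes (y , Py , lt) = descend bound y Py (s≤s⁻¹ (<-≤-trans lt fx≤))

-- The difference of the two sides is `(s - 1) * (d - s)`, which is nonnegative here and, as the
-- next lemma exploits, vanishes only for `s = d`.
no-deficit : ∀ {s d} → 2 ≤ s → s ≤ d → ¬ (s * suc d < s * s + d)
no-deficit {s} {d} 2≤s s≤d lt with m≤n⇒∃[o]m+o≡n s≤d
... | e , refl = <⇒≱ lt (begin
  s * s + (s + e)          ≤⟨ +-monoʳ-≤ (s * s) (+-monoʳ-≤ s (m≤n*m e s {{>-nonZero (≤-trans (s≤s z≤n) 2≤s)}})) ⟩
  s * s + (s + s * e)      ≡⟨ expand s e ⟨
  s * suc (s + e)          ∎)
  where
  open ≤-Reasoning
  expand : ∀ s e → s * suc (s + e) ≡ s * s + (s + s * e)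
  expand = solve-∀

tight : ∀ {s d} → 2 ≤ s → s ≤ d → s * suc d ≤ s * s + d → s ≡ d
tight {s} {d} 2≤s s≤d le with m≤n⇒∃[o]m+o≡n s≤d
... | zero , refl = sym (+-identityʳ s)
... | suc e , refl = contradiction le (<⇒≱ (begin-strict
  s * s + (s + suc e)          <⟨ +-monoʳ-< (s * s) (+-monoʳ-< s (m<m*n (suc e) s 2≤s)) ⟩
  s * s + (s + suc e * s)      ≡⟨ expand s (suc e) ⟨
  s * suc (s + suc e)          ∎))
  where
  open ≤-Reasoning
  expand : ∀ s e → s * suc (s + e) ≡ s * s + (s + e * s)
  expand = solve-∀

exceeds : ∀ {a c} e → a ≡ c + suc e → ¬ (a ≤ c)
exceeds {c = c} e refl = <⇒≱ (m<m+n c z<s)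

-- Here i is the number of interior vertices and μ the least exposure.
exposure-arithmetic : ∀ {τ d i μ} → τ ≤ 1 → τ + 3 ≤ d → μ ≤ d → i * μ ≤ d * (d ∸ 1) →
                      1 + d * d ≤ i + d * suc τ + μ → μ ≤ 1
exposure-arithmetic {μ = 0} _ _ _ _ _ = z≤n
exposure-arithmetic {μ = 1} _ _ _ _ _ = ≤-refl
-- The exact value 2 has to be kept: replacing the summand `μ` by `d`, as for larger `μ`, would
-- leave no contradiction for `τ = 1` and `d = 4`.
exposure-arithmetic {τ} {d} {i} {μ@2} τ≤1 τ+3≤d _ few many = contradiction (begin
  2 * (1 + d * d)                        ≤⟨ *-monoʳ-≤ 2 many ⟩
  2 * (i + d * suc τ + 2)                ≡⟨ regroup i (d * suc τ) ⟩
  i * 2 + (2 * (d * suc τ) + 4)          ≤⟨ +-monoˡ-≤ (2 * (d * suc τ) + 4) few ⟩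
  d * (d ∸ 1) + (2 * (d * suc τ) + 4)    ∎) (absurd τ≤1 τ+3≤d)
  where
  open ≤-Reasoning
  regroup : ∀ i a → 2 * (i + a + 2) ≡ i * 2 + (2 * a + 4)
  regroup = solve-∀
  -- For `d = τ + 3 + b` the left side exceeds the right one by a polynomial in `b` with positive
  -- coefficients, split off as a successor for `exceeds`.
  identity₀ : ∀ b → 2 * (1 + (3 + b) * (3 + b)) ≡ (3 + b) * (2 + b) + (2 * ((3 + b) * 1) + 4) + suc (3 + 5 * b + b * b)
  identity₀ = solve-∀
  identity₁ : ∀ b → 2 * (1 + (4 + b) * (4 + b)) ≡ (4 + b) * (3 + b) + (2 * ((4 + b) * 2) + 4) + suc (1 + 5 * b + b * b)
  identity₁ = solve-∀
  absurd : ∀ {τ d} → τ ≤ 1 → τ + 3 ≤ d → ¬ (2 * (1 + d * d) ≤ d * (d ∸ 1) + (2 * (d * suc τ) + 4))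
  absurd z≤n le with m≤n⇒∃[o]m+o≡n le
  ... | b , refl = exceeds (3 + 5 * b + b * b) (identity₀ b)
  absurd (s≤s z≤n) le with m≤n⇒∃[o]m+o≡n le
  ... | b , refl = exceeds (1 + 5 * b + b * b) (identity₁ b)
exposure-arithmetic {τ} {d} {i} {suc (suc (suc μ))} τ≤1 τ+3≤d μ≤d few many = contradiction (begin
  3 * (1 + d * d)                        ≤⟨ *-monoʳ-≤ 3 many ⟩
  3 * (i + d * suc τ + (3 + μ))          ≤⟨ *-monoʳ-≤ 3 (+-monoʳ-≤ (i + d * suc τ) μ≤d) ⟩
  3 * (i + d * suc τ + d)                ≡⟨ regroup i (d * suc τ) d ⟩
  i * 3 + 3 * (d * suc τ + d)            ≤⟨ +-monoˡ-≤ (3 * (d * suc τ + d)) (≤-trans (*-monoʳ-≤ i (m≤m+n 3 μ)) few) ⟩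
  d * (d ∸ 1) + 3 * (d * suc τ + d)      ∎) (absurd τ≤1 τ+3≤d)
  where
  open ≤-Reasoning
  regroup : ∀ i a d → 3 * (i + a + d) ≡ i * 3 + 3 * (a + d)
  regroup = solve-∀
  identity₀ : ∀ b → 3 * (1 + (3 + b) * (3 + b)) ≡ (3 + b) * (2 + b) + 3 * ((3 + b) * 1 + (3 + b)) + suc (5 + 7 * b + 2 * (b * b))
  identity₀ = solve-∀
  identity₁ : ∀ b → 3 * (1 + (4 + b) * (4 + b)) ≡ (4 + b) * (3 + b) + 3 * ((4 + b) * 2 + (4 + b)) + suc (2 + 8 * b + 2 * (b * b))
  identity₁ = solve-∀
  absurd : ∀ {τ d} → τ ≤ 1 → τ + 3 ≤ d → ¬ (3 * (1 + d * d) ≤ d * (d ∸ 1) + 3 * (d * suc τ + d))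
  absurd z≤n le with m≤n⇒∃[o]m+o≡n le
  ... | b , refl = exceeds (5 + 7 * b + 2 * (b * b)) (identity₀ b)
  absurd (s≤s z≤n) le with m≤n⇒∃[o]m+o≡n le
  ... | b , refl = exceeds (2 + 8 * b + 2 * (b * b)) (identity₁ b)

-- `τ` bounds the number of triangles on an edge. As a parameter it lets one count serve
-- triangle-free graphs from degree 3 on, with `τ = 0`, and all graphs without 4-cycles from degree
-- 4 on, with `τ = 1`.
module LittleExposure (G : Graph n) (d : ℕ) (regular : Regular d G) (no-C₄ : ¬ Contains G C₄)
                      (τ : ℕ) (τ≤1 : τ ≤ 1) (τ+3≤d : τ + 3 ≤ d)
                      (sparse : ∀ {u v} → Graph._~_ G u v →
                        count (λ w → Graph._~?_ G u w ×-dec Graph._~?_ G v w) ≤ τ)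
                      {A : Pred (Fin n) 0ℓ} (A? : Decidable A) (2≤A : 2 ≤ count A?) where

  open Graph G renaming (sym to ~-sym)
  open PartialColorings G d regular
  open Stars G d regular no-C₄
  open Exposure G d regular

  outside : Fin n → ℕ
  outside u = count (leaving? A? u)

  module _ (few-leave : sum outside ≤ d) where

    -- If no vertex of A is interior then A is a clique on d vertices.
    module _ (none : ∀ {v} → ¬ Interior A v) where

      leaves : ∀ {u} → A u → 0 < outside u
      leaves {u} a with Fin.¬∀⟶∃¬ n _ (λ v → near? u v →-dec A? v) none
      ... | v , ¬imp with near? u v
      ...   | no ¬near = contradiction (λ near → contradiction near ¬near) ¬imp
      ...   | yes (inj₁ refl) = contradiction (λ _ → a) ¬imp
      ...   | yes (inj₂ adj) = count-∃ (leaving? A? u) (v , a , (λ a′ → ¬imp λ _ → a′) , adj)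

      small : count A? ≤ d
      small = ≤-trans (sum-mono λ u → ⟦⟧-bound (A? u) leaves) few-leave

      inside : ∀ {u} → A u → count (λ v → A? v ×-dec (u ~? v)) + outside u ≡ d
      inside {u} a = trans (cong₂ _+_
        (count-cong (λ v → A? v ×-dec (u ~? v)) (λ v → (u ~? v) ×-dec A? v) (λ (p , q) → q , p) (λ (p , q) → q , p))
        (count-cong (leaving? A? u) (λ v → (u ~? v) ×-dec ¬? (A? v)) (λ (_ , p , q) → q , p) (λ (p , q) → a , q , p)))
        (trans (count-split (u ~?_) A?) (degree-count u))

      bound : ∀ {u} → A u → suc d ≤ count A? + outside u
      bound {u} a = begin
        suc d                                                              ≡⟨ cong suc (inside a) ⟨
        suc (count (λ v → A? v ×-dec (u ~? v))) + outside u
          ≡⟨ cong (λ c → c + count (λ v → A? v ×-dec (u ~? v)) + outside u) (count-≟ u) ⟨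
        count (_≟ u) + count (λ v → A? v ×-dec (u ~? v)) + outside u
          ≡⟨ cong (_+ outside u) (∑-distrib-+ (λ v → ⟦ v ≟ u ⟧) (λ v → ⟦ A? v ×-dec (u ~? v) ⟧)) ⟨
        ∑[ v < n ] (⟦ v ≟ u ⟧ + ⟦ A? v ×-dec (u ~? v) ⟧) + outside u
          ≤⟨ +-monoˡ-≤ (outside u) (sum-mono λ v → ⟦⟧-disjoint (A? v) (v ≟ u) (A? v ×-dec (u ~? v))
               (λ { refl → a }) proj₁ (λ { refl (_ , adj) → irrefl refl adj })) ⟩
        count A? + outside u                                               ∎
        where open ≤-Reasoning

      bound-strict : ∀ {u w} → A u → A w → u ≢ w → ¬ (u ~ w) → suc d < count A? + outside u
      bound-strict {u} {w} a b u≢w u≁w = begin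
        suc (suc d)                                                        ≡⟨ cong (2 +_) (inside a) ⟨
        2 + count (λ v → A? v ×-dec (u ~? v)) + outside u
          ≡⟨ cong (λ c → c + count (λ v → A? v ×-dec (u ~? v)) + outside u) (cong₂ _+_ (count-≟ u) (count-≟ w)) ⟨
        count (_≟ u) + count (_≟ w) + count (λ v → A? v ×-dec (u ~? v)) + outside u
          ≡⟨ cong (_+ outside u) (trans (∑-distrib-+ (λ v → ⟦ v ≟ u ⟧ + ⟦ v ≟ w ⟧) (λ v → ⟦ A? v ×-dec (u ~? v) ⟧))
               (cong (_+ count (λ v → A? v ×-dec (u ~? v))) (∑-distrib-+ (λ v → ⟦ v ≟ u ⟧) (λ v → ⟦ v ≟ w ⟧)))) ⟨
        ∑[ v < n ] (⟦ v ≟ u ⟧ + ⟦ v ≟ w ⟧ + ⟦ A? v ×-dec (u ~? v) ⟧) + outside u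
          ≤⟨ +-monoˡ-≤ (outside u) (sum-mono λ v → ≤-trans
               (+-monoˡ-≤ ⟦ A? v ×-dec (u ~? v) ⟧ (⟦⟧-disjoint ((v ≟ u) ⊎-dec (v ≟ w)) (v ≟ u) (v ≟ w) inj₁ inj₂ λ { refl eq → u≢w eq }))
               (⟦⟧-disjoint (A? v) ((v ≟ u) ⊎-dec (v ≟ w)) (A? v ×-dec (u ~? v))
                 (λ { (inj₁ refl) → a ; (inj₂ refl) → b }) proj₁
                 (λ { (inj₁ refl) (_ , adj) → irrefl refl adj ; (inj₂ refl) (_ , adj) → u≁w adj }))) ⟩
        count A? + outside u                                               ∎
        where open ≤-Reasoning

      scaled : ∀ u → ⟦ A? u ⟧ * suc d ≤ ⟦ A? u ⟧ * count A? + outside u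
      scaled u = cases (A? u)
        where
        cases : (a? : Dec (A u)) → ⟦ a? ⟧ * suc d ≤ ⟦ a? ⟧ * count A? + outside u
        cases (no _) = z≤n
        cases (yes a) = ≤-trans (≤-reflexive (*-identityˡ (suc d))) (≤-trans (bound a)
          (≤-reflexive (cong (_+ outside u) (sym (*-identityˡ (count A?))))))

      scaled-sumˡ : sum (λ u → ⟦ A? u ⟧ * suc d) ≡ count A? * suc d
      scaled-sumˡ = sym (*-distribʳ-sum (suc d) (λ u → ⟦ A? u ⟧))

      scaled-sumʳ : sum (λ u → ⟦ A? u ⟧ * count A? + outside u) ≡ count A? * count A? + sum outside
      scaled-sumʳ = trans (∑-distrib-+ (λ u → ⟦ A? u ⟧ * count A?) outside)
        (cong (_+ sum outside) (sym (*-distribʳ-sum (count A?) (λ u → ⟦ A? u ⟧))))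

      -- With `s` for the size of `A`, summing `bound` over `A` gives `s * suc d ≤ s * s + d`, the
      -- hypothesis of `tight`.
      full : count A? ≡ d
      full = tight 2≤A small (≤-trans (subst₂ _≤_ scaled-sumˡ scaled-sumʳ (sum-mono scaled))
                                      (+-monoʳ-≤ (count A? * count A?) few-leave))

      -- A nonadjacent pair would make one of the summed inequalities strict, and the sum has no
      -- slack.
      clique : ∀ {u w} → A u → A w → u ≢ w → u ~ w
      clique {u} {w} a b u≢w = decidable-stable (u ~? w) λ u≁w → no-deficit 2≤A small
        (<-≤-trans (subst₂ _<_ scaled-sumˡ scaled-sumʳ (sum-strict _ _ scaled u (strict u≁w)))
                   (+-monoʳ-≤ (count A? * count A?) few-leave))
        where
        strict : ¬ (u ~ w) → ⟦ A? u ⟧ * suc d < ⟦ A? u ⟧ * count A? + outside u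
        strict u≁w = subst (λ t → t * suc d < t * count A? + outside u) (sym (⟦⟧-yes (A? u) a))
          (subst₂ _<_ (sym (*-identityˡ (suc d))) (cong (_+ outside u) (sym (*-identityˡ (count A?))))
            (bound-strict a b u≢w u≁w))

      -- Two members of a clique on `d` vertices have `d ∸ 2` common neighbors in it, which is more
      -- than `τ`.
      impossible : ⊥
      impossible with count-pos A? (≤-trans (s≤s z≤n) 2≤A)
      ... | u , a with count-pos (without? A? u) (s≤s⁻¹ (subst (2 ≤_) (sym (count-without A? a)) 2≤A))
      ...   | v , b , v≢u = <⇒≱ (subst (_≤ d) (+-suc τ 2) τ+3≤d) (begin
        d                                          ≡⟨ full ⟨
        count A?                                   ≤⟨ sum-mono cover ⟩
        ∑[ w < n ] (⟦ w ≟ u ⟧ + (⟦ w ≟ v ⟧ + ⟦ (u ~? w) ×-dec (v ~? w) ⟧))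
          ≡⟨ trans (∑-distrib-+ (λ w → ⟦ w ≟ u ⟧) (λ w → ⟦ w ≟ v ⟧ + ⟦ (u ~? w) ×-dec (v ~? w) ⟧))
               (cong (count (_≟ u) +_) (∑-distrib-+ (λ w → ⟦ w ≟ v ⟧) (λ w → ⟦ (u ~? w) ×-dec (v ~? w) ⟧))) ⟩
        count (_≟ u) + (count (_≟ v) + count (λ w → (u ~? w) ×-dec (v ~? w)))
          ≤⟨ +-mono-≤ (≤-reflexive (count-≟ u)) (+-mono-≤ (≤-reflexive (count-≟ v)) (sparse (clique a b (v≢u ∘ sym)))) ⟩
        2 + τ                                      ≡⟨ +-comm 2 τ ⟩
        τ + 2                                      ∎)
        where
        open ≤-Reasoning
        cover : ∀ w → ⟦ A? w ⟧ ≤ ⟦ w ≟ u ⟧ + (⟦ w ≟ v ⟧ + ⟦ (u ~? w) ×-dec (v ~? w) ⟧)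
        cover w = ≤-trans (⟦⟧-cover (A? w) (w ≟ u) ((w ≟ v) ⊎-dec ((u ~? w) ×-dec (v ~? w))) split)
          (+-monoʳ-≤ ⟦ w ≟ u ⟧ (⟦⟧-cover ((w ≟ v) ⊎-dec ((u ~? w) ×-dec (v ~? w))) (w ≟ v) ((u ~? w) ×-dec (v ~? w)) id))
          where
          split : A w → w ≡ u ⊎ (w ≡ v ⊎ (u ~ w × v ~ w))
          split c with w ≟ u | w ≟ v
          ... | yes eq | _ = inj₁ eq
          ... | no _ | yes eq = inj₂ (inj₁ eq)
          ... | no w≢u | no w≢v = inj₂ (inj₂ (clique a c (w≢u ∘ sym) , clique b c (w≢v ∘ sym)))

    interior-exists : ∃ (Interior A)
    interior-exists = decidable-stable (any? (interior? A?)) λ none →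
      impossible λ {v} i → none (v , i)

    module _ {x : Fin n} (inner : Interior A x)
             (least : ∀ {z} → Interior A z → exposure A? x ≤ exposure A? z) where

      exposure≤total : exposure A? x ≤ d
      exposure≤total = ≤-trans (double-sum-mono λ p q →
        ⟦⟧-mono ((x ~? p) ×-dec leaving? A? p q) (leaving? A? p q) proj₂) few-leave

      -- Each edge leaving A is seen from at most d - 1 interior vertices.
      interior-few : count (interior? A?) * exposure A? x ≤ d * (d ∸ 1)
      interior-few = begin
        count (interior? A?) * exposure A? x
          ≡⟨ *-distribʳ-sum (exposure A? x) (λ z → ⟦ interior? A? z ⟧) ⟩
        ∑[ z < n ] (⟦ interior? A? z ⟧ * exposure A? x)       ≤⟨ sum-mono per-z ⟩
        ∑[ z < n ] ∑[ p < n ] ∑[ q < n ] ⟦ seen? z p q ⟧      ≡⟨ ∑-comm (λ z p → ∑[ q < n ] ⟦ seen? z p q ⟧) ⟩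
        ∑[ p < n ] ∑[ z < n ] ∑[ q < n ] ⟦ seen? z p q ⟧      ≡⟨ sum-cong-≗ (λ p → ∑-comm (λ z q → ⟦ seen? z p q ⟧)) ⟩
        ∑[ p < n ] ∑[ q < n ] ∑[ z < n ] ⟦ seen? z p q ⟧      ≤⟨ double-sum-mono per-edge ⟩
        ∑[ p < n ] ∑[ q < n ] (⟦ leaving? A? p q ⟧ * (d ∸ 1))
          ≡⟨ sum-cong-≗ (λ p → *-distribʳ-sum (d ∸ 1) (λ q → ⟦ leaving? A? p q ⟧)) ⟨
        ∑[ p < n ] (outside p * (d ∸ 1))                      ≡⟨ *-distribʳ-sum (d ∸ 1) outside ⟨
        sum outside * (d ∸ 1)                                 ≤⟨ *-monoˡ-≤ (d ∸ 1) few-leave ⟩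
        d * (d ∸ 1)                                           ∎
        where
        open ≤-Reasoning
        seen? = λ z p q → interior? A? z ×-dec ((z ~? p) ×-dec leaving? A? p q)
        per-z : ∀ z → ⟦ interior? A? z ⟧ * exposure A? x ≤ ∑[ p < n ] ∑[ q < n ] ⟦ seen? z p q ⟧
        per-z z with interior? A? z
        ... | no _ = z≤n
        ... | yes i = ≤-trans (≤-reflexive (*-identityˡ _)) (≤-trans (least i)
                (double-sum-mono λ p q → ⟦⟧-mono ((z ~? p) ×-dec leaving? A? p q)
                  (yes i ×-dec ((z ~? p) ×-dec leaving? A? p q)) (i ,_)))
        per-edge : ∀ p q → ∑[ z < n ] ⟦ seen? z p q ⟧ ≤ ⟦ leaving? A? p q ⟧ * (d ∸ 1)
        per-edge p q with leaving? A? p q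
        ... | no ¬l = ≤-reflexive (count-none (λ z → interior? A? z ×-dec ((z ~? p) ×-dec no ¬l)) λ z → ¬l ∘ proj₂ ∘ proj₂)
        ... | yes l@(_ , ¬a , adj) = ≤-trans (∸-monoˡ-≤ 1 (begin
          suc (count sees?)                       ≡⟨ cong (_+ count sees?) (count-≟ q) ⟨
          count (_≟ q) + count sees?              ≡⟨ ∑-distrib-+ (λ z → ⟦ z ≟ q ⟧) (λ z → ⟦ sees? z ⟧) ⟨
          ∑[ z < n ] (⟦ z ≟ q ⟧ + ⟦ sees? z ⟧)    ≤⟨ sum-mono (λ z → ⟦⟧-disjoint (p ~? z) (z ≟ q) (sees? z)
                                                        (λ { refl → adj }) (λ (_ , zp , _) → ~-sym zp)
                                                        (λ { refl (i , _) → ¬a (i q (inj₁ refl)) })) ⟩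
          count (p ~?_)                           ≡⟨ degree-count p ⟩
          d                                       ∎)) (≤-reflexive (sym (*-identityˡ (d ∸ 1))))
          where sees? = λ z → interior? A? z ×-dec ((z ~? p) ×-dec yes l)

      Far : Fin n → Set
      Far v = A v × v ≢ x × ¬ (x ~ v)

      far? : Decidable Far
      far? v = A? v ×-dec (¬? (v ≟ x) ×-dec ¬? (x ~? v))

      beyond? = λ u v → (x ~? u) ×-dec ((u ~? v) ×-dec far? v)

      beyond : ℕ
      beyond = ∑[ u < n ] ∑[ v < n ] ⟦ beyond? u v ⟧

      -- A far vertex has at most one common neighbor with `x`, so the pairs counted by `beyond`
      -- have distinct second members, all in `A` and outside the closed neighborhood of `x`.
      ball : suc d + beyond ≤ count A?
      ball = begin
        suc d + beyond
          ≡⟨ cong₂ _+_ (cong₂ _+_ (count-≟ x) (degree-count x)) (∑-comm (λ v u → ⟦ beyond? u v ⟧)) ⟨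
        count (_≟ x) + count (x ~?_) + ∑[ v < n ] ∑[ u < n ] ⟦ beyond? u v ⟧
          ≤⟨ +-monoʳ-≤ (count (_≟ x) + count (x ~?_)) (sum-mono once) ⟩
        count (_≟ x) + count (x ~?_) + count far?
          ≡⟨ trans (∑-distrib-+ (λ v → ⟦ v ≟ x ⟧ + ⟦ x ~? v ⟧) (λ v → ⟦ far? v ⟧))
               (cong (_+ count far?) (∑-distrib-+ (λ v → ⟦ v ≟ x ⟧) (λ v → ⟦ x ~? v ⟧))) ⟨
        ∑[ v < n ] (⟦ v ≟ x ⟧ + ⟦ x ~? v ⟧ + ⟦ far? v ⟧)
          ≤⟨ sum-mono (λ v → ≤-trans
               (+-monoˡ-≤ ⟦ far? v ⟧ (⟦⟧-disjoint (near? x v) (v ≟ x) (x ~? v) inj₁ inj₂ λ { refl → irrefl refl }))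
               (⟦⟧-disjoint (A? v) (near? x v) (far? v) (inner v) proj₁
                 (λ { (inj₁ eq) (_ , ne , _) → ne eq ; (inj₂ adj) (_ , _ , ¬adj) → ¬adj adj }))) ⟩
        count A? ∎
        where
        open ≤-Reasoning
        once : ∀ v → ∑[ u < n ] ⟦ beyond? u v ⟧ ≤ ⟦ far? v ⟧
        once v with far? v
        ... | no ¬far = ≤-reflexive (count-none (λ u → (x ~? u) ×-dec ((u ~? v) ×-dec no ¬far)) λ u → ¬far ∘ proj₂ ∘ proj₂)
        ... | yes far@(_ , v≢x , _) = count-≤1 (λ u → (x ~? u) ×-dec ((u ~? v) ×-dec yes far))
              λ (xu , uv , _) (xu′ , uv′ , _) → common-neighbor (v≢x ∘ sym) xu xu′ (~-sym uv) (~-sym uv′)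

      -- The neighbors of a vertex `u` adjacent to `x` are `x`, at most `τ` common neighbors with
      -- `x`, those outside `A`, and far ones.
      degrees : d * d ≤ d * suc τ + exposure A? x + beyond
      degrees = begin
        d * d                                        ≡⟨ cong (_* d) (degree-count x) ⟨
        count (x ~?_) * d                            ≡⟨ *-distribʳ-sum d (λ u → ⟦ x ~? u ⟧) ⟩
        ∑[ u < n ] (⟦ x ~? u ⟧ * d)                  ≤⟨ sum-mono per-u ⟩
        ∑[ u < n ] (⟦ x ~? u ⟧ * suc τ + ∑[ q < n ] ⟦ (x ~? u) ×-dec leaving? A? u q ⟧ + ∑[ v < n ] ⟦ beyond? u v ⟧)
          ≡⟨ trans (∑-distrib-+ (λ u → ⟦ x ~? u ⟧ * suc τ + ∑[ q < n ] ⟦ (x ~? u) ×-dec leaving? A? u q ⟧) (λ u → ∑[ v < n ] ⟦ beyond? u v ⟧))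
               (cong (_+ beyond) (∑-distrib-+ (λ u → ⟦ x ~? u ⟧ * suc τ) (λ u → ∑[ q < n ] ⟦ (x ~? u) ×-dec leaving? A? u q ⟧))) ⟩
        ∑[ u < n ] (⟦ x ~? u ⟧ * suc τ) + exposure A? x + beyond
          ≡⟨ cong (λ c → c + exposure A? x + beyond) (trans (sym (*-distribʳ-sum (suc τ) (λ u → ⟦ x ~? u ⟧))) (cong (_* suc τ) (degree-count x))) ⟩
        d * suc τ + exposure A? x + beyond           ∎
        where
        open ≤-Reasoning
        per-u : ∀ u → ⟦ x ~? u ⟧ * d ≤
                ⟦ x ~? u ⟧ * suc τ + ∑[ q < n ] ⟦ (x ~? u) ×-dec leaving? A? u q ⟧ + ∑[ v < n ] ⟦ beyond? u v ⟧
        per-u u with x ~? u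
        ... | no _ = z≤n
        ... | yes xu = begin
          1 * d                                      ≡⟨ *-identityˡ d ⟩
          d                                          ≡⟨ degree-count u ⟨
          count (u ~?_)                              ≤⟨ sum-mono four ⟩
          ∑[ v < n ] (⟦ v ≟ x ⟧ + ⟦ (x ~? v) ×-dec (u ~? v) ⟧ + ⟦ out? v ⟧ + ⟦ far′? v ⟧)
            ≡⟨ trans (∑-distrib-+ (λ v → ⟦ v ≟ x ⟧ + ⟦ (x ~? v) ×-dec (u ~? v) ⟧ + ⟦ out? v ⟧) (λ v → ⟦ far′? v ⟧))
                (cong (_+ count far′?) (trans (∑-distrib-+ (λ v → ⟦ v ≟ x ⟧ + ⟦ (x ~? v) ×-dec (u ~? v) ⟧) (λ v → ⟦ out? v ⟧))
                  (cong (_+ count out?) (∑-distrib-+ (λ v → ⟦ v ≟ x ⟧) (λ v → ⟦ (x ~? v) ×-dec (u ~? v) ⟧))))) ⟩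
          count (_≟ x) + count (λ v → (x ~? v) ×-dec (u ~? v)) + count out? + count far′?
            ≤⟨ +-monoˡ-≤ (count far′?) (+-monoˡ-≤ (count out?) (+-mono-≤ (≤-reflexive (count-≟ x)) (sparse xu))) ⟩
          suc τ + count out? + count far′?           ≡⟨ cong (λ c → c + count out? + count far′?) (*-identityˡ (suc τ)) ⟨
          1 * suc τ + count out? + count far′?       ∎
          where
          out? = λ v → yes xu ×-dec leaving? A? u v
          far′? = λ v → yes xu ×-dec ((u ~? v) ×-dec far? v)
          four : ∀ v → ⟦ u ~? v ⟧ ≤ ⟦ v ≟ x ⟧ + ⟦ (x ~? v) ×-dec (u ~? v) ⟧ + ⟦ out? v ⟧ + ⟦ far′? v ⟧
          four v = begin
            ⟦ u ~? v ⟧  ≤⟨ ⟦⟧-cover (u ~? v) (((v ≟ x) ⊎-dec ((x ~? v) ×-dec (u ~? v))) ⊎-dec out? v) (far′? v) split ⟩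
            ⟦ ((v ≟ x) ⊎-dec ((x ~? v) ×-dec (u ~? v))) ⊎-dec out? v ⟧ + ⟦ far′? v ⟧
              ≤⟨ +-monoˡ-≤ ⟦ far′? v ⟧ (⟦⟧-cover (((v ≟ x) ⊎-dec ((x ~? v) ×-dec (u ~? v))) ⊎-dec out? v) ((v ≟ x) ⊎-dec ((x ~? v) ×-dec (u ~? v))) (out? v) id) ⟩
            ⟦ (v ≟ x) ⊎-dec ((x ~? v) ×-dec (u ~? v)) ⟧ + ⟦ out? v ⟧ + ⟦ far′? v ⟧
              ≤⟨ +-monoˡ-≤ ⟦ far′? v ⟧ (+-monoˡ-≤ ⟦ out? v ⟧ (⟦⟧-cover ((v ≟ x) ⊎-dec ((x ~? v) ×-dec (u ~? v))) (v ≟ x) ((x ~? v) ×-dec (u ~? v)) id)) ⟩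
            _ ∎
            where
            split : u ~ v → ((v ≡ x ⊎ (x ~ v × u ~ v)) ⊎ (x ~ u × Leaving A u v)) ⊎ (x ~ u × u ~ v × Far v)
            split uv with v ≟ x | x ~? v | A? v
            ... | yes eq | _ | _ = inj₁ (inj₁ (inj₁ eq))
            ... | no _ | yes xv | _ = inj₁ (inj₁ (inj₂ (xv , uv)))
            ... | no _ | no _ | no ¬a = inj₁ (inj₂ (xu , inner u (inj₂ xu) , ¬a , uv))
            ... | no v≢x | no ¬xv | yes a = inj₂ (xu , uv , a , v≢x , ¬xv)

      -- Each vertex of `A` that is not interior has an edge leaving `A`, and at most `d` edges
      -- leave.
      A-interior : count A? ≤ count (interior? A?) + d
      A-interior = ≤-trans (sum-mono split)
        (≤-trans (≤-reflexive (∑-distrib-+ (λ v → ⟦ interior? A? v ⟧) outside))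
                 (+-monoʳ-≤ (count (interior? A?)) few-leave))
        where
        split : ∀ v → ⟦ A? v ⟧ ≤ ⟦ interior? A? v ⟧ + outside v
        split v = ≤-trans (⟦⟧-cover (A? v) (interior? A? v) (any? (leaving? A? v)) either)
          (+-monoʳ-≤ ⟦ interior? A? v ⟧ (⟦⟧-bound (any? (leaving? A? v)) (count-∃ (leaving? A? v))))
          where
          either : A v → Interior A v ⊎ ∃ (Leaving A v)
          either a with interior? A? v
          ... | yes i = inj₁ i
          ... | no ¬i with Fin.¬∀⟶∃¬ n _ (λ u → near? v u →-dec A? u) ¬i
          ...   | u , ¬imp with near? v u
          ...     | no ¬near = contradiction (λ near → contradiction near ¬near) ¬imp
          ...     | yes (inj₁ refl) = contradiction (λ _ → a) ¬imp
          ...     | yes (inj₂ adj) = inj₂ (u , a , (λ a′ → ¬imp λ _ → a′) , adj)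

      interior-many : 1 + d * d ≤ count (interior? A?) + d * suc τ + exposure A? x
      interior-many = +-cancelʳ-≤ (d + beyond) _ _ (begin
        1 + d * d + (d + beyond)                         ≡⟨ shuffle (d * d) d beyond ⟩
        suc d + beyond + d * d                           ≤⟨ +-mono-≤ (≤-trans ball A-interior) degrees ⟩
        i + d + (d * suc τ + exposure A? x + beyond)     ≡⟨ shuffle′ i d (d * suc τ) (exposure A? x) beyond ⟩
        i + d * suc τ + exposure A? x + (d + beyond)     ∎)
        where
        open ≤-Reasoning
        i = count (interior? A?)
        shuffle : ∀ e d b → 1 + e + (d + b) ≡ suc d + b + e
        shuffle = solve-∀
        shuffle′ : ∀ i d a e b → i + d + (a + e + b) ≡ i + a + e + (d + b)
        shuffle′ = solve-∀

      least-exposure : exposure A? x ≤ 1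
      least-exposure = exposure-arithmetic τ≤1 τ+3≤d exposure≤total interior-few interior-many

    little-exposure : ∃ λ x → Interior A x × exposure A? x ≤ 1
    little-exposure =
      let x , inner , least = argmin (interior? A?) (exposure A?) interior-exists
      in x , inner , least-exposure inner least

-- Edge cuts

count≤n : {A : Pred (Fin n) 0ℓ} (A? : Decidable A) → count A? ≤ n
count≤n {n} A? = ≤-trans (sum-mono λ v → ⟦⟧≤1 (A? v)) (≤-reflexive (count-all n))

module _ (G : Graph n) where

  open Graph G using (_~_; _~?_)

  record ClosedSet : Set₁ where
    field
      {Member} : Pred (Fin n) 0ℓ
      member?  : Decidable Member
      some-in  : ∃ Member
      some-out : ∃ λ v → ¬ Member v
      closed   : ∀ {p q} → Member p → ¬ Member q → ¬ (p ~ q)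

  -- Disconnectedness is merely the negation of a universal statement. Enlarging the set reached
  -- from `u` until no edge leaves it turns this into a concrete set of vertices; `fuel` pays for
  -- the vertices not yet reached.
  grow : ∀ fuel {S : Pred (Fin n) 0ℓ} (S? : Decidable S) {u} → n ≤ count S? + fuel → S u →
         (∀ {v} → S v → Star _~_ u v) → (∀ v → Star _~_ u v) ⊎ ClosedSet
  grow fuel {S} S? {u} enough u∈S reach
    with any? (λ p → any? λ q → S? p ×-dec (¬? (S? q) ×-dec (p ~? q)))
  ... | no none with all? S?
  ...   | yes all-in = inj₁ λ v → reach (all-in v)
  ...   | no ¬all = inj₂ record
          { member? = S? ; some-in = u , u∈S ; some-out = Fin.¬∀⟶∃¬ n _ S? ¬all
          ; closed = λ {p} {q} Sp ¬Sq adj → none (p , q , Sp , ¬Sq , adj) }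
  grow fuel {S} S? {u} enough u∈S reach | yes (p , q , Sp , ¬Sq , adj) = next fuel enough
    where
    S′? : Decidable (λ v → S v ⊎ v ≡ q)
    S′? v = S? v ⊎-dec (v ≟ q)
    larger : suc (count S?) ≤ count S′?
    larger = sum-strict _ _ (λ v → ⟦⟧-mono (S? v) (S′? v) inj₁) q
      (subst₂ _<_ (sym (⟦⟧-no (S? q) ¬Sq)) (sym (⟦⟧-yes (S′? q) (inj₂ refl))) z<s)
    next : ∀ fuel → n ≤ count S? + fuel → _
    next zero enough = contradiction (≤-trans larger (count≤n S′?))
      (≤⇒≯ (subst (n ≤_) (+-identityʳ (count S?)) enough))
    next (suc fuel) enough = grow fuel S′?
      (≤-trans enough (≤-trans (≤-reflexive (+-suc (count S?) fuel)) (+-monoˡ-≤ fuel larger)))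
      (inj₁ u∈S)
      (λ { (inj₁ Sv) → reach Sv ; (inj₂ refl) → reach Sp ◅◅ (adj ◅ here) })

  closed-set : Fin n → Disconnected G → ClosedSet
  closed-set u disconnected =
    [ (λ reach → contradiction (λ v w → Path.reverse (Graph.sym G) (reach v) ◅◅ reach w) disconnected) , id ]′
      (grow n (_≟ u) {u} (m≤n+m n (count (_≟ u))) refl λ { refl → here })

module Cuts (G : Graph n) (d : ℕ) (regular : Regular d G) where

  open Graph G renaming (sym to ~-sym)
  open PartialColorings G d regular
  open Exposure G d regular

  cut-size : {A : Pred (Fin n) 0ℓ} → Decidable A → ℕ
  cut-size A? = ∑[ p < n ] ∑[ q < n ] ⟦ leaving? A? p q ⟧

  module _ (U : EdgeSet G) where

    open EdgeSet U renaming (sym to Has-sym)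

    edge? : ∀ u v → Dec _
    edge? u v = (u Fin.<? v) ×-dec has? u v

    size-sum : size U ≡ ∑[ u < n ] ∑[ v < n ] ⟦ edge? u v ⟧
    size-sum = length-filter-product (λ (u , v) → edge? u v) id id

    cut⊆ : (S : ClosedSet (G ∖ U)) → ∀ {p q} → Leaving (ClosedSet.Member S) p q → Has p q
    cut⊆ S {p} {q} (a , ¬b , adj) = decidable-stable (has? p q) λ ¬has →
      ClosedSet.closed S a ¬b (adj , ¬has)

    -- `size` puts the smaller endpoint of an edge first, `cut-size` the endpoint in `A`. After the
    -- decreasing pairs are reversed they still do not collide with the increasing ones, since an
    -- edge leaves `A` in one direction only.
    cut-size≤size : {A : Pred (Fin n) 0ℓ} (A? : Decidable A) →
                    (∀ {p q} → Leaving A p q → Has p q) → cut-size A? ≤ size U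
    cut-size≤size {A} A? ⊆U = begin
      cut-size A?                                                         ≤⟨ double-sum-mono orient ⟩
      ∑[ p < n ] ∑[ q < n ] (⟦ up? p q ⟧ + ⟦ down? p q ⟧)                 ≡⟨ double-sum-+ (λ p q → ⟦ up? p q ⟧) (λ p q → ⟦ down? p q ⟧) ⟩
      (∑[ p < n ] ∑[ q < n ] ⟦ up? p q ⟧) + (∑[ p < n ] ∑[ q < n ] ⟦ down? p q ⟧)
        ≡⟨ cong ((∑[ p < n ] ∑[ q < n ] ⟦ up? p q ⟧) +_) (∑-comm (λ p q → ⟦ down? p q ⟧)) ⟩
      (∑[ p < n ] ∑[ q < n ] ⟦ up? p q ⟧) + (∑[ p < n ] ∑[ q < n ] ⟦ down? q p ⟧)
        ≡⟨ double-sum-+ (λ p q → ⟦ up? p q ⟧) (λ p q → ⟦ down? q p ⟧) ⟨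
      ∑[ p < n ] ∑[ q < n ] (⟦ up? p q ⟧ + ⟦ down? q p ⟧)
        ≤⟨ double-sum-mono (λ p q → ⟦⟧-disjoint (edge? p q) (up? p q) (down? q p)
             (λ (lt , l) → lt , ⊆U l) (λ (lt , l) → lt , Has-sym (⊆U l))
             (λ (_ , a , _) (_ , _ , ¬a , _) → ¬a a)) ⟩
      ∑[ p < n ] ∑[ q < n ] ⟦ edge? p q ⟧                                 ≡⟨ size-sum ⟨
      size U                                                              ∎
      where
      open ≤-Reasoning
      up? = λ p q → (p Fin.<? q) ×-dec leaving? A? p q
      down? = λ p q → (q Fin.<? p) ×-dec leaving? A? p q
      orient : ∀ p q → ⟦ leaving? A? p q ⟧ ≤ ⟦ up? p q ⟧ + ⟦ down? p q ⟧
      orient p q = ⟦⟧-cover (leaving? A? p q) (up? p q) (down? p q) split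
        where
        split : Leaving A p q → _
        split l@(_ , _ , adj) with Fin.<-cmp p q
        ... | tri< lt _ _ = inj₁ (lt , l)
        ... | tri≈ _ eq _ = contradiction eq (~⇒≢ adj)
        ... | tri> _ _ gt = inj₂ (gt , l)

  Isolates : Pred (Fin n) 0ℓ → Fin n → Set
  Isolates A w = (A w × (∀ {v} → A v → v ≡ w)) ⊎ (¬ A w × (∀ {v} → ¬ A v → v ≡ w))

  isolating-cut : {A : Pred (Fin n) 0ℓ} (A? : Decidable A) {w : Fin n} → Isolates A w → d ≤ cut-size A?
  isolating-cut A? {w} (inj₁ (a , only)) = begin
    d                       ≡⟨ degree-count w ⟨
    count (w ~?_)           ≤⟨ count-mono (w ~?_) (leaving? A? w) (λ adj → a , (λ b → ~⇒≢ adj (sym (only b))) , adj) ⟩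
    count (leaving? A? w)   ≤⟨ term≤sum (λ p → count (leaving? A? p)) w ⟩
    cut-size A?             ∎
    where open ≤-Reasoning
  isolating-cut {A} A? {w} (inj₂ (¬a , only)) = begin
    d                                             ≡⟨ degree-count w ⟨
    count (w ~?_)                                 ≤⟨ count-mono (w ~?_) (λ p → leaving? A? p w)
                                                       (λ {p} adj → decidable-stable (A? p) (λ ¬p → ~⇒≢ adj (sym (only ¬p))) , ¬a , ~-sym adj) ⟩
    count (λ p → leaving? A? p w)                 ≤⟨ term≤sum (λ q → count (λ p → leaving? A? p q)) w ⟩
    ∑[ q < n ] ∑[ p < n ] ⟦ leaving? A? p q ⟧     ≡⟨ ∑-comm (λ q p → ⟦ leaving? A? p q ⟧) ⟩
    cut-size A?                                   ∎
    where open ≤-Reasoning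

  isolates-by-count : {A : Pred (Fin n) 0ℓ} (A? : Decidable A) → ∃ A → ¬ (2 ≤ count A?) →
                      ∃ λ w → A w × (∀ {v} → A v → v ≡ w)
  isolates-by-count {A} A? (w , a) small = w , a , λ {v} b → decidable-stable (v ≟ w) λ v≢w →
    small (≤-trans (s≤s (count-∃ (without? A? w) (v , b , v≢w))) (≤-reflexive (count-without A? a)))

  star-size : ∀ w → size (incidentEdges G w) ≡ d
  star-size w = ≤-antisym upper
    (≤-trans (isolating-cut (_≟ w) (inj₁ (refl , id)))
      (cut-size≤size (incidentEdges G w) (_≟ w) λ (p≡w , _ , adj) → adj , inj₁ p≡w))
    where
    open ≤-Reasoning
    E? = edge? (incidentEdges G w)
    after? = λ v → (w Fin.<? v) ×-dec (w ~? v)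
    before? = λ u → (u Fin.<? w) ×-dec (w ~? u)
    first? = λ u v → (u ≟ w) ×-dec after? v
    second? = λ u v → (v ≟ w) ×-dec before? u
    delta : {X : Set} (x? : Dec X) → count (λ u → (u ≟ w) ×-dec x?) ≤ ⟦ x? ⟧
    delta (yes x) = count-≤1 (λ u → (u ≟ w) ×-dec yes x) λ (eq , _) (eq′ , _) → trans eq (sym eq′)
    delta (no ¬x) = ≤-reflexive (count-none (λ u → (u ≟ w) ×-dec no ¬x) λ _ → ¬x ∘ proj₂)
    upper : size (incidentEdges G w) ≤ d
    upper = begin
      size (incidentEdges G w)                                           ≡⟨ size-sum (incidentEdges G w) ⟩
      ∑[ u < n ] ∑[ v < n ] ⟦ E? u v ⟧                                   ≤⟨ double-sum-mono (λ u v → ⟦⟧-cover (E? u v) (first? u v) (second? u v)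
                                                                              λ { (lt , adj , inj₁ refl) → inj₁ (refl , lt , adj)
                                                                                ; (lt , adj , inj₂ refl) → inj₂ (refl , lt , ~-sym adj) }) ⟩
      ∑[ u < n ] ∑[ v < n ] (⟦ first? u v ⟧ + ⟦ second? u v ⟧)           ≡⟨ double-sum-+ (λ u v → ⟦ first? u v ⟧) (λ u v → ⟦ second? u v ⟧) ⟩
      (∑[ u < n ] ∑[ v < n ] ⟦ first? u v ⟧) + (∑[ u < n ] ∑[ v < n ] ⟦ second? u v ⟧)
        ≡⟨ cong (_+ (∑[ u < n ] ∑[ v < n ] ⟦ second? u v ⟧)) (∑-comm (λ u v → ⟦ first? u v ⟧)) ⟩
      (∑[ v < n ] ∑[ u < n ] ⟦ first? u v ⟧) + (∑[ u < n ] ∑[ v < n ] ⟦ second? u v ⟧)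
        ≤⟨ +-mono-≤ (sum-mono λ v → delta (after? v)) (sum-mono λ u → delta (before? u)) ⟩
      count after? + count before?                                       ≡⟨ ∑-distrib-+ (λ v → ⟦ after? v ⟧) (λ v → ⟦ before? v ⟧) ⟨
      ∑[ v < n ] (⟦ after? v ⟧ + ⟦ before? v ⟧)                          ≤⟨ sum-mono (λ v → ⟦⟧-disjoint (w ~? v) (after? v) (before? v) proj₂ proj₂
                                                                              λ (lt , _) (gt , _) → Fin.<-asym lt gt) ⟩
      count (w ~?_)                                                      ≡⟨ degree-count w ⟩
      d                                                                  ∎

  module _ (no-cut : ∀ {A : Pred (Fin n) 0ℓ} (A? : Decidable A) → 2 ≤ count A? →
                     2 ≤ count (λ v → ¬? (A? v)) → ¬ (cut-size A? ≤ d)) where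

    isolates : {A : Pred (Fin n) 0ℓ} (A? : Decidable A) → ∃ A → ∃ (λ v → ¬ A v) →
               cut-size A? ≤ d → ∃ (Isolates A)
    isolates A? in? out? small with 2 ≤? count A? | 2 ≤? count (λ v → ¬? (A? v))
    ... | yes big | yes big′ = contradiction small (no-cut A? big big′)
    ... | no ¬big | _ = let w , p = isolates-by-count A? in? ¬big in w , inj₁ p
    ... | yes _ | no ¬big = let w , p = isolates-by-count (λ v → ¬? (A? v)) out? ¬big in w , inj₂ p

    lower-bound : (U : EdgeSet G) (S : ClosedSet (G ∖ U)) → d ≤ size U
    lower-bound U S = ≤-trans by-cut (cut-size≤size U S.member? (cut⊆ U S))
      where
      module S = ClosedSet S
      by-cut : d ≤ cut-size S.member?
      by-cut with cut-size S.member? ≤? d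
      ... | no large = <⇒≤ (≰⇒> large)
      ... | yes small = isolating-cut S.member? (proj₂ (isolates S.member? S.some-in S.some-out small))

    -- The cut isolates some `w`, so `U` contains all edges at `w`. These are `d` already, and one
    -- more would exceed the bound on `U`.
    minimum-cut : (U : EdgeSet G) → ClosedSet (G ∖ U) → size U ≤ d →
                  ∃ λ w → (∀ {u v} → EdgeSet.Has U u v → u ~ v × (u ≡ w ⊎ v ≡ w)) ×
                          (∀ {u v} → u ~ v × (u ≡ w ⊎ v ≡ w) → EdgeSet.Has U u v)
    minimum-cut U S size≤d =
      w , (λ {u} {v} has → U.⊆E has , decidable-stable ((u ≟ w) ⊎-dec (v ≟ w)) (only has)) , all
      where
      module S = ClosedSet S
      module U = EdgeSet U
      isolated = isolates S.member? S.some-in S.some-out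
                   (≤-trans (cut-size≤size U S.member? (cut⊆ U S)) size≤d)
      w = proj₁ isolated
      from-w : ∀ {v} → w ~ v → U.Has w v
      from-w adj with proj₂ isolated
      ... | inj₁ (a , unique) = cut⊆ U S (a , (λ b → ~⇒≢ adj (sym (unique b))) , adj)
      ... | inj₂ (¬a , unique) = U.sym (cut⊆ U S
              (decidable-stable (S.member? _) (λ ¬b → ~⇒≢ adj (sym (unique ¬b))) , ¬a , ~-sym adj))
      all : ∀ {u v} → u ~ v × (u ≡ w ⊎ v ≡ w) → U.Has u v
      all (adj , inj₁ refl) = from-w adj
      all (adj , inj₂ refl) = U.sym (from-w (~-sym adj))
      E? = edge? (incidentEdges G w)
      U? = edge? U
      E≤U : ∀ u v → ⟦ E? u v ⟧ ≤ ⟦ U? u v ⟧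
      E≤U u v = ⟦⟧-mono (E? u v) (U? u v) λ (lt , e) → lt , all e
      ordered : ∀ {u v} → toℕ u < toℕ v → U.Has u v → ¬ (u ≡ w ⊎ v ≡ w) → ⊥
      ordered {u} {v} lt has ¬w = <⇒≱ (subst₂ _<_ (trans (sym (size-sum (incidentEdges G w))) (star-size w)) (sym (size-sum U))
          (sum-strict (λ u → ∑[ v < n ] ⟦ E? u v ⟧) (λ u → ∑[ v < n ] ⟦ U? u v ⟧) (λ u → sum-mono (E≤U u)) u
            (sum-strict (λ v → ⟦ E? u v ⟧) (λ v → ⟦ U? u v ⟧) (E≤U u) v
              (subst₂ _<_ (sym (⟦⟧-no (E? u v) (¬w ∘ proj₂ ∘ proj₂))) (sym (⟦⟧-yes (U? u v) (lt , has))) z<s)))) size≤d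
      only : ∀ {u v} → U.Has u v → ¬ ¬ (u ≡ w ⊎ v ≡ w)
      only {u} {v} has ¬w with Fin.<-cmp u v
      ... | tri< lt _ _ = ordered lt has ¬w
      ... | tri≈ _ eq _ = ~⇒≢ (U.⊆E has) eq
      ... | tri> _ _ gt = ordered gt (U.sym has) (¬w ∘ Sum.swap)

    disconnect-star : ∀ {w v : Fin n} → v ≢ w → Disconnected (G ∖ incidentEdges G w)
    disconnect-star {w} {v} v≢w connected with connected w v
    ... | here = v≢w refl
    ... | (adj , ¬inc) ◅ _ = ¬inc (adj , inj₁ refl)

    super-edge-connected : (w : Fin n) → n ≡ 1 ⊎ (∃ λ v → v ≢ w) → SuperEdgeConnected d G
    super-edge-connected w single = (cut , minimal) , λ U (disconnected , minimum) →
      minimum-cut U (closed-set (G ∖ U) w disconnected) (proj₂ minimum cut)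
      where
      cut : ∃ λ (U : EdgeSet G) → size U ≡ d × (Disconnected (G ∖ U) ⊎ n ≡ 1)
      cut = incidentEdges G w , star-size w , [ inj₂ , (λ (v , v≢w) → inj₁ (disconnect-star v≢w)) ]′ single
      minimal : ∀ {j} → (∃ λ (U : EdgeSet G) → size U ≡ j × (Disconnected (G ∖ U) ⊎ n ≡ 1)) → d ≤ j
      minimal (U , refl , inj₁ disconnected) = lower-bound U (closed-set (G ∖ U) w disconnected)
      -- On a single vertex regularity forces `d` to be zero.
      minimal (U , refl , inj₂ refl) = ≤-trans (≤-reflexive (trans (sym (degree-count w))
        (count-none (w ~?_) λ { zero adj → ~⇒≢ adj (only-zero w) }))) z≤n
        where
        only-zero : (w : Fin 1) → w ≡ zero
        only-zero zero = refl

  -- Formulated for `Subset n` instead of predicates because its existence can then be decided by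
  -- finite search. This is how an actual cut is obtained from the bare negation of
  -- super-edge-connectedness.
  NontrivialCut : Subset n → Set
  NontrivialCut S = 2 ≤ count (_∈? S) × 2 ≤ count (λ v → ¬? (v ∈? S)) × cut-size (_∈? S) ≤ d

  nontrivial-cut? : Dec (∃ NontrivialCut)
  nontrivial-cut? = anySubset? λ S →
    (2 ≤? count (_∈? S)) ×-dec ((2 ≤? count (λ v → ¬? (v ∈? S))) ×-dec (cut-size (_∈? S) ≤? d))

  as-subset : {A : Pred (Fin n) 0ℓ} → Decidable A → Subset n
  as-subset A? = tabulate (does ∘ A?)

  ∈-as-subset : {A : Pred (Fin n) 0ℓ} (A? : Decidable A) → ∀ {v} → A v → v ∈ as-subset A?
  ∈-as-subset A? {v} a = Vec.lookup⇒[]= v _ (trans (Vec.lookup∘tabulate (does ∘ A?) v) (dec-true (A? v) a))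

  as-subset-∈ : {A : Pred (Fin n) 0ℓ} (A? : Decidable A) → ∀ {v} → v ∈ as-subset A? → A v
  as-subset-∈ A? {v} v∈ with A? v | trans (sym (Vec.lookup∘tabulate (does ∘ A?) v)) (Vec.[]=⇒lookup v∈)
  ... | yes a | _ = a

  subset-cut : {A : Pred (Fin n) 0ℓ} (A? : Decidable A) → 2 ≤ count A? →
               2 ≤ count (λ v → ¬? (A? v)) → cut-size A? ≤ d → ∃ NontrivialCut
  subset-cut A? big big′ small = as-subset A? ,
    ≤-trans big (count-mono A? (_∈? as-subset A?) (∈-as-subset A?)) ,
    ≤-trans big′ (count-mono (λ v → ¬? (A? v)) (λ v → ¬? (v ∈? as-subset A?)) λ ¬a → ¬a ∘ as-subset-∈ A?) ,
    ≤-trans (double-sum-mono λ p q → ⟦⟧-mono (leaving? (_∈? as-subset A?) p q) (leaving? A? p q)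
      λ (a , ¬b , adj) → as-subset-∈ A? a , ¬b ∘ ∈-as-subset A? , adj) small

-- The upper bound and the assembly of the cases

b-coloring-bound : ∀ {d} (G : Graph n) → Regular d G → (f : Fin n → Fin k) → IsBColoring G f → k ≤ suc d
b-coloring-bound {k = zero} _ _ _ _ = z≤n
b-coloring-bound {k = suc k} {d} G regular f (_ , b-vertex) with b-vertex zero
... | v , f-v , onto = subst₂ _≤_ (count-all (suc k)) (count-near v)
    (count-transfer (λ _ → yes tt) (near? v) (λ c u → f u ≟ c) (λ {c} _ → colored c)
      λ eq eq′ → trans (sym eq) eq′)
  where
  open PartialColorings G d regular
  colored : ∀ c → ∃ λ u → Near v u × f u ≡ c
  colored c with c ≟ zero
  ... | yes refl = v , inj₁ refl , f-v
  ... | no c≢0 with proj₂ onto (λ 0≡c → c≢0 (sym 0≡c))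
  ...   | u , adj , f-u = u , inj₂ adj , f-u

halves : ∀ d → 3 ≤ d → ∃₂ λ m m′ → d ≡ m + suc m′ × 1 ≤ m × m ≤ m′ × m′ ≤ suc m
halves 3 _ = 1 , 1 , refl , ≤-refl , ≤-refl , s≤s z≤n
halves 4 _ = 1 , 2 , refl , ≤-refl , s≤s z≤n , ≤-refl
halves (suc (suc d@(suc (suc (suc _))))) _ with halves d (s≤s (s≤s (s≤s z≤n)))
... | m , m′ , eq , 1≤m , m≤m′ , m′≤1+m =
      suc m , suc m′ , cong suc (trans (cong suc eq) (sym (+-suc m (suc m′)))) , s≤s z≤n , s≤s m≤m′ , s≤s m′≤1+m
halves 0 ()
halves 1 (s≤s ())
halves 2 (s≤s (s≤s ()))

module Main (d : ℕ) (G : Graph n) (regular : Regular d G) (no-C₄ : ¬ Contains G C₄) where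

  open Graph G renaming (sym to ~-sym)
  open PartialColorings G d regular
  open Stars G d regular no-C₄
  open Exposure G d regular
  open Cuts G d regular

  BColoring : Set
  BColoring = ∃ λ (f : Fin n → Fin (suc d)) → IsBColoring G f

  across : {A B : Pred (Fin n) 0ℓ} (A? : Decidable A) (B? : Decidable B) →
           (∀ v → A v ⊎ B v) → (∀ {v} → A v → ¬ B v) → 3 ≤ d → cut-size A? ≤ d →
           ∀ {x y} → Interior A x → Interior B y → exposure A? x ≤ exposure B? y → exposure B? y ≤ 1 →
           BColoring
  across A? B? cover disjoint 3≤d small x-inner y-inner x≤y y≤1 with halves d 3≤d
  ... | m , m′ , refl , 1≤m , m≤m′ , m′≤1+m =
        two-stars A? B? cover disjoint x-inner y-inner
          (≤-trans (double-sum-mono λ p q → ⟦⟧-mono (Sides.cut? A? B? cover disjoint p q) (leaving? A? p q)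
            (cut⇒leavingA A? B? cover disjoint)) small)
          x≤y y≤1 1≤m m≤m′ m′≤1+m
    where
    open TwoStars G m m′ regular no-C₄
    open Balance G m m′ regular no-C₄

  module _ (τ : ℕ) (τ≤1 : τ ≤ 1) (τ+3≤d : τ + 3 ≤ d)
           (sparse : ∀ {u v} → u ~ v → count (λ w → (u ~? w) ×-dec (v ~? w)) ≤ τ) where

    3≤d : 3 ≤ d
    3≤d = ≤-trans (m≤n+m 3 τ) τ+3≤d

    from-cut : ∃ NontrivialCut → BColoring
    from-cut (S , big , big′ , small) = choose (little-exposure A? big small) (little-exposure B? big′ small′)
      where
      open LittleExposure G d regular no-C₄ τ τ≤1 τ+3≤d sparse using (little-exposure)
      A? = _∈? S
      B? = λ v → ¬? (v ∈? S)
      cover : ∀ v → v ∈ S ⊎ ¬ (v ∈ S)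
      cover v with v ∈? S
      ... | yes p = inj₁ p
      ... | no ¬p = inj₂ ¬p
      small′ : cut-size B? ≤ d
      small′ = ≤-trans (≤-reflexive (∑-comm (λ p q → ⟦ leaving? B? p q ⟧)))
        (≤-trans (double-sum-mono λ p q → ⟦⟧-mono (leaving? B? q p) (leaving? A? p q)
          λ (¬a , ¬¬b , adj) → decidable-stable (p ∈? S) ¬¬b , ¬a , ~-sym adj) small)
      choose : (∃ λ x → Interior (_∈ S) x × exposure A? x ≤ 1) →
               (∃ λ y → Interior (λ v → ¬ (v ∈ S)) y × exposure B? y ≤ 1) → BColoring
      choose (x , x-inner , x≤1) (y , y-inner , y≤1) with ≤-total (exposure A? x) (exposure B? y)
      ... | inj₁ x≤y = across A? B? cover (λ a ¬a → ¬a a) 3≤d small x-inner y-inner x≤y y≤1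
      ... | inj₂ y≤x = across B? A? (Sum.swap ∘ cover) id 3≤d small′ y-inner x-inner y≤x x≤1

    not-super : ¬ SuperEdgeConnected d G → (w : Fin n) → n ≡ 1 ⊎ (∃ λ v → v ≢ w) → BColoring
    not-super ¬super w single with nontrivial-cut?
    ... | yes cut = from-cut cut
    ... | no none = contradiction (super-edge-connected
            (λ A? big big′ small → none (subset-cut A? big big′ small)) w single) ¬super

  sparse : ∀ {u v} → u ~ v → count (λ w → (u ~? w) ×-dec (v ~? w)) ≤ 1
  sparse {u} {v} uv = count-≤1 (λ w → (u ~? w) ×-dec (v ~? w))
    λ (p , q) (p′ , q′) → common-neighbor (~⇒≢ uv) p p′ q q′

exists : ∀ d (G : Graph n) → Regular d G → ¬ Contains G C₄ → ¬ SuperEdgeConnected d G →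
         (w : Fin n) → n ≡ 1 ⊎ (∃ λ v → v ≢ w) → ∃ λ (f : Fin n → Fin (suc d)) → IsBColoring G f
exists 0 G regular no-C₄ _ w _ = SmallDegree.degree≤2 G 0 regular no-C₄ z≤n w
exists 1 G regular no-C₄ _ w _ = SmallDegree.degree≤2 G 1 regular no-C₄ (s≤s z≤n) w
exists 2 G regular no-C₄ _ w _ = SmallDegree.degree≤2 G 2 regular no-C₄ (s≤s (s≤s z≤n)) w
exists 3 G regular no-C₄ ¬super w single
  with any? (λ x → any? λ a → any? λ b → (x ~? a) ×-dec ((x ~? b) ×-dec (a ~? b)))
  where open Graph G
... | yes (x , a , b , xa , xb , ab) = Triangle.triangle G regular no-C₄ xa xb ab
-- Without triangles adjacent vertices have no common neighbor, and `τ = 0` makes `τ + 3 ≤ d` hold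
-- with equality.
... | no none = Main.not-super 3 G regular no-C₄ 0 z≤n ≤-refl
      (λ {u} {v} uv → ≤-reflexive (count-none (λ w → Graph._~?_ G u w ×-dec Graph._~?_ G v w)
        λ w (uw , vw) → none (u , v , w , uv , uw , vw)))
      ¬super w single
exists (suc (suc (suc (suc d)))) G regular no-C₄ ¬super w single =
  Main.not-super _ G regular no-C₄ 1 ≤-refl (s≤s (s≤s (s≤s (s≤s z≤n))))
    (Main.sparse _ G regular no-C₄) ¬super w single

theorem1 : (d n : ℕ) → .{{_ : NonZero n}} → (G : Graph n) →
    Regular d G → ¬ Contains G C₄ →
    ¬ SuperEdgeConnected d G →
    IsBChromaticNumber G (suc d)
theorem1 d (suc n) G regular no-C₄ ¬super =
  exists d G regular no-C₄ ¬super zero (alone n) , λ (f , b) → b-coloring-bound G regular f b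
  where
  alone : ∀ n → suc n ≡ 1 ⊎ (∃ λ (v : Fin (suc n)) → v ≢ zero)
  alone zero = inj₁ refl
  alone (suc n) = inj₂ (suc zero , λ ())
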